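{- Let $t \geq 2$ and $1 \leq k_1 \leq \cdots \leq k_t$ be integers with $n = k_1 + \cdots + k_t \geq 4$, let $K_{k_1,\ldots,k_t}$ have vertex set $[n]$, and let $X$ be a graph on $n$ vertices. Suppose one of the following holds: \begin{enumerate} \item $t = 2$ and $k_t < n-1$, and $X$ is connected, is non-bipartite, is not a cycle, and does not contain a $k_1$-bridge; \item $t > 2$, and $X$ is connected, is not a cycle, is not a tree, and does not contain an $(n-k_t)$-bridge. \end{enumerate} Then for any $i, j \in [n]$ and any bijection $\sigma: V(X) \to [n]$ with $\{\sigma^{ -1}(i), \sigma^{ -1}(j)\} \in E(X)$, the vertices $i$ and $j$ are $(X, K_{k_1,\ldots,k_t})$-exchangeable from $\sigma$.
   Context: All graphs are simple. For graphs $X, Y$ on $n$ vertices, the friends-and-strangers graph $\mathsf{FS}(X,Y)$ has as vertices all bijections $\sigma: V(X) \to V(Y)$; two bijections $\sigma, \sigma'$ are adjacent iff there is an edge $\{a,b\} \in E(X)$ with $\{\sigma(a),\sigma(b)\} \in E(Y)$, $\sigma'(a) = \sigma(b)$, $\sigma'(b) = \sigma(a)$, and $\sigma'(c) = \sigma(c)$ for all other $c$ (an $(X,Y)$-friendly swap). For a bijection $\sigma: V(X) \to V(Y)$ and $u, v \in V(Y)$, $u$ and $v$ are $(X,Y)$-exchangeable from $\sigma$ if some sequence of $(X,Y)$-friendly swaps takes $\sigma$ to $(u\; v)\circ\sigma$. $K_{k_1,\ldots,k_t}$ denotes the complete $t$-partite graph with partition classes of sizes $k_1,\ldots,k_t$.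 A path $v_1, \ldots, v_k$ in a graph is a $k$-bridge if each edge of the path is a cut-edge, $v_2,\ldots,v_{k-1}$ have degree $2$, and $v_1, v_k$ do not have degree $1$; a single cut-vertex is a $1$-bridge. -}

module Defs where

open import Data.Nat using (ℕ; zero; suc; _+_; _%_; _≤_; _<_)
open import Data.Fin using (Fin; toℕ; fromℕ; _≟_) renaming (zero to fz)
open import Data.Fin.Permutation.Components using (transpose)
open import Data.Bool using (Bool; true; false)
open import Data.List using (List; length; filterᵇ; filter; map)
open import Data.Nat.ListAction using (sum)
open import Data.List using () renaming (allFin to allFinL)
open import Data.Product using (Σ; ∃; _×_; _,_)
open import Data.Sum using (_⊎_)
open import Relation.Nullary using (¬_)
open import Relation.Binary.PropositionalEquality using (_≡_; _≢_)
open import Relation.Binary.Construct.Closure.ReflexiveTransitive using (Star)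
open import Function.Definitions using (Injective; Bijective)

record Graph (n : ℕ) : Set where
  field
    adj    : Fin n → Fin n → Bool
    sym    : ∀ a b → adj a b ≡ adj b a
    irrefl : ∀ a → adj a a ≡ false
open Graph public

E : ∀ {n} → Graph n → Fin n → Fin n → Set
E X a b = adj X a b ≡ true

deg : ∀ {n} → Graph n → Fin n → ℕ
deg {n} X v = length (filterᵇ (adj X v) (allFinL n))

Reach : ∀ {n} → Graph n → Fin n → Fin n → Set
Reach X = Star (E X)

Connected : ∀ {n} → Graph n → Set
Connected X = ∀ a b → Reach X a b

EdgeDel : ∀ {n} → Graph n → Fin n → Fin n → Fin n → Fin n → Set
EdgeDel X a b u w = E X u w × ¬ ((u ≡ a × w ≡ b) ⊎ (u ≡ b × w ≡ a))

-- {a,b} is a cut-edge: an edge whose endpoints are disconnected in X - ab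
-- (equivalently, deleting it increases the number of components)
IsCutEdge : ∀ {n} → Graph n → Fin n → Fin n → Set
IsCutEdge X a b = E X a b × ¬ Star (EdgeDel X a b) a b

VertDel : ∀ {n} → Graph n → Fin n → Fin n → Fin n → Set
VertDel X v u w = E X u w × u ≢ v × w ≢ v

-- v is a cut-vertex: deleting v increases the number of components, i.e.
-- some two vertices other than v are connected in X but not in X - v
IsCutVertex : ∀ {n} → Graph n → Fin n → Set
IsCutVertex X v = Σ _ λ a → Σ _ λ b →
  a ≢ v × b ≢ v × Reach X a b × ¬ Star (VertDel X v) a b

HasBridge : ∀ {n} → Graph n → ℕ → Set
HasBridge X zero = Σ _ λ (x : Fin 0) → x ≡ x   -- no 0-bridges (empty type)
HasBridge X (suc zero) = ∃ λ v → IsCutVertex X v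
HasBridge {n} X (suc (suc m)) = Σ (Fin (suc (suc m)) → Fin n) λ p →
  Injective _≡_ _≡_ p ×
  (∀ i j → suc (toℕ i) ≡ toℕ j → IsCutEdge X (p i) (p j)) ×
  (∀ i → toℕ i ≢ 0 → toℕ i ≢ suc m → deg X (p i) ≡ 2) ×
  deg X (p fz) ≢ 1 × deg X (p (fromℕ (suc m))) ≢ 1

CycAdj : ∀ {N} → Fin N → Fin N → Set
CycAdj {zero} ()
CycAdj {suc N} i j = ((toℕ i + 1) % suc N ≡ toℕ j) ⊎ ((toℕ j + 1) % suc N ≡ toℕ i)

IsCycle : ∀ {n} → Graph n → Set
IsCycle {n} X = Σ (Fin n → Fin n) λ f → Bijective _≡_ _≡_ f ×
  (∀ a b → (E X a b → CycAdj (f a) (f b)) × (CycAdj (f a) (f b) → E X a b))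

HasCycle : ∀ {n} → Graph n → Set
HasCycle {n} X = Σ ℕ λ m → Σ (Fin (3 + m) → Fin n) λ g →
  Injective _≡_ _≡_ g × (∀ i j → CycAdj i j → E X (g i) (g j))

IsTree : ∀ {n} → Graph n → Set
IsTree X = Connected X × ¬ HasCycle X

Bipartite : ∀ {n} → Graph n → Set
Bipartite {n} X = Σ (Fin n → Bool) λ c → ∀ a b → E X a b → c a ≢ c b

-- complete multipartite graph determined by a part-assignment p : [n] → [t]
MultiAdj : ∀ {n t} → (Fin n → Fin t) → Fin n → Fin n → Set
MultiAdj p a b = p a ≢ p b

partSize : ∀ {n t} → (Fin n → Fin t) → Fin t → ℕ
partSize {n} p s = length (filter (λ v → p v ≟ s) (allFinL n))

FriendlySwap : ∀ {n} → (Fin n → Fin n → Set) → (Fin n → Fin n → Set) →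
               (Fin n → Fin n) → (Fin n → Fin n) → Set
FriendlySwap EX EY σ σ' = Σ _ λ a → Σ _ λ b →
  EX a b × EY (σ a) (σ b) × σ' a ≡ σ b × σ' b ≡ σ a ×
  (∀ c → c ≢ a → c ≢ b → σ' c ≡ σ c)

Exchangeable : ∀ {n} → (Fin n → Fin n → Set) → (Fin n → Fin n → Set) →
               (Fin n → Fin n) → Fin n → Fin n → Set
Exchangeable EX EY σ u v = Σ (_ → _) λ σ' →
  Star (FriendlySwap EX EY) σ σ' × (∀ c → σ' c ≡ transpose u v (σ c))

sumFin : ∀ {t} → (Fin t → ℕ) → ℕ
sumFin {t} k = sum (map k (allFinL t))

{-# OPTIONS --safe #-}
-- Relabelling by a permutation that preserves the parts of Y commutes with friendly swaps. So the
-- permutations π with π ∘ σ reachable from σ form a group G, the same for all configurations reachable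
-- from σ, and the colour patterns of the configurations can be rearranged at will, X being connected.
--
-- Fix a part c and call the other labels blanks. At a vertex of degree 3, two tokens of colour c and two
-- blanks d, e on a claw yield (1 2)(d e) ∈ G, and (1 2) ∈ G if d and e lie in different parts. From this all
-- tokens of colour c are seen to be equivalent by letting a connected set S containing all blanks grow
-- vertex by vertex. A new vertex w is reached from a branching vertex of S through a path without branches.
-- Either there are enough blanks to fill that path, so that the token at w can be moved next to the
-- branching vertex, or the path is too long; as it is not a bridge, it then lies on a chordless cycle, around
-- which a pair of adjacent tokens can be carried to a claw. This settles the case of at least three parts.
--
-- For two parts the claw only gives products (1 2)(d e). Carrying one token around an odd cycle with an
-- even number of tokens d, as often as needed for all of them to return, is an odd permutation of the
-- tokens d. If only two of them are on the cycle, it is a transposition; otherwise the squares of products of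
-- two elements (1 2)(d e) and (3 4)(d g) provide all even permutations. So the tokens of the smaller part
-- can be exchanged, and then the claw exchanges those of the larger one.
module Submission where

open import Defs
open import Data.Nat using (ℕ; zero; suc; _+_; _*_; _∸_; _%_; _≤_; _<_; z≤n; s≤s; s≤s⁻¹; _≤?_)
import Data.Nat.Properties as ℕₚ
import Data.Nat.DivMod as DivMod
open import Data.Bool using (Bool; true; false; not; _xor_)
import Data.Bool.Properties as Boolₚ
open import Data.Fin using (Fin; fromℕ; toℕ) renaming (zero to fz)
open import Data.Fin using (zero; suc; fromℕ<; _≟_)
open import Data.Fin using () renaming (_≤_ to _≤ᶠ_)
import Data.Fin.Properties as Finₚ
open import Data.Fin.Permutation.Components using (transpose; transpose-inverse)
open import Data.List using (List; []; _∷_; _++_; length; map; filter; filterᵇ; lookup; take; drop; allFin)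
import Data.List.Properties as Listₚ
open import Data.List.Membership.Propositional using (_∈_; _∉_; find)
open import Data.List.Membership.Propositional.Properties using (∈-map⁺; ∈-map⁻; ∈-++⁺ˡ; ∈-++⁺ʳ; ∈-++⁻; ∈-∃++; ∈-allFin; ∈-filter⁺; ∈-filter⁻; ∈-lookup)
import Data.List.Membership.DecPropositional as DecMem
open import Data.List.Relation.Unary.All using (All; []; _∷_)
import Data.List.Relation.Unary.All as All
import Data.List.Relation.Unary.All.Properties as Allₚ
open import Data.List.Relation.Unary.Any using (Any; here; there)
import Data.List.Relation.Unary.Any as Any
open import Data.List.Relation.Unary.AllPairs using ([]; _∷_)
open import Data.List.Relation.Unary.Unique.Propositional using (Unique)
import Data.List.Relation.Unary.Unique.Propositional.Properties as Uniqueₚ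
open import Data.List.Relation.Binary.Permutation.Propositional using (_↭_; ↭⇒↭ₛ; ↭-trans; ↭-sym)
import Data.List.Relation.Binary.Permutation.Propositional.Properties as ↭ₚ
import Data.List.Relation.Binary.Permutation.Setoid.Properties as ↭ₛₚ
open import Data.Product using (Σ; ∃; ∃₂; _×_; _,_; proj₁; proj₂)
open import Data.Sum using (_⊎_; inj₁; inj₂; [_,_]′; swap)
open import Data.Empty using (⊥; ⊥-elim)
open import Data.Unit using (⊤; tt)
open import Relation.Nullary using (¬_; Dec; yes; no; does; contradiction)
open import Relation.Nullary.Decidable using (¬?; _×-dec_; _⊎-dec_; decidable-stable)
open import Relation.Binary.Definitions using (tri<; tri≈; tri>)
open import Relation.Binary.PropositionalEquality using (_≡_; _≢_; refl; trans; cong; cong₂; subst; subst₂; setoid) renaming (sym to ≡sym)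
open import Relation.Binary.Construct.Closure.ReflexiveTransitive using (Star; ε; _◅_; _◅◅_)
import Relation.Binary.Construct.Closure.ReflexiveTransitive as Star
open import Function using (_∘_; id; Equivalence)
open import Function.Definitions using (Injective; Bijective)

-- Two labels of different parts at the ends of an edge are exchanged by one swap, so all the work
-- concerns a single part. There any two labels prove to be exchangeable, whether they stand on
-- adjacent vertices or not.
--
-- The length `b` of the excluded bridge is the smallest number of blanks that any part leaves, so
-- that one hypothesis serves all parts; with two parts this is the size of the smaller one. To
-- bring a token to a branching vertex along a path of `b` vertices, that vertex included, would
-- take `b + 1` blanks, two of them for the claw. This is one too many when only `b` are available.
--
-- With two parts the obstacle is parity. If `X` is bipartite, each swap changes by one the number
-- of tokens of a given colour on a given side, so a reachable relabelling is the outcome of an even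
-- number of swaps and is even. Products from claws are even as well, whence the odd cycle. Tokens
-- of equal colour cannot pass each other there; such passes are only imagined, and the error is
-- controlled up to one fixed involution `θ`.

private
  variable
    n : ℕ
    A : Set

-- Lists without repetitions

uniq-∷ : {x : A} {xs : List A} → x ∉ xs → Unique xs → Unique (x ∷ xs)
uniq-∷ x∉ u = Allₚ.¬Any⇒All¬ _ x∉ ∷ u

uniq-∉ : {x : A} {xs : List A} → Unique (x ∷ xs) → x ∉ xs
uniq-∉ (px ∷ _) x∈ = All.lookup px x∈ refl

uniq-tail : {x : A} {xs : List A} → Unique (x ∷ xs) → Unique xs
uniq-tail (_ ∷ u) = u

uniq-↭ : {xs ys : List A} → xs ↭ ys → Unique xs → Unique ys
uniq-↭ {A} p = ↭ₛₚ.Unique-resp-↭ (setoid A) (↭⇒↭ₛ p)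

uniq-++-disjoint : (xs : List A) {ys : List A} {x : A} → Unique (xs ++ ys) → x ∈ xs → x ∉ ys
uniq-++-disjoint (x ∷ xs) u (here refl) x∈ys = uniq-∉ u (∈-++⁺ʳ xs x∈ys)
uniq-++-disjoint (x ∷ xs) u (there x∈) x∈ys = uniq-++-disjoint xs (uniq-tail u) x∈ x∈ys

uniq-++ˡ : (xs : List A) {ys : List A} → Unique (xs ++ ys) → Unique xs
uniq-++ˡ [] u = []
uniq-++ˡ (x ∷ xs) u = uniq-∷ (uniq-∉ u ∘ ∈-++⁺ˡ) (uniq-++ˡ xs (uniq-tail u))

uniq-++ʳ : (xs : List A) {ys : List A} → Unique (xs ++ ys) → Unique ys
uniq-++ʳ [] u = u
uniq-++ʳ (x ∷ xs) u = uniq-++ʳ xs (uniq-tail u)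

∈-tail : {x y : A} {xs : List A} → x ∈ y ∷ xs → x ≢ y → x ∈ xs
∈-tail (here e) ne = contradiction e ne
∈-tail (there m) ne = m

uniq-⊆-length : {xs ys : List A} → Unique xs → (∀ {x} → x ∈ xs → x ∈ ys) → length xs ≤ length ys
uniq-⊆-length {xs = []} u s = z≤n
uniq-⊆-length {xs = x ∷ xs} {ys} u s with ∈-∃++ (s (here refl))
... | as , bs , refl = subst (suc (length xs) ≤_) (≡sym (trans (Listₚ.length-++ as) (ℕₚ.+-suc (length as) (length bs))))
        (s≤s (subst (length xs ≤_) (Listₚ.length-++ as) (uniq-⊆-length (uniq-tail u) sub)))
  where
  sub : ∀ {y} → y ∈ xs → y ∈ as ++ bs
  sub {y} m with ∈-++⁻ as (s (there m))
  ... | inj₁ p = ∈-++⁺ˡ p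
  ... | inj₂ (here refl) = contradiction m (uniq-∉ u)
  ... | inj₂ (there p) = ∈-++⁺ʳ as p

infix 4 _∈?_
_∈?_ : (x : Fin n) (xs : List (Fin n)) → Dec (x ∈ xs)
_∈?_ = DecMem._∈?_ _≟_

pigeon : (xs ys : List (Fin n)) → Unique xs → length ys < length xs → ∃ λ x → x ∈ xs × x ∉ ys
pigeon xs ys u lt with Any.any? (λ x → ¬? (x ∈? ys)) xs
... | yes p = let x , x∈ , x∉ = find p in x , x∈ , x∉
... | no ¬p = contradiction (uniq-⊆-length u sub) (ℕₚ.<⇒≱ lt)
  where
  sub : ∀ {x} → x ∈ xs → x ∈ ys
  sub {x} m = decidable-stable (x ∈? ys) (λ x∉ → ¬p (Any.map (λ { refl → x∉ }) m))

uniq-length≤ : {xs : List (Fin n)} → Unique xs → length xs ≤ n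
uniq-length≤ {n} {xs} u = subst (length xs ≤_) (Listₚ.length-tabulate id) (uniq-⊆-length u (λ {x} _ → ∈-allFin x))

length-allFin : ∀ n → length (allFin n) ≡ n
length-allFin n = Listₚ.length-tabulate id

lookup-injective : {xs : List A} → Unique xs → Injective _≡_ _≡_ (lookup xs)
lookup-injective {xs = x ∷ xs} u {zero} {zero} e = refl
lookup-injective {xs = x ∷ xs} u {zero} {suc j} e = contradiction (subst (_∈ xs) (≡sym e) (∈-lookup {xs = xs} j)) (uniq-∉ u)
lookup-injective {xs = x ∷ xs} u {suc i} {zero} e = contradiction (subst (_∈ xs) e (∈-lookup {xs = xs} i)) (uniq-∉ u)
lookup-injective {xs = x ∷ xs} u {suc i} {suc j} e = cong suc (lookup-injective (uniq-tail u) e)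

map-≡⇒≗ : {B : Set} {f g : A → B} (xs : List A) → map f xs ≡ map g xs → ∀ {x} → x ∈ xs → f x ≡ g x
map-≡⇒≗ (x ∷ xs) e (here refl) = Listₚ.∷-injectiveˡ e
map-≡⇒≗ (x ∷ xs) e (there m) = map-≡⇒≗ xs (Listₚ.∷-injectiveʳ e) m

-- Chooses where all blanks are to stand: `ts` must receive them and `av` must not. The pigeonhole
-- principle supplies one further vertex at a time.
extend-list : (pool ts av : List (Fin n)) (k : ℕ) → Unique pool → Unique ts →
  (∀ {x} → x ∈ ts → x ∈ pool) → (∀ {x} → x ∈ ts → x ∉ av) →
  length ts ≤ k → k + length av ≤ length pool →
  ∃ λ us → Unique us × length us ≡ k × (∀ {x} → x ∈ ts → x ∈ us) ×
    (∀ {x} → x ∈ us → x ∈ pool) × (∀ {x} → x ∈ us → x ∉ av)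
extend-list pool ts av k up ut sub dis le bound = go (k ∸ length ts) ts ut (ℕₚ.m∸n+n≡m le) id sub dis
  where
  go : ∀ d us → Unique us → d + length us ≡ k → (∀ {x} → x ∈ ts → x ∈ us) →
    (∀ {x} → x ∈ us → x ∈ pool) → (∀ {x} → x ∈ us → x ∉ av) →
    ∃ λ us → Unique us × length us ≡ k × (∀ {x} → x ∈ ts → x ∈ us) ×
      (∀ {x} → x ∈ us → x ∈ pool) × (∀ {x} → x ∈ us → x ∉ av)
  go zero us uu e t⊆ p a = us , uu , e , t⊆ , p , a
  go (suc d) us uu e t⊆ p a with pigeon pool (us ++ av) up lt
    where
    lt : length (us ++ av) < length pool
    lt = ℕₚ.<-≤-trans (subst (_< k + length av) (≡sym (Listₚ.length-++ us))
           (ℕₚ.+-monoˡ-< (length av) (subst (length us <_) e (s≤s (ℕₚ.m≤n+m _ d))))) bound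
  ... | x , x∈ , x∉ = go d (x ∷ us) (uniq-∷ (x∉ ∘ ∈-++⁺ˡ) uu) (trans (ℕₚ.+-suc d _) e) (there ∘ t⊆)
        (λ { (here refl) → x∈ ; (there m) → p m })
        (λ { (here refl) → x∉ ∘ ∈-++⁺ʳ us ; (there m) → a m })

least : {P : ℕ → Set} → (∀ k → Dec (P k)) → ∀ k → P k → ∃ λ m → P m × (∀ j → j < m → ¬ P j) × m ≤ k
least P? zero p = zero , p , (λ _ ()) , z≤n
least P? (suc k) p with P? zero
... | yes p0 = zero , p0 , (λ _ ()) , z≤n
... | no ¬p0 with least (P? ∘ suc) k p
... | m , pm , min , le = suc m , pm , (λ { zero _ → ¬p0 ; (suc j) (s≤s lt) → min j lt }) , s≤s le

-- Transpositions and their products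

data TransposeView (i j k : Fin n) : Fin n → Set where
  hitˡ : k ≡ i → TransposeView i j k j
  hitʳ : k ≢ i → k ≡ j → TransposeView i j k i
  miss : k ≢ i → k ≢ j → TransposeView i j k k

transpose-view : (i j k : Fin n) → TransposeView i j k (transpose i j k)
transpose-view i j k with k ≟ i
... | yes p = hitˡ p
... | no ¬p with k ≟ j
...   | yes q = hitʳ ¬p q
...   | no ¬q = miss ¬p ¬q

transpose-ˡ : (i j : Fin n) → transpose i j i ≡ j
transpose-ˡ i j with transpose i j i | transpose-view i j i
... | _ | hitˡ _ = refl
... | _ | hitʳ ne _ = contradiction refl ne
... | _ | miss ne _ = contradiction refl ne

transpose-ʳ : (i j : Fin n) → transpose i j j ≡ i
transpose-ʳ i j with transpose i j j | transpose-view i j j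
... | _ | hitˡ e = e
... | _ | hitʳ _ _ = refl
... | _ | miss _ ne = contradiction refl ne

transpose-≢ : {i j k : Fin n} → k ≢ i → k ≢ j → transpose i j k ≡ k
transpose-≢ {i = i} {j} {k} p q with transpose i j k | transpose-view i j k
... | _ | hitˡ e = contradiction e p
... | _ | hitʳ _ e = contradiction e q
... | _ | miss _ _ = refl

transpose-comm : (i j k : Fin n) → transpose i j k ≡ transpose j i k
transpose-comm i j k with transpose i j k | transpose-view i j k
... | _ | hitˡ refl = ≡sym (transpose-ʳ j i)
... | _ | hitʳ _ refl = ≡sym (transpose-ˡ j i)
... | _ | miss p q = ≡sym (transpose-≢ q p)

transpose-involutive : (i j k : Fin n) → transpose i j (transpose i j k) ≡ k
transpose-involutive i j k = trans (cong (transpose i j) (transpose-comm i j k)) (transpose-inverse i j)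

transpose-refl : (i k : Fin n) → transpose i i k ≡ k
transpose-refl i k with transpose i i k | transpose-view i i k
... | _ | hitˡ e = ≡sym e
... | _ | hitʳ _ e = ≡sym e
... | _ | miss _ _ = refl

transpose-natural : ∀ {m} {f : Fin m → Fin n} → Injective _≡_ _≡_ f → (i j k : Fin m) →
  f (transpose i j k) ≡ transpose (f i) (f j) (f k)
transpose-natural {f = f} inj i j k with transpose i j k | transpose-view i j k
... | _ | hitˡ refl = ≡sym (transpose-ˡ (f k) (f j))
... | _ | hitʳ _ refl = ≡sym (transpose-ʳ (f i) (f k))
... | _ | miss p q = ≡sym (transpose-≢ (p ∘ inj) (q ∘ inj))

transpose-injective : (i j : Fin n) → Injective _≡_ _≡_ (transpose i j)
transpose-injective i j {a} {b} e =
  trans (≡sym (transpose-involutive i j a)) (trans (cong (transpose i j) e) (transpose-involutive i j b))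

transpose-resp : {B : Set} {i j : Fin n} (f : Fin n → B) → f i ≡ f j → ∀ k → f (transpose i j k) ≡ f k
transpose-resp {i = i} {j} f e k with transpose i j k | transpose-view i j k
... | _ | hitˡ refl = ≡sym e
... | _ | hitʳ _ refl = e
... | _ | miss _ _ = refl

transpose-conj : {i j k : Fin n} → i ≢ j → j ≢ k → i ≢ k → ∀ l →
  transpose i j (transpose j k (transpose i j l)) ≡ transpose i k l
transpose-conj {i = i} {j} {k} i≢j j≢k i≢k l =
  trans (transpose-natural (transpose-injective i j) j k (transpose i j l))
        (trans (cong (λ z → transpose z (transpose i j k) (transpose i j (transpose i j l))) (transpose-ʳ i j))
        (trans (cong (λ z → transpose i z (transpose i j (transpose i j l))) (transpose-≢ (i≢k ∘ ≡sym) (j≢k ∘ ≡sym)))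
               (cong (transpose i k) (transpose-involutive i j l))))

-- act ι s is the product of the transpositions (ι i  ι j), the head of s being the outermost factor.
-- Identities between such products with ι injective are thereby reduced to closed computations in Fin k.
act : ∀ {k} → (Fin k → Fin n) → List (Fin k × Fin k) → Fin n → Fin n
act ι [] v = v
act ι ((i , j) ∷ s) v = transpose (ι i) (ι j) (act ι s v)

module _ {k} {ι : Fin k → Fin n} (inj : Injective _≡_ _≡_ ι) where

  act-image : ∀ s m → act ι s (ι m) ≡ ι (act id s m)
  act-image [] m = refl
  act-image ((i , j) ∷ s) m = trans (cong (transpose (ι i) (ι j)) (act-image s m)) (≡sym (transpose-natural inj i j _))

  act-outside : ∀ s {v} → (∀ m → v ≢ ι m) → act ι s v ≡ v
  act-outside [] o = refl
  act-outside ((i , j) ∷ s) o = trans (cong (transpose (ι i) (ι j)) (act-outside s o)) (transpose-≢ (o i) (o j))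

  act-≗ : ∀ s s′ → (∀ m → act id s m ≡ act id s′ m) → ∀ v → act ι s v ≡ act ι s′ v
  act-≗ s s′ e v with Finₚ.any? (λ m → v ≟ ι m)
  ... | yes (m , refl) = trans (act-image s m) (trans (cong ι (e m)) (≡sym (act-image s′ m)))
  ... | no ¬p = trans (act-outside s out) (≡sym (act-outside s′ out))
    where
    out : ∀ m → v ≢ ι m
    out m q = ¬p (m , q)

-- Configurations and legal moves

module Moves {n t : ℕ} (X : Graph n) (col : Fin n → Fin t) where

  E-sym : ∀ {a b} → E X a b → E X b a
  E-sym {a} {b} e = trans (sym X b a) e

  E-≢ : ∀ {a b} → E X a b → a ≢ b
  E-≢ {a} e refl with trans (≡sym e) (irrefl X a)
  ... | ()

  infix 4 _⇝_ _⇝[_]_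

  -- Paths end up to pointwise equality, since the identities between products of transpositions
  -- that are applied to their ends hold pointwise.
  data _⇝_ (σ τ : Fin n → Fin n) : Set where
    done : (∀ v → σ v ≡ τ v) → σ ⇝ τ
    move : ∀ a b → E X a b → col (σ a) ≢ col (σ b) → (σ ∘ transpose a b) ⇝ τ → σ ⇝ τ

  ⇝-refl : ∀ {σ} → σ ⇝ σ
  ⇝-refl = done (λ _ → refl)

  ⇝-respˡ : ∀ {σ σ′ τ} → (∀ v → σ v ≡ σ′ v) → σ ⇝ τ → σ′ ⇝ τ
  ⇝-respˡ e (done f) = done (λ v → trans (≡sym (e v)) (f v))
  ⇝-respˡ e (move a b ab c p) =
    move a b ab (subst₂ (λ x y → col x ≢ col y) (e a) (e b) c) (⇝-respˡ (e ∘ transpose a b) p)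

  ⇝-trans : ∀ {σ τ ρ} → σ ⇝ τ → τ ⇝ ρ → σ ⇝ ρ
  ⇝-trans (done f) q = ⇝-respˡ (≡sym ∘ f) q
  ⇝-trans (move a b ab c p) q = move a b ab c (⇝-trans p q)

  ⇝-respʳ : ∀ {σ τ τ′} → (∀ v → τ v ≡ τ′ v) → σ ⇝ τ → σ ⇝ τ′
  ⇝-respʳ e p = ⇝-trans p (done e)

  ⇝-move : ∀ {σ a b} → E X a b → col (σ a) ≢ col (σ b) → σ ⇝ σ ∘ transpose a b
  ⇝-move {a = a} {b} ab c = move a b ab c ⇝-refl

  ⇝-sym : ∀ {σ τ} → σ ⇝ τ → τ ⇝ σ
  ⇝-sym (done f) = done (≡sym ∘ f)
  ⇝-sym {σ} (move a b ab c p) = ⇝-trans (⇝-sym p)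
    (move a b ab (subst₂ (λ x y → col (σ x) ≢ col (σ y)) (≡sym (transpose-ˡ a b)) (≡sym (transpose-ʳ a b)) (c ∘ ≡sym))
      (done (λ v → cong σ (transpose-involutive a b v))))

  ColourPreserving : (Fin n → Fin n) → Set
  ColourPreserving π = ∀ l → col (π l) ≡ col l

  transpose-cp : ∀ {i j} → col i ≡ col j → ColourPreserving (transpose i j)
  transpose-cp = transpose-resp col

  ∘-cp : ∀ {π ρ} → ColourPreserving π → ColourPreserving ρ → ColourPreserving (π ∘ ρ)
  ∘-cp {ρ = ρ} p q l = trans (p (ρ l)) (q l)

  ⇝-relabel : ∀ {σ τ π} → ColourPreserving π → σ ⇝ τ → π ∘ σ ⇝ π ∘ τ
  ⇝-relabel {π = π} cp (done f) = done (cong π ∘ f)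
  ⇝-relabel {σ} cp (move a b ab c p) =
    move a b ab (c ∘ subst₂ _≡_ (cp (σ a)) (cp (σ b))) (⇝-relabel cp p)

  ⇝-injective : ∀ {σ τ} → Injective _≡_ _≡_ σ → σ ⇝ τ → Injective _≡_ _≡_ τ
  ⇝-injective inj (done f) e = inj (trans (f _) (trans e (≡sym (f _))))
  ⇝-injective inj (move a b _ _ p) e = ⇝-injective (transpose-injective a b ∘ inj) p e

  ⇝-conj : ∀ {σ τ π} → ColourPreserving π → σ ⇝ τ → σ ⇝ π ∘ σ → τ ⇝ π ∘ τ
  ⇝-conj cp p q = ⇝-trans (⇝-sym p) (⇝-trans q (⇝-relabel cp p))

  ⇝-comp : ∀ {σ} π ρ → ColourPreserving π → σ ⇝ π ∘ σ → σ ⇝ ρ ∘ σ → σ ⇝ π ∘ ρ ∘ σ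
  ⇝-comp _ _ cp p q = ⇝-trans p (⇝-relabel cp q)

  injective⇒surjective : ∀ {σ : Fin n → Fin n} → Injective _≡_ _≡_ σ → ∀ l → ∃ λ v → σ v ≡ l
  injective⇒surjective {σ} inj l with Finₚ.any? (λ v → σ v ≟ l)
  ... | yes p = p
  ... | no ¬p = contradiction (uniq-length≤ (uniq-∷ l∉ (Uniqueₚ.map⁺ inj (Uniqueₚ.allFin⁺ n))))
                  (subst (λ k → ¬ suc k ≤ n) (≡sym (trans (Listₚ.length-map σ (allFin n)) (length-allFin n))) (ℕₚ.<-irrefl refl))
    where
    l∉ : l ∉ map σ (allFin n)
    l∉ m with ∈-map⁻ σ m
    ... | v , _ , e = ¬p (v , ≡sym e)

  _⇝[_]_ : (Fin n → Fin n) → List (Fin n) → (Fin n → Fin n) → Set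
  σ ⇝[ S ] τ = σ ⇝ τ × (∀ {v} → v ∉ S → τ v ≡ σ v)

  ⇝[]-refl : ∀ {σ S} → σ ⇝[ S ] σ
  ⇝[]-refl = ⇝-refl , λ _ → refl

  ⇝[]-trans : ∀ {σ τ ρ S} → σ ⇝[ S ] τ → τ ⇝[ S ] ρ → σ ⇝[ S ] ρ
  ⇝[]-trans (p , f) (q , g) = ⇝-trans p q , λ o → trans (g o) (f o)

  ⇝[]-label : ∀ {σ τ S x} → Injective _≡_ _≡_ σ → σ ⇝[ S ] τ → x ∈ S → ∃ λ y → y ∈ S × τ y ≡ σ x
  ⇝[]-label {σ} {τ} {S} {x} inj (p , f) x∈ with injective⇒surjective (⇝-injective inj p) (σ x)
  ... | y , e = y , decidable-stable (y ∈? S) (λ y∉ → y∉ (subst (_∈ S) (inj (trans (≡sym e) (f y∉))) x∈)) , e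

  ConnectedIn : List (Fin n) → Fin n → Fin n → Set
  ConnectedIn S = Star (λ u v → E X u v × u ∈ S × v ∈ S)

  ConnectedIn-sym : ∀ {S x y} → ConnectedIn S x y → ConnectedIn S y x
  ConnectedIn-sym ε = ε
  ConnectedIn-sym ((e , p , q) ◅ s) = ConnectedIn-sym s ◅◅ ((E-sym e , q , p) ◅ ε)

  -- Up to the labels, any two positions joined by an edge can be exchanged: there is nothing to do
  -- when their colours agree.
  colour-transpose-edge : ∀ {S a b} → E X a b → a ∈ S → b ∈ S → ∀ σ →
    ∃ λ τ → σ ⇝[ S ] τ × (∀ v → col (τ v) ≡ col (σ (transpose a b v)))
  colour-transpose-edge {S} {a} {b} e a∈ b∈ σ with col (σ a) ≟ col (σ b)
  ... | yes q = σ , ⇝[]-refl , λ v → ≡sym (transpose-resp (col ∘ σ) q v)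
  ... | no ¬q = σ ∘ transpose a b
              , (⇝-move e ¬q , λ {v} v∉ → cong σ (transpose-≢ (λ { refl → v∉ a∈ }) (λ { refl → v∉ b∈ })))
              , λ _ → refl

  -- Exchanging along the first edge, then `z` with `y`, then along the first edge again is a
  -- conjugation; the intermediate vertices of the path recover their colours.
  colour-transpose : ∀ {S x y} → ConnectedIn S x y → ∀ σ →
    ∃ λ τ → σ ⇝[ S ] τ × (∀ v → col (τ v) ≡ col (σ (transpose x y v)))
  colour-transpose {S} {x} ε σ = σ , ⇝[]-refl , λ v → cong (col ∘ σ) (≡sym (transpose-refl x v))
  colour-transpose {S} {x} {y} (_◅_ {j = z} (e , x∈ , z∈) s) σ with x ≟ y | z ≟ y
  ... | yes refl | _ = σ , ⇝[]-refl , λ v → cong (col ∘ σ) (≡sym (transpose-refl x v))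
  ... | no _ | yes refl = colour-transpose-edge e x∈ z∈ σ
  ... | no x≢y | no z≢y with colour-transpose-edge e x∈ z∈ σ
  ...   | σ₁ , r₁ , c₁ with colour-transpose s σ₁
  ...     | σ₂ , r₂ , c₂ with colour-transpose-edge e x∈ z∈ σ₂
  ...       | σ₃ , r₃ , c₃ = σ₃ , ⇝[]-trans r₁ (⇝[]-trans r₂ r₃) , λ v →
                trans (c₃ v) (trans (c₂ _) (trans (c₁ _) (cong (col ∘ σ) (transpose-conj (E-≢ e) z≢y x≢y v))))

  module Gadget {k : ℕ} {ι : Fin k → Fin n} (inj : Injective _≡_ _≡_ ι) {cs : List (Fin t)} (distinct : Unique cs)
                (κ : Fin k → Fin (length cs)) {σ : Fin n → Fin n} (hκ : ∀ i → col (σ (ι i)) ≡ lookup cs (κ i)) where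

    -- `g m` is the slot from which the token now in slot `m` came. Legality of a fixed word of
    -- swaps thus becomes a list of inequalities between closed terms. The head of the word is
    -- carried out first.
    Valid : (Fin k → Fin k) → List (Fin k × Fin k) → Set
    Valid g [] = ⊤
    Valid g ((i , j) ∷ s) = κ (g i) ≢ κ (g j) × E X (ι i) (ι j) × Valid (g ∘ transpose i j) s

    run : ∀ s → Valid id s → σ ⇝ σ ∘ act ι s
    run s = go id s σ (λ _ → refl)
      where
      go : ∀ g s τ → (∀ m → τ (ι m) ≡ σ (ι (g m))) → Valid g s → τ ⇝ τ ∘ act ι s
      go g [] τ h _ = ⇝-refl
      go g ((i , j) ∷ s) τ h (c , e , v) =
        move (ι i) (ι j) e
          (λ q → c (lookup-injective distinct
            (trans (≡sym (colour i)) (trans q (colour j)))))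
          (go (g ∘ transpose i j) s (τ ∘ transpose (ι i) (ι j))
            (λ m → trans (cong τ (≡sym (transpose-natural inj i j m))) (h (transpose i j m))) v)
        where
        colour : ∀ i → col (τ (ι i)) ≡ lookup cs (κ (g i))
        colour i = trans (cong col (h i)) (hκ (g i))

  module Claw {z x a b : Fin n} (u : Unique (z ∷ x ∷ a ∷ b ∷ []))
              (zx : E X z x) (za : E X z a) (zb : E X z b)
              {σ : Fin n → Fin n} (inj : Injective _≡_ _≡_ σ) (same : col (σ x) ≡ col (σ z))
              (a≢ : col (σ z) ≢ col (σ a)) (b≢ : col (σ z) ≢ col (σ b)) where
    private
      ι : Fin 4 → Fin n
      ι = lookup (z ∷ x ∷ a ∷ b ∷ [])

      pattern #z = zero
      pattern #x = suc zero
      pattern #a = suc (suc zero)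
      pattern #b = suc (suc (suc zero))

      -- `swaps₂` goes through the leaves `b`, `x`, `a` twice. One round is a 4-cycle, whose square
      -- is a double transposition, here `(z x)(a b)`. `swaps₁` appends the conjugate of `(z b)` by
      -- `(z a)`, which undoes the exchange of `a` and `b`; its middle swap requires those two
      -- blanks to differ in colour.
      swaps₂ swaps₁ : List (Fin 4 × Fin 4)
      swaps₂ = (#z , #b) ∷ (#z , #x) ∷ (#z , #a) ∷ (#z , #b) ∷ (#z , #x) ∷ (#z , #a) ∷ []
      swaps₁ = (#z , #b) ∷ (#z , #x) ∷ (#z , #a) ∷ (#z , #b) ∷ (#z , #x) ∷ (#z , #a) ∷ (#z , #a) ∷ (#z , #b) ∷ (#z , #a) ∷ []

    exchange-both : col (σ b) ≡ col (σ a) → σ ⇝ transpose (σ z) (σ x) ∘ transpose (σ a) (σ b) ∘ σ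
    exchange-both ba = ⇝-respʳ eq
      (Gadget.run (lookup-injective u) {col (σ z) ∷ col (σ a) ∷ []} (uniq-∷ (λ { (here q) → a≢ q }) (uniq-∷ (λ ()) []))
        (lookup (zero ∷ zero ∷ suc zero ∷ suc zero ∷ []))
        (λ { #z → refl ; #x → same ; #a → refl ; #b → ba }) swaps₂
        ((λ ()) , zb , (λ ()) , zx , (λ ()) , za , (λ ()) , zb , (λ ()) , zx , (λ ()) , za , tt))
      where
      eq : ∀ v → σ (act ι swaps₂ v) ≡ transpose (σ z) (σ x) (transpose (σ a) (σ b) (σ v))
      eq v = trans (cong σ (act-≗ (lookup-injective u) swaps₂ ((#z , #x) ∷ (#a , #b) ∷ [])
                     (λ { #z → refl ; #x → refl ; #a → refl ; #b → refl }) v))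
             (trans (transpose-natural inj z x _) (cong (transpose (σ z) (σ x)) (transpose-natural inj a b v)))

    exchange : col (σ a) ≢ col (σ b) → σ ⇝ transpose (σ z) (σ x) ∘ σ
    exchange a≢b = ⇝-respʳ eq
      (Gadget.run (lookup-injective u) {col (σ z) ∷ col (σ a) ∷ col (σ b) ∷ []}
        (uniq-∷ (λ { (here q) → a≢ q ; (there (here q)) → b≢ q }) (uniq-∷ (λ { (here q) → a≢b q }) (uniq-∷ (λ ()) [])))
        (lookup (zero ∷ zero ∷ suc zero ∷ suc (suc zero) ∷ []))
        (λ { #z → refl ; #x → same ; #a → refl ; #b → refl }) swaps₁
        ((λ ()) , zb , (λ ()) , zx , (λ ()) , za , (λ ()) , zb , (λ ()) , zx , (λ ()) , za ,
         (λ ()) , za , (λ ()) , zb , (λ ()) , za , tt))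
      where
      eq : ∀ v → σ (act ι swaps₁ v) ≡ transpose (σ z) (σ x) (σ v)
      eq v = trans (cong σ (act-≗ (lookup-injective u) swaps₁ ((#z , #x) ∷ [])
                     (λ { #z → refl ; #x → refl ; #a → refl ; #b → refl }) v))
             (transpose-natural inj z x v)

-- Shortest paths and cycles

E? : (X : Graph n) → ∀ a b → Dec (E X a b)
E? X a b = adj X a b Boolₚ.≟ true

EdgeDel? : (X : Graph n) → ∀ a b u w → Dec (EdgeDel X a b u w)
EdgeDel? X a b u w = E? X u w ×-dec ¬? (((u ≟ a) ×-dec (w ≟ b)) ⊎-dec ((u ≟ b) ×-dec (w ≟ a)))

module Distance {n : ℕ} (R : Fin n → Fin n → Set) (R? : ∀ u v → Dec (R u v)) (r : Fin n) where

  Walk : ℕ → Fin n → Set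
  Walk zero v = v ≡ r
  Walk (suc k) v = ∃ λ u → R v u × Walk k u

  Walk? : ∀ k v → Dec (Walk k v)
  Walk? zero v = v ≟ r
  Walk? (suc k) v = Finₚ.any? (λ u → R? v u ×-dec Walk? k u)

  Walk⇒Star : ∀ k {v} → Walk k v → Star R v r
  Walk⇒Star zero refl = ε
  Walk⇒Star (suc k) (u , e , w) = e ◅ Walk⇒Star k w

  Star⇒Walk : ∀ {v} → Star R v r → ∃ λ k → Walk k v
  Star⇒Walk ε = zero , refl
  Star⇒Walk (e ◅ s) with Star⇒Walk s
  ... | k , w = suc k , _ , e , w

  Dist : ℕ → Fin n → Set
  Dist k v = Walk k v × (∀ j → j < k → ¬ Walk j v)

  dist : ∀ {v} → Star R v r → ∃ λ k → Dist k v
  dist {v} s with Star⇒Walk s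
  ... | k , w with least (λ j → Walk? j v) k w
  ... | m , wm , min , _ = m , wm , min

  Dist-≤ : ∀ {j k v} → Walk j v → Dist k v → k ≤ j
  Dist-≤ {j} {k} w (_ , min) with k ≤? j
  ... | yes p = p
  ... | no ¬p = contradiction w (min j (ℕₚ.≰⇒> ¬p))

  Dist-unique : ∀ {j k v} → Dist j v → Dist k v → j ≡ k
  Dist-unique d e = ℕₚ.≤-antisym (Dist-≤ (proj₁ e) d) (Dist-≤ (proj₁ d) e)

  Dist-step : ∀ {k v} → Dist (suc k) v → ∃ λ u → R v u × Dist k u
  Dist-step ((u , e , w) , min) = u , e , w , λ j lt w′ → min (suc j) (s≤s lt) (u , e , w′)

  Dist-zero : Dist 0 r
  Dist-zero = refl , λ _ ()

  data Geodesic : ℕ → Fin n → List (Fin n) → Set where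
    stop : Geodesic 0 r (r ∷ [])
    step : ∀ {k v u us} → R v u → Dist (suc k) v → Geodesic k u us → Geodesic (suc k) v (v ∷ us)

  geodesic : ∀ k {v} → Dist k v → ∃ λ us → Geodesic k v us
  geodesic zero (refl , _) = _ , stop
  geodesic (suc k) d with Dist-step d
  ... | u , e , d′ with geodesic k d′
  ... | us , g = _ , step e d g

  Geodesic-Dist : ∀ {k v us} → Geodesic k v us → Dist k v
  Geodesic-Dist stop = Dist-zero
  Geodesic-Dist (step _ d _) = d

  Geodesic-∈ : ∀ {k v us x} → Geodesic k v us → x ∈ us → ∃ λ j → j ≤ k × Dist j x
  Geodesic-∈ stop (here refl) = 0 , z≤n , Dist-zero
  Geodesic-∈ (step _ d _) (here refl) = _ , ℕₚ.≤-refl , d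
  Geodesic-∈ (step _ _ g) (there m) with Geodesic-∈ g m
  ... | j , le , d = j , ℕₚ.m≤n⇒m≤1+n le , d

  Geodesic-unique : ∀ {k v us} → Geodesic k v us → Unique us
  Geodesic-unique stop = uniq-∷ (λ ()) []
  Geodesic-unique (step e d g) = uniq-∷ v∉ (Geodesic-unique g)
    where
    v∉ : _ ∉ _
    v∉ m with Geodesic-∈ g m
    ... | j , le , d′ = ℕₚ.<-irrefl (Dist-unique d′ d) (s≤s le)

  Geodesic-length : ∀ {k v us} → Geodesic k v us → length us ≡ suc k
  Geodesic-length stop = refl
  Geodesic-length (step _ _ g) = cong suc (Geodesic-length g)

  -- Distances strictly decrease along a shortest path. The levels can therefore serve as the
  -- numbering of a cycle.
  Geodesic-injective : ∀ {k v us j x y} → Geodesic k v us → x ∈ us → y ∈ us → Dist j x → Dist j y → x ≡ y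
  Geodesic-injective stop (here refl) (here refl) _ _ = refl
  Geodesic-injective (step _ _ g) (here refl) (here refl) _ _ = refl
  Geodesic-injective (step _ d g) (here refl) (there m) dx dy with Geodesic-∈ g m
  ... | i , le , d′ = contradiction (trans (Dist-unique d′ dy) (Dist-unique dx d)) (ℕₚ.<⇒≢ (s≤s le))
  Geodesic-injective (step _ d g) (there m) (here refl) dx dy with Geodesic-∈ g m
  ... | i , le , d′ = contradiction (trans (Dist-unique d′ dx) (Dist-unique dy d)) (ℕₚ.<⇒≢ (s≤s le))
  Geodesic-injective (step _ _ g) (there m) (there m′) dx dy = Geodesic-injective g m m′ dx dy

  Geodesic-penultimate : ∀ {k v us} → Geodesic (suc k) v us → ∃ λ s → s ∈ us × R s r
  Geodesic-penultimate (step e d stop) = _ , here refl , e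
  Geodesic-penultimate (step _ _ g@(step _ _ _)) with Geodesic-penultimate g
  ... | s , m , e = s , there m , e

  Geodesic-end : ∀ {k v us} → Geodesic k v us → r ∈ us
  Geodesic-end stop = here refl
  Geodesic-end (step _ _ g) = there (Geodesic-end g)

  -- A shortest walk repeats no vertex and so has fewer than `n` edges, which makes the search
  -- finite. Being a cut-edge becomes decidable in this way.
  Star? : ∀ v → Dec (Star R v r)
  Star? v with Finₚ.any? (λ (k : Fin n) → Walk? (toℕ k) v)
  ... | yes (k , w) = yes (Walk⇒Star _ w)
  ... | no ¬p = no λ s → let k , d = dist s
                             us , g = geodesic k d
                             k<n = subst (_≤ n) (Geodesic-length g) (uniq-length≤ (Geodesic-unique g))
                         in ¬p (fromℕ< k<n , subst (λ j → Walk j v) (≡sym (Finₚ.toℕ-fromℕ< k<n)) (proj₁ d))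

data Path (X : Graph n) : Fin n → List (Fin n) → Fin n → Set where
  one : ∀ x → Path X x (x ∷ []) x
  _∷_ : ∀ {x y z xs} → E X x y → Path X y xs z → Path X x (x ∷ xs) z

Path-snoc : ∀ {X : Graph n} {x y z xs} → Path X x xs y → E X y z → Path X x (xs ++ z ∷ []) z
Path-snoc (one x) e = e ∷ one _
Path-snoc (f ∷ p) e = f ∷ Path-snoc p e

Path-first : ∀ {X : Graph n} {x y xs} → Path X x xs y → x ∈ xs
Path-first (one x) = here refl
Path-first (_ ∷ _) = here refl

Path-last : ∀ {X : Graph n} {x y xs} → Path X x xs y → y ∈ xs
Path-last (one x) = here refl
Path-last (_ ∷ p) = there (Path-last p)

Path-edge : ∀ {X : Graph n} {x y z u xs} → Path X u (x ∷ y ∷ xs) z → E X x y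
Path-edge (e ∷ one _) = e
Path-edge (e ∷ (_ ∷ _)) = e

Cyclic : Graph n → List (Fin n) → Set
Cyclic X L = Unique L × ∃₂ λ x y → Path X x L y × E X y x

Cyclic-rotate : ∀ {X : Graph n} {x xs} → Cyclic X (x ∷ xs) → Cyclic X (xs ++ x ∷ [])
Cyclic-rotate {xs = []} c = c
Cyclic-rotate {x = x} {xs = xs@(_ ∷ _)} (u , _ , _ , (e ∷ p) , f) =
  uniq-↭ (↭ₚ.++-comm (x ∷ []) xs) u , _ , _ , Path-snoc p f , e

Cyclic-++ : ∀ {X : Graph n} xs {ys} → Cyclic X (xs ++ ys) → Cyclic X (ys ++ xs)
Cyclic-++ {X = X} [] {ys} c = subst (Cyclic X) (≡sym (Listₚ.++-identityʳ ys)) c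
Cyclic-++ {X = X} (x ∷ xs) {ys} c = subst (Cyclic X) (Listₚ.++-assoc ys (x ∷ []) xs)
  (Cyclic-++ xs (subst (Cyclic X) (Listₚ.++-assoc xs ys (x ∷ [])) (Cyclic-rotate c)))

crossing : ∀ {X : Graph n} {s v} (S : List (Fin n)) → Reach X s v → s ∈ S → v ∉ S →
  ∃₂ λ x y → x ∈ S × y ∉ S × E X x y
crossing S ε s∈ v∉ = contradiction s∈ v∉
crossing {X = X} S (_◅_ {i = s} {j = u} e p) s∈ v∉ with u ∈? S
... | yes u∈ = crossing {X = X} S p u∈ v∉
... | no u∉ = s , u , s∈ , u∉ , e

CycAdj-suc : {i j : Fin n} → toℕ j ≡ suc (toℕ i) → CycAdj i j
CycAdj-suc {suc N} {i} {j} e = inj₁ (trans (cong (_% suc N) (trans (ℕₚ.+-comm (toℕ i) 1) (≡sym e))) (DivMod.m<n⇒m%n≡m (Finₚ.toℕ<n j)))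

CycAdj-wrap : {i j : Fin n} → suc (toℕ i) ≡ n → toℕ j ≡ 0 → CycAdj i j
CycAdj-wrap {suc N} {i} {j} e e′ = inj₁ (trans (cong (_% suc N) (trans (ℕₚ.+-comm (toℕ i) 1) e)) (trans (DivMod.n%n≡0 (suc N)) (≡sym e′)))

CycAdj-sym : {i j : Fin n} → CycAdj i j → CycAdj j i
CycAdj-sym {suc N} = swap

CycAdj-cases : {i j : Fin n} → CycAdj i j →
  (toℕ j ≡ suc (toℕ i) ⊎ suc (toℕ i) ≡ n × toℕ j ≡ 0) ⊎
  (toℕ i ≡ suc (toℕ j) ⊎ suc (toℕ j) ≡ n × toℕ i ≡ 0)
CycAdj-cases {suc N} {i} {j} (inj₁ e) = inj₁ (go i j e)
  where
  go : (i j : Fin (suc N)) → (toℕ i + 1) % suc N ≡ toℕ j → toℕ j ≡ suc (toℕ i) ⊎ suc (toℕ i) ≡ suc N × toℕ j ≡ 0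
  go i j e with suc (toℕ i) ≤? N
  ... | yes p = inj₁ (trans (≡sym e) (trans (cong (_% suc N) (ℕₚ.+-comm (toℕ i) 1)) (DivMod.m<n⇒m%n≡m (s≤s p))))
  ... | no ¬p = inj₂ (eq , trans (≡sym e) (trans (cong (_% suc N) (trans (ℕₚ.+-comm (toℕ i) 1) eq)) (DivMod.n%n≡0 (suc N))))
    where
    eq : suc (toℕ i) ≡ suc N
    eq = ℕₚ.≤-antisym (Finₚ.toℕ<n i) (ℕₚ.≰⇒> ¬p)
CycAdj-cases {suc N} {i} {j} (inj₂ e) = swap (CycAdj-cases {suc N} {j} {i} (inj₁ e))

module NonCutEdge {n : ℕ} (X : Graph n) (connected : Connected X) (¬cycle : ¬ IsCycle X)
                  {a b : Fin n} (ab : E X a b) (noncut : Star (EdgeDel X a b) a b) where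

  private
    R : Fin n → Fin n → Set
    R = EdgeDel X a b

    R-sym : ∀ {u v} → R u v → R v u
    R-sym {u} {v} (e , f) = trans (sym X v u) e , f ∘ λ { (inj₁ (p , q)) → inj₂ (q , p) ; (inj₂ (p , q)) → inj₁ (q , p) }

    E⇒R : ∀ {u v} → E X u v → ((u ≡ a × v ≡ b) ⊎ (u ≡ b × v ≡ a)) ⊎ R u v
    E⇒R {u} {v} e with ((u ≟ a) ×-dec (v ≟ b)) ⊎-dec ((u ≟ b) ×-dec (v ≟ a))
    ... | yes p = inj₁ p
    ... | no ¬p = inj₂ (e , ¬p)

    R-irrefl : ∀ {u} → ¬ R u u
    R-irrefl {u} (e , _) with trans (≡sym e) (irrefl X u)
    ... | ()

  open Distance R (EdgeDel? X a b) b

  private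
    Geodesic-Path : ∀ {k v us} → Geodesic k v us → Path X v us b
    Geodesic-Path stop = one b
    Geodesic-Path (step e _ g) = proj₁ e ∷ Geodesic-Path g

    Walk-sym-≤ : ∀ {u v j k} → R u v → Dist j u → Dist k v → j ≤ suc k
    Walk-sym-≤ e d d′ = Dist-≤ (_ , e , proj₁ d′) d

  -- The distance to `b` in `X` without the edge `ab` numbers the vertices. Levels of adjacent
  -- vertices differ by at most one there and no two vertices share a level, so each of its edges
  -- joins consecutive levels; `ab` closes the cycle.
  spanning⇒cycle : ∀ {k L} → Geodesic k a L → (∀ v → v ∈ L) → IsCycle X
  spanning⇒cycle {k} {L} g cover = f , (f-inj , surj) , λ u v → to u v , from u v
    where
    n≡ : n ≡ suc k
    n≡ = ℕₚ.≤-antisym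
      (subst₂ _≤_ (length-allFin n) (Geodesic-length g) (uniq-⊆-length (Uniqueₚ.allFin⁺ n) (λ {v} _ → cover v)))
      (subst (_≤ n) (Geodesic-length g) (uniq-length≤ (Geodesic-unique g)))
    level : ∀ v → ∃ λ j → j ≤ k × Dist j v
    level v = Geodesic-∈ g (cover v)
    lt : ∀ v → proj₁ (level v) < n
    lt v = subst (proj₁ (level v) <_) (≡sym n≡) (s≤s (proj₁ (proj₂ (level v))))
    f : Fin n → Fin n
    f v = fromℕ< (lt v)
    D : ∀ v → Dist (toℕ (f v)) v
    D v = subst (λ j → Dist j v) (≡sym (Finₚ.toℕ-fromℕ< (lt v))) (proj₂ (proj₂ (level v)))
    same : ∀ {j u v} → Dist j u → Dist j v → u ≡ v
    same {u = u} {v} = Geodesic-injective g (cover u) (cover v)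
    f-inj : Injective _≡_ _≡_ f
    f-inj {u} {v} e = same (D u) (subst (λ j → Dist (toℕ j) v) (≡sym e) (D v))
    surj : ∀ y → ∃ λ x → ∀ {z} → z ≡ x → f z ≡ y
    surj y with Moves.injective⇒surjective X (λ v → v) f-inj y
    ... | x , e = x , λ { refl → e }
    fa : suc (toℕ (f a)) ≡ n
    fa = trans (cong suc (Dist-unique (D a) (Geodesic-Dist g))) (≡sym n≡)
    fb : toℕ (f b) ≡ 0
    fb = Dist-unique (D b) Dist-zero
    to : ∀ u v → E X u v → CycAdj (f u) (f v)
    to u v e with E⇒R e
    ... | inj₁ (inj₁ (refl , refl)) = CycAdj-wrap fa fb
    ... | inj₁ (inj₂ (refl , refl)) = CycAdj-sym (CycAdj-wrap fa fb)
    ... | inj₂ r with ℕₚ.<-cmp (toℕ (f u)) (toℕ (f v))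
    ...   | tri< p _ _ = CycAdj-suc (ℕₚ.≤-antisym (Walk-sym-≤ (R-sym r) (D v) (D u)) p)
    ...   | tri≈ _ p _ = contradiction r (λ r′ → R-irrefl (subst (R u) (≡sym (f-inj (Finₚ.toℕ-injective p))) r′))
    ...   | tri> _ _ p = CycAdj-sym (CycAdj-suc (ℕₚ.≤-antisym (Walk-sym-≤ r (D u) (D v)) p))
    step-from : ∀ {u v} → toℕ (f v) ≡ suc (toℕ (f u)) → E X v u
    step-from {u} {v} e with Dist-step (subst (λ j → Dist j v) e (D v))
    ... | w , r , d = subst (E X v) (same d (D u)) (proj₁ r)
    wrap-from : ∀ {u v} → suc (toℕ (f u)) ≡ n → toℕ (f v) ≡ 0 → E X u v
    wrap-from {u} {v} p q = subst₂ (E X) (f-inj (Finₚ.toℕ-injective (ℕₚ.suc-injective (trans fa (≡sym p)))))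
                                         (f-inj (Finₚ.toℕ-injective (trans fb (≡sym q)))) ab
    E-sym′ : ∀ {u v} → E X u v → E X v u
    E-sym′ {u} {v} = trans (sym X v u)
    from : ∀ u v → CycAdj (f u) (f v) → E X u v
    from u v c with CycAdj-cases c
    ... | inj₁ (inj₁ e) = E-sym′ (step-from e)
    ... | inj₁ (inj₂ (p , q)) = wrap-from p q
    ... | inj₂ (inj₁ e) = step-from e
    ... | inj₂ (inj₂ (p , q)) = E-sym′ (wrap-from p q)

  -- A shortest path from a to b avoiding the edge ab closes up to a chordless cycle a ∷ w ∷ π,
  -- which therefore cannot span X.
  cycle-with-exit : ∃ λ w → ∃ λ π → Cyclic X (a ∷ w ∷ π) × E X a w × w ≢ b × b ∈ π ×
    (∃ λ s → s ∈ w ∷ π × s ≢ a × E X s b) ×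
    (∃₂ λ z c → z ∈ a ∷ w ∷ π × c ∉ a ∷ w ∷ π × E X z c)
  cycle-with-exit with dist noncut
  ... | zero , refl , _ = contradiction (trans (≡sym ab) (irrefl X a)) (λ ())
  ... | suc zero , (_ , r , refl) , _ = contradiction (inj₁ (refl , refl)) (proj₂ r)
  ... | suc (suc k) , d with geodesic _ d
  ... | _ , g@(step {u = w} {us = _ ∷ π} r d′ g′@(step _ _ g″)) =
        w , π , (Geodesic-unique g , _ , _ , Geodesic-Path g , trans (sym X b a) ab) , proj₁ r
        , (λ { refl → proj₂ r (inj₁ (refl , refl)) }) , Geodesic-end g″
        , (let s , s∈ , e = Geodesic-penultimate g′
           in s , s∈ , (λ s≡a → uniq-∉ (Geodesic-unique g) (subst (_∈ w ∷ π) s≡a s∈)) , proj₁ e)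
        , exit
    where
    L : List (Fin n)
    L = a ∷ w ∷ π
    exit : ∃₂ λ z c → z ∈ L × c ∉ L × E X z c
    exit with Finₚ.any? {n} (λ v → ¬? (v ∈? L))
    ... | yes (v , v∉) = crossing {X = X} L (connected a v) (here refl) v∉
    ... | no ¬p = contradiction (spanning⇒cycle g λ v → decidable-stable (v ∈? L) (λ v∉ → ¬p (v , v∉))) ¬cycle

odd : ℕ → Bool
odd zero = false
odd (suc k) = not (odd k)

module BFS {n : ℕ} (X : Graph n) (connected : Connected X) (r : Fin n) where

  open Distance (E X) (E? X) r

  private
    E-sym : ∀ {u v} → E X u v → E X v u
    E-sym {u} {v} = trans (sym X v u)

    level : ∀ v → ∃ λ k → Dist k v
    level v = dist (connected v r)

    Dist-edge : ∀ {u v j k} → E X u v → Dist j u → Dist k v → j ≤ suc k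
    Dist-edge e d d′ = Dist-≤ (_ , e , proj₁ d′) d

  -- Were there no such edge, the levels of adjacent vertices would differ by exactly one and their
  -- parity would be a proper 2-colouring.
  same-level-edge : ¬ Bipartite X → ∃₂ λ a b → E X a b × ∃ λ k → Dist k a × Dist k b
  same-level-edge ¬bip
    with Finₚ.any? (λ a → Finₚ.any? (λ b → E? X a b ×-dec (proj₁ (level a) ℕₚ.≟ proj₁ (level b))))
  ... | yes (a , b , e , q) = a , b , e , proj₁ (level a) , proj₂ (level a)
                            , subst (λ k → Dist k b) (≡sym q) (proj₂ (level b))
  ... | no ¬p = contradiction ((λ v → odd (proj₁ (level v))) , proper) ¬bip
    where
    alternate : ∀ {j k} → j ≡ suc k → odd j ≢ odd k
    alternate {k = k} refl e with odd k
    alternate refl () | true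
    alternate refl () | false
    proper : ∀ a b → E X a b → odd (proj₁ (level a)) ≢ odd (proj₁ (level b))
    proper a b e with ℕₚ.<-cmp (proj₁ (level a)) (proj₁ (level b))
    ... | tri< p _ _ = alternate (ℕₚ.≤-antisym (Dist-edge (E-sym e) (proj₂ (level b)) (proj₂ (level a))) p) ∘ ≡sym
    ... | tri≈ _ p _ = contradiction (a , b , e , p) ¬p
    ... | tri> _ _ p = alternate (ℕₚ.≤-antisym (Dist-edge e (proj₂ (level a)) (proj₂ (level b))) p)

  -- Shortest paths to the root change level at every step and hence avoid `ab`; two of them joined
  -- at the root replace it.
  same-level⇒noncut : ∀ {a b k} → Dist k a → Dist k b → Star (EdgeDel X a b) a b
  same-level⇒noncut {a} {b} da db = down _ da ◅◅ reverse (down _ db)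
    where
    keep : ∀ {u v j} → E X u v → Dist (suc j) u → Dist j v → EdgeDel X a b u v
    keep e du dv = e , λ
      { (inj₁ (refl , refl)) → ℕₚ.1+n≢n (trans (Dist-unique du da) (Dist-unique db dv))
      ; (inj₂ (refl , refl)) → ℕₚ.1+n≢n (trans (Dist-unique du db) (Dist-unique da dv)) }
    down : ∀ k {v} → Dist k v → Star (EdgeDel X a b) v r
    down zero (refl , _) = ε
    down (suc k) d with Dist-step d
    ... | u , e , d′ = keep e d d′ ◅ down k d′
    reverse : ∀ {u v} → Star (EdgeDel X a b) u v → Star (EdgeDel X a b) v u
    reverse ε = ε
    reverse ((e , f) ◅ s) = reverse s ◅◅
      ((E-sym e , f ∘ λ { (inj₁ (p , q)) → inj₂ (q , p) ; (inj₂ (p , q)) → inj₁ (q , p) }) ◅ ε)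

  -- Two shortest paths to the root are followed until they meet. As at most two neighbours of the root
  -- are visited, a root of degree at least 3 yields a cycle that does not span X.
  meet : ∀ k a b → a ≢ b → Dist k a → Dist k b →
    ∃ λ Q → Path X a Q b × Unique Q × odd (length Q) ≡ true × 3 ≤ length Q ×
      (∀ {y} → y ∈ Q → ∃ λ j → j ≤ k × Dist j y) ×
      (∃₂ λ α β → ∀ {y} → y ∈ Q → Dist 1 y → y ≡ α ⊎ y ≡ β)
  meet zero a b a≢b (refl , _) (refl , _) = contradiction refl a≢b
  meet (suc k) a b a≢b da db with Dist-step da | Dist-step db
  ... | a′ , ea , da′ | b′ , eb , db′ with a′ ≟ b′
  ...   | yes refl = a ∷ a′ ∷ b ∷ []
                   , (ea ∷ (E-sym eb ∷ one b))
                   , uniq-∷ (λ { (here refl) → up da da′ ; (there (here refl)) → a≢b refl })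
                       (uniq-∷ (λ { (here refl) → up db da′ }) (uniq-∷ (λ ()) []))
                   , refl , ℕₚ.≤-refl
                   , (λ { (here refl) → _ , ℕₚ.≤-refl , da
                        ; (there (here refl)) → _ , ℕₚ.n≤1+n k , da′
                        ; (there (there (here refl))) → _ , ℕₚ.≤-refl , db })
                   , two k da db da′
    where
    up : ∀ {v j} → Dist (suc j) v → Dist j v → ⊥
    up d d′ = ℕₚ.1+n≢n (Dist-unique d d′)
    two : ∀ k → Dist (suc k) a → Dist (suc k) b → Dist k a′ →
      ∃₂ λ α β → ∀ {y} → y ∈ a ∷ a′ ∷ b ∷ [] → Dist 1 y → y ≡ α ⊎ y ≡ β
    two zero da db da′ = a , b , λ
      { (here refl) _ → inj₁ refl
      ; (there (here refl)) d → ⊥-elim (up d da′)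
      ; (there (there (here refl))) _ → inj₂ refl }
    two (suc k) da db da′ = a′ , a′ , λ
      { (here refl) d → contradiction (Dist-unique d da) (λ ())
      ; (there (here refl)) _ → inj₁ refl
      ; (there (there (here refl))) d → contradiction (Dist-unique d db) (λ ()) }
  ...   | no a′≢b′ with meet k a′ b′ a′≢b′ da′ db′
  ...     | Q , p , u , o , l3 , lv , α , β , two =
              a ∷ (Q ++ b ∷ [])
            , (ea ∷ Path-snoc p (E-sym eb))
            , uniq-∷ a∉ (uniq-↭ (↭ₚ.++-comm (b ∷ []) Q) (uniq-∷ (top db) u))
            , trans (cong (not ∘ odd) (trans (Listₚ.length-++ Q) (ℕₚ.+-comm (length Q) 1)))
                    (cong (not ∘ not) o)
            , ℕₚ.≤-trans l3 (ℕₚ.m≤n⇒m≤1+n (subst (length Q ≤_) (≡sym (Listₚ.length-++ Q)) (ℕₚ.m≤m+n (length Q) 1)))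
            , lv′ , α , β , two′
    where
    top : ∀ {v} → Dist (suc k) v → v ∉ Q
    top d m with lv m
    ... | j , le , d′ = ℕₚ.<-irrefl (Dist-unique d′ d) (s≤s le)
    a∉ : a ∉ Q ++ b ∷ []
    a∉ m with ∈-++⁻ Q m
    ... | inj₁ m′ = top da m′
    ... | inj₂ (here e) = a≢b e
    lv′ : ∀ {y} → y ∈ a ∷ (Q ++ b ∷ []) → ∃ λ j → j ≤ suc k × Dist j y
    lv′ (here refl) = _ , ℕₚ.≤-refl , da
    lv′ (there m) with ∈-++⁻ Q m
    ... | inj₁ m′ = let j , le , d = lv m′ in j , ℕₚ.m≤n⇒m≤1+n le , d
    ... | inj₂ (here refl) = _ , ℕₚ.≤-refl , db
    low : ∀ {y} → Dist (suc k) y → Dist 1 y → y ≡ α ⊎ y ≡ β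
    low d d₁ with Dist-unique d d₁
    ... | refl = contradiction (trans (proj₁ da′) (≡sym (proj₁ db′))) a′≢b′
    two′ : ∀ {y} → y ∈ a ∷ (Q ++ b ∷ []) → Dist 1 y → y ≡ α ⊎ y ≡ β
    two′ (here refl) d = low da d
    two′ (there m) d with ∈-++⁻ Q m
    ... | inj₁ m′ = two m′ d
    ... | inj₂ (here refl) = low db d

  -- Each level that `meet` passes contributes two vertices and the meeting point one, so the length
  -- is odd. At most two vertices at distance 1 are used, hence one of the three neighbours of the
  -- root stays off the cycle and some edge leaves it.
  odd-cycle : ¬ Bipartite X → ∀ {y₁ y₂ y₃} → Unique (y₁ ∷ y₂ ∷ y₃ ∷ []) → E X r y₁ → E X r y₂ → E X r y₃ →
    ∃ λ Q → Cyclic X Q × odd (length Q) ≡ true × 3 ≤ length Q × (∃₂ λ z c → z ∈ Q × c ∉ Q × E X z c)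
  odd-cycle ¬bip {y₁} {y₂} {y₃} u₃ e₁ e₂ e₃ with same-level-edge ¬bip
  ... | a , b , e , k , da , db with meet k a b (λ { refl → contradiction (trans (≡sym e) (irrefl X a)) (λ ()) }) da db
  ... | Q , p , u , o , l3 , _ , α , β , two = Q , (u , _ , _ , p , E-sym e) , o , l3 , exit
    where
    D₁ : ∀ {y} → E X r y → Dist 1 y
    D₁ e = (r , E-sym e , refl) , λ { zero _ refl → contradiction (trans (≡sym e) (irrefl X r)) (λ ()) ; (suc _) (s≤s ()) _ }
    exit : ∃₂ λ z c → z ∈ Q × c ∉ Q × E X z c
    exit with pigeon (y₁ ∷ y₂ ∷ y₃ ∷ []) (α ∷ β ∷ []) u₃ ℕₚ.≤-refl
    ... | y , y∈ , y∉ = crossing {X = X} Q (connected a y) (Path-first p) y∉Q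
      where
      dy : Dist 1 y
      dy = D₁ (All.lookup (e₁ ∷ e₂ ∷ e₃ ∷ []) y∈)
      y∉Q : y ∉ Q
      y∉Q m with two m dy
      ... | inj₁ q = y∉ (here q)
      ... | inj₂ q = y∉ (there (here q))

module _ {n : ℕ} {X : Graph n} where

  cyclic-neighbours : ∀ {z rest} → Cyclic X (z ∷ rest) → 2 ≤ length rest →
    ∃₂ λ y₁ y₂ → y₁ ∈ rest × y₂ ∈ rest × y₁ ≢ y₂ × E X z y₁ × E X z y₂
  cyclic-neighbours {rest = _ ∷ []} _ (s≤s ())
  cyclic-neighbours {z} {y ∷ y′ ∷ rest} (u , _ , w , (e ∷ (e′ ∷ p)) , f) _ =
    y , w , here refl , there w∈ , (λ { refl → uniq-∉ (uniq-tail u) w∈ }) , e , trans (sym X z w) f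
    where
    w∈ : w ∈ y′ ∷ rest
    w∈ = Path-last p

-- The cycle found first may be even. It only provides a vertex `z` of degree at least 3, with two
-- neighbours on it and one off it; the search is then repeated with `z` as the root.
non-bipartite⇒odd-cycle : {X : Graph n} → Fin n → Connected X → ¬ IsCycle X → ¬ Bipartite X →
  ∃ λ Q → Cyclic X Q × odd (length Q) ≡ true × 3 ≤ length Q × (∃₂ λ z c → z ∈ Q × c ∉ Q × E X z c)
non-bipartite⇒odd-cycle {X = X} r connected ¬cycle ¬bip with BFS.same-level-edge X connected r ¬bip
... | a , b , ab , k , da , db
  with NonCutEdge.cycle-with-exit X connected ¬cycle ab (BFS.same-level⇒noncut X connected r da db)
... | w , π , cyc , _ , _ , b∈π , _ , z , c , z∈ , c∉ , zc with ∈-∃++ z∈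
... | as , bs , eq with cyclic-neighbours (Cyclic-++ as (subst (Cyclic X) eq cyc)) 2≤
  where
  2≤ : 2 ≤ length (bs ++ as)
  2≤ = s≤s⁻¹ (subst (3 ≤_) (trans (cong length eq) (trans (Listₚ.length-++ as)
         (trans (ℕₚ.+-comm (length as) _) (cong suc (≡sym (Listₚ.length-++ bs))))))
         (s≤s (s≤s (nonempty b∈π))))
    where
    nonempty : ∀ {x} {xs : List (Fin _)} → x ∈ xs → 1 ≤ length xs
    nonempty (here _) = s≤s z≤n
    nonempty (there _) = s≤s z≤n
... | y₁ , y₂ , y₁∈ , y₂∈ , y₁≢y₂ , e₁ , e₂ =
  BFS.odd-cycle X connected z ¬bip
    (uniq-∷ (λ { (here p) → y₁≢y₂ p ; (there (here refl)) → out y₁∈ })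
      (uniq-∷ (λ { (here refl) → out y₂∈ }) (uniq-∷ (λ ()) []))) e₁ e₂ zc
  where
  out : c ∉ bs ++ as
  out m = c∉ (subst (c ∈_) (≡sym eq) ([ (λ p → ∈-++⁺ʳ as (there p)) , ∈-++⁺ˡ ]′ (∈-++⁻ bs m)))

-- Placing the blanks

module Arrangement {n t : ℕ} (X : Graph n) (col : Fin n → Fin t) (c : Fin t) where

  open Moves X col

  Blank : (Fin n → Fin n) → Fin n → Set
  Blank σ v = col (σ v) ≢ c

  Blank? : ∀ σ v → Dec (Blank σ v)
  Blank? σ v = ¬? (col (σ v) ≟ c)

  blanks : List (Fin n)
  blanks = filter (λ l → ¬? (col l ≟ c)) (allFin n)

  Conn : List (Fin n) → Set
  Conn S = ∀ {x y} → x ∈ S → y ∈ S → ConnectedIn S x y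

  BlanksIn : List (Fin n) → (Fin n → Fin n) → Set
  BlanksIn S σ = ∀ {v} → Blank σ v → v ∈ S

  BlanksIn-⇝ : ∀ {S σ τ} → σ ⇝[ S ] τ → BlanksIn S σ → BlanksIn S τ
  BlanksIn-⇝ {S} (_ , off) b {v} bl = decidable-stable (v ∈? S) (λ v∉ → v∉ (b (subst (λ l → col l ≢ c) (off v∉) bl)))

  blanks-∈ : ∀ {l} → col l ≢ c → l ∈ blanks
  blanks-∈ = ∈-filter⁺ (λ l → ¬? (col l ≟ c)) (∈-allFin _)

  blank-positions : ∀ {σ} → Injective _≡_ _≡_ σ →
    ∃ λ vs → Unique vs × (∀ {v} → v ∈ vs → Blank σ v) × length blanks ≤ length vs
  blank-positions {σ} inj = vs , Uniqueₚ.filter⁺ (Blank? σ) (Uniqueₚ.allFin⁺ n) , proj₂ ∘ ∈-filter⁻ (Blank? σ) {xs = allFin n}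
    , subst (length blanks ≤_) (Listₚ.length-map σ vs)
        (uniq-⊆-length (Uniqueₚ.filter⁺ (λ l → ¬? (col l ≟ c)) (Uniqueₚ.allFin⁺ n)) back)
    where
    vs = filter (Blank? σ) (allFin n)
    back : ∀ {l} → l ∈ blanks → l ∈ map σ vs
    back {l} m with injective⇒surjective inj l
    ... | v , refl = ∈-map⁺ σ (∈-filter⁺ (Blank? σ) (∈-allFin v) (proj₂ (∈-filter⁻ (λ l → ¬? (col l ≟ c)) {xs = allFin n} m)))

  blank-positions-≤ : ∀ {σ vs} → Injective _≡_ _≡_ σ → Unique vs → (∀ {v} → v ∈ vs → Blank σ v) → length vs ≤ length blanks
  blank-positions-≤ {σ} {vs} inj u bl = subst (_≤ length blanks) (Listₚ.length-map σ vs) (uniq-⊆-length (Uniqueₚ.map⁺ inj u) sub)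
    where
    sub : ∀ {l} → l ∈ map σ vs → l ∈ blanks
    sub m with ∈-map⁻ σ m
    ... | v , v∈ , refl = blanks-∈ (bl v∈)

  module _ {S : List (Fin n)} (conn : Conn S) where

    private
      -- If `u` is not blank, then `u` and the blank positions together outnumber `ts`, so some
      -- blank stands outside `ts` and its colour can be brought to `u`. Blanks already in `ts` are
      -- left alone.
      fill : ∀ {ts} → (∀ {v} → v ∈ ts → v ∈ S) → length ts ≡ length blanks →
        ∀ us → (∀ {v} → v ∈ us → v ∈ ts) → ∀ σ → Injective _≡_ _≡_ σ → BlanksIn S σ →
        ∃ λ τ → σ ⇝[ S ] τ × (∀ {v} → v ∈ us → Blank τ v) × (∀ {v} → v ∈ ts → Blank σ v → col (τ v) ≡ col (σ v))
      fill ts⊆ len [] us⊆ σ inj bin = σ , ⇝[]-refl , (λ ()) , λ _ _ → refl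
      fill {ts} ts⊆ len (u ∷ us) us⊆ σ inj bin with Blank? σ u
      ... | yes bl with fill ts⊆ len us (us⊆ ∘ there) σ inj bin
      ...   | τ , r , b , keep = τ , r
              , (λ { (here refl) → subst (_≢ c) (≡sym (keep (us⊆ (here refl)) bl)) bl ; (there m) → b m }) , keep
      fill {ts} ts⊆ len (u ∷ us) us⊆ σ inj bin | no ¬bl with blank-positions inj
      ...   | vs , uv , bv , le with pigeon (u ∷ vs) ts (uniq-∷ (¬bl ∘ bv) uv) (subst (_< suc (length vs)) (≡sym len) (s≤s le))
      ...     | y , y∈ , y∉ts = result (∈-tail y∈ y≢u)
        where
        y≢u : y ≢ u
        y≢u refl = y∉ts (us⊆ (here refl))
        result : y ∈ vs → ∃ λ τ → σ ⇝[ S ] τ × (∀ {v} → v ∈ u ∷ us → Blank τ v) ×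
                   (∀ {v} → v ∈ ts → Blank σ v → col (τ v) ≡ col (σ v))
        result y∈vs with colour-transpose (conn (ts⊆ (us⊆ (here refl))) (bin (bv y∈vs))) σ
        ... | σ₁ , r₁ , c₁ with fill ts⊆ len us (us⊆ ∘ there) σ₁ (⇝-injective inj (proj₁ r₁)) (BlanksIn-⇝ r₁ bin)
        ...   | τ , r , b , keep = τ , ⇝[]-trans r₁ r
                , (λ { (here refl) → subst (_≢ c) (≡sym (trans (keep (us⊆ (here refl)) u-bl) u-col)) (bv y∈vs)
                     ; (there m) → b m })
                , λ {v} m bl → trans (keep m (subst (_≢ c) (≡sym (same m bl)) bl)) (same m bl)
          where
          u-col : col (σ₁ u) ≡ col (σ y)
          u-col = trans (c₁ u) (cong (col ∘ σ) (transpose-ˡ u y))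
          u-bl : Blank σ₁ u
          u-bl = subst (_≢ c) (≡sym u-col) (bv y∈vs)
          same : ∀ {v} → v ∈ ts → Blank σ v → col (σ₁ v) ≡ col (σ v)
          same {v} m bl = trans (c₁ v) (cong (col ∘ σ) (transpose-≢ (λ { refl → ¬bl bl }) (λ { refl → y∉ts m })))

    -- There are exactly as many targets as blanks, so none is left elsewhere once the targets are
    -- filled. The last component protects blanks of a prescribed colour that were put into `ts`
    -- beforehand.
    arrange : ∀ {ts} → Unique ts → (∀ {v} → v ∈ ts → v ∈ S) → length ts ≡ length blanks →
      ∀ σ → Injective _≡_ _≡_ σ → BlanksIn S σ →
      ∃ λ τ → σ ⇝[ S ] τ × (∀ {v} → v ∈ ts → Blank τ v) × (∀ {v} → v ∉ ts → col (τ v) ≡ c) ×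
        (∀ {v} → v ∈ ts → Blank σ v → col (τ v) ≡ col (σ v))
    arrange {ts} u ts⊆ len σ inj bin with fill ts⊆ len ts id σ inj bin
    ... | τ , r , b , keep = τ , r , b , rest , keep
      where
      rest : ∀ {v} → v ∉ ts → col (τ v) ≡ c
      rest {v} v∉ = decidable-stable (col (τ v) ≟ c) λ bl →
        ℕₚ.<-irrefl len (blank-positions-≤ {vs = v ∷ ts} (⇝-injective inj (proj₁ r)) (uniq-∷ v∉ u)
          λ { (here refl) → bl ; (there m) → b m })

    bring : ∀ {a y₁ y₂} → a ∈ S → y₁ ∈ S → y₂ ∈ S → y₂ ≢ y₁ → ∀ σ →
      ∃ λ τ → σ ⇝[ S ] τ × col (τ a) ≡ col (σ y₁) × ∃ λ y → y ∈ S × y ≢ a × col (τ y) ≡ col (σ y₂)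
    bring {a} {y₁} {y₂} a∈ y₁∈ y₂∈ ne σ with colour-transpose (conn a∈ y₁∈) σ
    -- The new place of the second colour is the image of `y₂` under the exchange: if `y₂` is `a`
    -- itself, its colour has been displaced to `y₁`.
    ... | τ , r , e = τ , r , trans (e a) (cong (col ∘ σ) (transpose-ˡ a y₁)) , transpose a y₁ y₂ , y∈
                    , (λ q → ne (transpose-injective a y₁ (trans q (≡sym (transpose-ʳ a y₁)))))
                    , trans (e _) (cong (col ∘ σ) (transpose-involutive a y₁ y₂))
      where
      y∈ : transpose a y₁ y₂ ∈ S
      y∈ with transpose a y₁ y₂ | transpose-view a y₁ y₂
      ... | _ | hitˡ _ = y₁∈
      ... | _ | hitʳ _ _ = a∈
      ... | _ | miss _ _ = y₂∈

    bring-two : ∀ {a b y₁ y₂} → a ∈ S → b ∈ S → a ≢ b → y₁ ∈ S → y₂ ∈ S → y₂ ≢ y₁ → ∀ σ →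
      ∃ λ τ → σ ⇝[ S ] τ × col (τ a) ≡ col (σ y₁) × col (τ b) ≡ col (σ y₂)
    bring-two {a} {b} a∈ b∈ a≢b y₁∈ y₂∈ ne σ with bring a∈ y₁∈ y₂∈ ne σ
    ... | σ₁ , r₁ , ea , y , y∈ , y≢a , ey with colour-transpose (conn b∈ y∈) σ₁
    ... | τ , r , e = τ , ⇝[]-trans r₁ r
        , trans (e a) (trans (cong (col ∘ σ₁) (transpose-≢ a≢b (y≢a ∘ ≡sym))) ea)
        , trans (e b) (trans (cong (col ∘ σ₁) (transpose-ˡ b y)) ey)

  slide : ∀ {u us w σ} → Path X u us w → Unique us → (∀ {v} → v ∈ us → v ≢ w → Blank σ v) → col (σ w) ≡ c →
    ∃ λ τ → σ ⇝[ us ] τ × τ u ≡ σ w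
  slide (one _) u bl cw = _ , ⇝[]-refl , refl
  slide {w = w} {σ} (_∷_ {x = x} {y} {xs = us} e p) u bl cw with slide p (uniq-tail u) (bl ∘ there) cw
  ... | τ , (r , off) , q = τ ∘ transpose x y
      , (⇝-trans r (⇝-move e λ r′ → bl (here refl) x≢w (trans (cong col (≡sym (off (uniq-∉ u)))) (trans r′ (trans (cong col q) cw))))
        , λ {v} v∉ → trans (cong τ (transpose-≢ (λ { refl → v∉ (here refl) }) (λ { refl → v∉ (there (Path-first p)) }))) (off (v∉ ∘ there)))
      , trans (cong τ (transpose-ˡ x y)) q
    where
    x≢w : x ≢ w
    x≢w refl = uniq-∉ u (Path-last p)

  ConnectedIn-⊆ : ∀ {S S′ x y} → (∀ {v} → v ∈ S → v ∈ S′) → ConnectedIn S x y → ConnectedIn S′ x y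
  ConnectedIn-⊆ s ε = ε
  ConnectedIn-⊆ s ((e , p , q) ◅ r) = (e , s p , s q) ◅ ConnectedIn-⊆ s r

  Path-conn : ∀ {x us y} → Path X x us y → Conn us
  Path-conn {x} {us} p u∈ v∈ = ConnectedIn-sym (from-first p u∈) ◅◅ from-first p v∈
    where
    from-first : ∀ {x us y v} → Path X x us y → v ∈ us → ConnectedIn us x v
    from-first (one _) (here refl) = ε
    from-first (e ∷ p) (here refl) = ε
    from-first (e ∷ p) (there m) = (e , here refl , there (Path-first p)) ◅ ConnectedIn-⊆ there (from-first p m)

  Conn-∷ : ∀ {S w s} → Conn S → s ∈ S → E X s w → Conn (w ∷ S)
  Conn-∷ {S} {w} {s} conn s∈ e u∈ v∈ = ConnectedIn-sym (from-s u∈) ◅◅ from-s v∈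
    where
    from-s : ∀ {v} → v ∈ w ∷ S → ConnectedIn (w ∷ S) s v
    from-s (here refl) = (e , there s∈ , here refl) ◅ ε
    from-s (there m) = ConnectedIn-⊆ there (conn s∈ m)

  Conn-allFin : Connected X → Conn (allFin n)
  Conn-allFin connected {x} {y} _ _ = go (connected x y)
    where
    go : ∀ {x y} → Reach X x y → ConnectedIn (allFin n) x y
    go ε = ε
    go (e ◅ s) = (e , ∈-allFin _ , ∈-allFin _) ◅ go s

-- Claw relations and a pair of tokens on a cycle

record ClawEquivalence {n t : ℕ} (X : Graph n) (col : Fin n → Fin t) (c κ₁ κ₂ : Fin t) (σ₀ : Fin n → Fin n)
                       (_≈_ : Fin n → Fin n → Set) : Set where
  open Moves X col
  field
    -- The relation stays abstract because of its two uses: that a transposition is a reachable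
    -- relabelling, and, where claws yield only double transpositions, that two labels belong to a
    -- class together. Transitivity asks for the colours since relabellings compose only if they
    -- preserve colours.
    ≈-refl  : ∀ {i} → i ≈ i
    ≈-sym   : ∀ {i j} → i ≈ j → j ≈ i
    ≈-trans : ∀ {i j k} → col i ≡ c → col j ≡ c → col k ≡ c → i ≈ j → j ≈ k → i ≈ k
    claw    : ∀ {τ z x a b} → σ₀ ⇝ τ → Unique (z ∷ x ∷ a ∷ b ∷ []) → E X z x → E X z a → E X z b →
              col (τ z) ≡ c → col (τ x) ≡ c → col (τ a) ≡ κ₁ → col (τ b) ≡ κ₂ → τ z ≈ τ x

module Train {n t : ℕ} (X : Graph n) (col : Fin n → Fin t) (c κ₁ κ₂ : Fin t) (κ₁≢c : κ₁ ≢ c) (κ₂≢c : κ₂ ≢ c)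
             (σ₀ : Fin n → Fin n) (_≈_ : Fin n → Fin n → Set)
             (equivalence : ClawEquivalence X col c κ₁ κ₂ σ₀ _≈_) where

  open Moves X col
  open Arrangement X col c
  open ClawEquivalence equivalence

  private
    cyclic-edges : ∀ {x₀ x₁ x₂ π} → Cyclic X (x₀ ∷ x₁ ∷ x₂ ∷ π) → E X x₀ x₁ × E X x₁ x₂ × Conn (x₂ ∷ π)
    cyclic-edges (_ , _ , _ , (e ∷ (e′ ∷ p@(one _))) , _) = e , e′ , Path-conn p
    cyclic-edges (_ , _ , _ , (e ∷ (e′ ∷ p@(_ ∷ _))) , _) = e , e′ , Path-conn p

    -- The blank jumps back over both tokens, so the pair moves on by one vertex in the same order.
    advance : ∀ {x₀ x₁ x₂ π τ} → Cyclic X (x₀ ∷ x₁ ∷ x₂ ∷ π) → col (τ x₀) ≡ c → col (τ x₁) ≡ c → Blank τ x₂ →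
      ∃ λ τ′ → τ ⇝ τ′ × τ′ x₁ ≡ τ x₀ × τ′ x₂ ≡ τ x₁ × τ′ x₀ ≡ τ x₂ ×
        (∀ {v} → v ∉ x₀ ∷ x₁ ∷ x₂ ∷ [] → τ′ v ≡ τ v)
    advance {x₀} {x₁} {x₂} {π} {τ} cyc c₀ c₁ b with cyclic-edges cyc
    ... | e₀ , e₁ , _ = τ ∘ transpose x₁ x₂ ∘ transpose x₀ x₁
        , move x₁ x₂ e₁ (λ q → b (trans (≡sym q) c₁))
            (move x₀ x₁ e₀ (λ q → b (trans (≡sym (trans (cong col at₀) (trans q (cong (col ∘ τ) (transpose-ˡ x₁ x₂))))) c₀ ))
              ⇝-refl)
        , trans (cong (τ ∘ transpose x₁ x₂) (transpose-ʳ x₀ x₁)) at₀′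
        , trans (cong (τ ∘ transpose x₁ x₂) (transpose-≢ x₂≢x₀ (x₁≢x₂ ∘ ≡sym))) (cong τ (transpose-ʳ x₁ x₂))
        , trans (cong (τ ∘ transpose x₁ x₂) (transpose-ˡ x₀ x₁)) (cong τ (transpose-ˡ x₁ x₂))
        , λ {v} v∉ → trans (cong (τ ∘ transpose x₁ x₂) (transpose-≢ {k = v} (λ { refl → v∉ (here refl) }) (λ { refl → v∉ (there (here refl)) })))
                   (cong τ (transpose-≢ (λ { refl → v∉ (there (here refl)) }) (λ { refl → v∉ (there (there (here refl))) })))
      where
      u = proj₁ cyc
      x₁≢x₂ : x₁ ≢ x₂
      x₁≢x₂ refl = uniq-∉ (uniq-tail u) (here refl)
      x₂≢x₀ : x₂ ≢ x₀
      x₂≢x₀ refl = uniq-∉ u (there (here refl))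
      x₀≢x₁ : x₀ ≢ x₁
      x₀≢x₁ refl = uniq-∉ u (here refl)
      at₀′ : τ (transpose x₁ x₂ x₀) ≡ τ x₀
      at₀′ = cong τ (transpose-≢ x₀≢x₁ (x₂≢x₀ ∘ ≡sym))
      at₀ : τ x₀ ≡ τ (transpose x₁ x₂ x₀)
      at₀ = ≡sym at₀′

    -- One blank is parked next to z, off the cycle; the pair of tokens travels round the cycle until
    -- it stands on z and its predecessor.
    approach : ∀ as {x₀ x₁ z bs τ b y} → Cyclic X (x₀ ∷ x₁ ∷ as ++ z ∷ bs) → σ₀ ⇝ τ →
      col (τ x₀) ≡ c → col (τ x₁) ≡ c → E X z b → b ∉ x₀ ∷ x₁ ∷ as ++ z ∷ bs →
      col (τ b) ≡ κ₁ → y ∈ as ++ z ∷ bs → col (τ y) ≡ κ₂ → τ x₀ ≈ τ x₁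
    approach [] {x₀} {x₁} {z} {bs} {τ} {b} {y} cyc r c₀ c₁ zb b∉ cb y∈ cy
      with colour-transpose (proj₂ (proj₂ (cyclic-edges cyc)) (here refl) y∈) τ
    ... | τ₁ , (r₁ , off₁) , e₁
      with advance cyc (trans (cong col (off₁ x₀∉)) c₀) (trans (cong col (off₁ x₁∉)) c₁) (λ q → κ₂≢c (trans (≡sym z₁) q))
      where
      u = proj₁ cyc
      x₀∉ : x₀ ∉ z ∷ bs
      x₀∉ = uniq-∉ u ∘ there
      x₁∉ : x₁ ∉ z ∷ bs
      x₁∉ = uniq-∉ (uniq-tail u)
      z₁ : col (τ₁ z) ≡ κ₂
      z₁ = trans (e₁ z) (trans (cong (col ∘ τ) (transpose-ˡ z y)) cy)
    -- The pair now stands on `x₁` and `z`, and the blank it has passed is behind it on `x₀`. That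
    -- blank is sent along the rest of the cycle to `q`, the successor of `z`; then `x₁`, `b` and
    -- `q` are the leaves of a claw at `z`.
    ... | τ₂ , r₂ , at₁ , atz , at₀ , off₂ = finish (bs ++ x₀ ∷ []) refl (∈-++⁺ʳ bs (here refl))
      where
      u = proj₁ cyc
      x₀∉ : x₀ ∉ z ∷ bs
      x₀∉ = uniq-∉ u ∘ there
      x₁∉ : x₁ ∉ z ∷ bs
      x₁∉ = uniq-∉ (uniq-tail u)
      i₀ : τ₂ x₁ ≡ τ x₀
      i₀ = trans at₁ (off₁ x₀∉)
      i₁ : τ₂ z ≡ τ x₁
      i₁ = trans atz (off₁ x₁∉)
      x₀-col : col (τ₂ x₀) ≡ κ₂
      x₀-col = trans (cong col at₀) (trans (e₁ z) (trans (cong (col ∘ τ) (transpose-ˡ z y)) cy))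
      b-col : col (τ₂ b) ≡ κ₁
      b-col = trans (cong col (trans (off₂ λ { (here q) → b∉ (here q) ; (there (here q)) → b∉ (there (here q))
                                             ; (there (there (here q))) → b∉ (there (there (here q))) })
                                     (off₁ (b∉ ∘ there ∘ there)))) cb
      cyc′ : Cyclic X (x₁ ∷ z ∷ bs ++ x₀ ∷ [])
      cyc′ = Cyclic-rotate cyc
      finish : ∀ ρ → bs ++ x₀ ∷ [] ≡ ρ → x₀ ∈ ρ → τ x₀ ≈ τ x₁
      finish [] _ ()
      finish (q ∷ ρ) eq x₀∈ with subst (λ ρ → Cyclic X (x₁ ∷ z ∷ ρ)) eq cyc′
      ... | cyc″ with cyclic-edges cyc″
      ... | e , e′ , conn with colour-transpose (conn (here refl) x₀∈) τ₂
      ... | τ₃ , (r₃ , off₃) , e₃ = ≈-sym (subst₂ _≈_ (trans (off₃ z∉) i₁) (trans (off₃ x₁∉′) i₀)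
              (claw (⇝-trans r (⇝-trans r₁ (⇝-trans r₂ r₃))) uniq₄ (E-sym e) zb e′
                (trans (cong col (trans (off₃ z∉) i₁)) c₁) (trans (cong col (trans (off₃ x₁∉′) i₀)) c₀)
                (trans (cong col (off₃ b∉′)) b-col)
                (trans (e₃ q) (trans (cong (col ∘ τ₂) (transpose-ˡ q x₀)) x₀-col))))
        where
        u″ = proj₁ cyc″
        z∉ : z ∉ q ∷ ρ
        z∉ = uniq-∉ (uniq-tail u″)
        x₁∉′ : x₁ ∉ q ∷ ρ
        x₁∉′ = uniq-∉ u″ ∘ there
        b∉′ : b ∉ q ∷ ρ
        b∉′ m with ∈-++⁻ bs (subst (b ∈_) (≡sym eq) m)
        ... | inj₁ m′ = b∉ (there (there (there m′)))
        ... | inj₂ (here q) = b∉ (here q)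
        uniq₄ : Unique (z ∷ x₁ ∷ b ∷ q ∷ [])
        uniq₄ = uniq-∷ (λ { (here refl) → E-≢ e refl ; (there (here refl)) → E-≢ zb refl ; (there (there (here refl))) → z∉ (here refl) })
                  (uniq-∷ (λ { (here refl) → b∉ (there (here refl)) ; (there (here refl)) → x₁∉′ (here refl) })
                    (uniq-∷ (λ { (here refl) → b∉′ (here refl) }) (uniq-∷ (λ ()) [])))
    approach (x₂ ∷ as) {x₀} {x₁} {z} {bs} {τ} {b} {y} cyc r c₀ c₁ zb b∉ cb y∈ cy
      with colour-transpose (proj₂ (proj₂ (cyclic-edges cyc)) (here refl) y∈) τ
    ... | τ₁ , (r₁ , off₁) , e₁
      with advance cyc (trans (cong col (off₁ x₀∉)) c₀) (trans (cong col (off₁ x₁∉)) c₁) (λ q → κ₂≢c (trans (≡sym x₂-col) q))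
      where
      u = proj₁ cyc
      x₀∉ : x₀ ∉ x₂ ∷ as ++ z ∷ bs
      x₀∉ = uniq-∉ u ∘ there
      x₁∉ : x₁ ∉ x₂ ∷ as ++ z ∷ bs
      x₁∉ = uniq-∉ (uniq-tail u)
      x₂-col : col (τ₁ x₂) ≡ κ₂
      x₂-col = trans (e₁ x₂) (trans (cong (col ∘ τ) (transpose-ˡ x₂ y)) cy)
    ... | τ₂ , r₂ , at₁ , at₂ , at₀ , off₂ =
      subst₂ _≈_ i₀ i₁ (approach as {bs = bs ++ x₀ ∷ []} (subst (Cyclic X) assoc (Cyclic-rotate cyc))
        (⇝-trans r (⇝-trans r₁ r₂)) (trans (cong col i₀) c₀) (trans (cong col i₁) c₁) zb
        (b∉ ∘ back ∘ subst (b ∈_) (≡sym assoc)) b-col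
        (subst (x₀ ∈_) (Listₚ.++-assoc as (z ∷ bs) (x₀ ∷ [])) (∈-++⁺ʳ (as ++ z ∷ bs) (here refl)))
        (trans (cong col at₀) (trans (e₁ x₂) (trans (cong (col ∘ τ) (transpose-ˡ x₂ y)) cy))))
      where
      u = proj₁ cyc
      i₀ : τ₂ x₁ ≡ τ x₀
      i₀ = trans at₁ (off₁ (uniq-∉ u ∘ there))
      i₁ : τ₂ x₂ ≡ τ x₁
      i₁ = trans at₂ (off₁ (uniq-∉ (uniq-tail u)))
      assoc : x₁ ∷ (x₂ ∷ as ++ z ∷ bs) ++ x₀ ∷ [] ≡ x₁ ∷ x₂ ∷ as ++ z ∷ (bs ++ x₀ ∷ [])
      assoc = cong (λ l → x₁ ∷ x₂ ∷ l) (Listₚ.++-assoc as (z ∷ bs) (x₀ ∷ []))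
      back : b ∈ x₁ ∷ (x₂ ∷ as ++ z ∷ bs) ++ x₀ ∷ [] → b ∈ x₀ ∷ x₁ ∷ x₂ ∷ as ++ z ∷ bs
      back (here q) = there (here q)
      back (there m) with ∈-++⁻ (x₂ ∷ as ++ z ∷ bs) m
      ... | inj₁ m′ = there (there m′)
      ... | inj₂ (here q) = here q
      b-col : col (τ₂ b) ≡ κ₁
      b-col = trans (cong col (trans (off₂ λ { (here q) → b∉ (here q) ; (there (here q)) → b∉ (there (here q))
                                             ; (there (there (here q))) → b∉ (there (there (here q))) })
                                     (off₁ (b∉ ∘ there ∘ there)))) cb

    -- The blank of colour `κ₁` is brought to `z` and its colour exchanged with that on `b`. If `b`
    -- already has this colour, nothing is moved. The blank of colour `κ₂` remains on the cycle to
    -- drive the pair.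
    park : ∀ {x₀ x₁ x₂ π τ z b y₁ y₂} → Cyclic X (x₀ ∷ x₁ ∷ x₂ ∷ π) → σ₀ ⇝ τ →
      col (τ x₀) ≡ c → col (τ x₁) ≡ c → y₁ ∈ x₂ ∷ π → y₂ ∈ x₂ ∷ π → y₂ ≢ y₁ → col (τ y₁) ≡ κ₁ → col (τ y₂) ≡ κ₂ →
      z ∈ x₂ ∷ π → b ∉ x₀ ∷ x₁ ∷ x₂ ∷ π → E X z b → τ x₀ ≈ τ x₁
    park {x₀} {x₁} {x₂} {π} {τ} {z} {b} cyc r c₀ c₁ y₁∈ y₂∈ ne k₁ k₂ z∈ b∉ zb
      with bring (proj₂ (proj₂ (cyclic-edges cyc))) z∈ y₁∈ y₂∈ ne τ
    ... | τ₁ , (r₁ , off₁) , ez , y , y∈ , y≢z , ey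
      with colour-transpose-edge {S = z ∷ b ∷ []} zb (here refl) (there (here refl)) τ₁ | ∈-∃++ z∈
    ... | τ₂ , (r₂ , off₂) , e₂ | as , bs , eq = subst₂ _≈_ i₀ i₁
        (approach as (subst (λ l → Cyclic X (x₀ ∷ x₁ ∷ l)) eq cyc) (⇝-trans r (⇝-trans r₁ r₂))
          (trans (cong col i₀) c₀) (trans (cong col i₁) c₁) zb
          (subst (λ l → b ∉ x₀ ∷ x₁ ∷ l) eq b∉)
          (trans (e₂ b) (trans (cong (col ∘ τ₁) (transpose-ʳ z b)) (trans ez k₁)))
          (subst (y ∈_) eq y∈)
          (trans (e₂ y) (trans (cong (col ∘ τ₁) (transpose-≢ y≢z (λ { refl → b∉ (there (there y∈)) }))) (trans ey k₂))))
      where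
      u = proj₁ cyc
      x₀∉ : x₀ ∉ x₂ ∷ π
      x₀∉ = uniq-∉ u ∘ there
      x₁∉ : x₁ ∉ x₂ ∷ π
      x₁∉ = uniq-∉ (uniq-tail u)
      i₀ : τ₂ x₀ ≡ τ x₀
      i₀ = trans (off₂ λ { (here refl) → x₀∉ z∈ ; (there (here refl)) → b∉ (here refl) }) (off₁ x₀∉)
      i₁ : τ₂ x₁ ≡ τ x₁
      i₁ = trans (off₂ λ { (here refl) → x₁∉ z∈ ; (there (here refl)) → b∉ (there (here refl)) }) (off₁ x₁∉)

    -- When the exit `z` lies under the pair, the pair moves on by two vertices. This frees `z` and
    -- leaves the two blanks on `x₀` and `x₁`.
    step-aside : ∀ {x₀ x₁ x₂ x₃ π τ z b y₁ y₂} → Cyclic X (x₀ ∷ x₁ ∷ x₂ ∷ x₃ ∷ π) → σ₀ ⇝ τ →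
      col (τ x₀) ≡ c → col (τ x₁) ≡ c → y₁ ∈ x₂ ∷ x₃ ∷ π → y₂ ∈ x₂ ∷ x₃ ∷ π → y₂ ≢ y₁ → col (τ y₁) ≡ κ₁ → col (τ y₂) ≡ κ₂ →
      z ∈ x₀ ∷ x₁ ∷ [] → b ∉ x₀ ∷ x₁ ∷ x₂ ∷ x₃ ∷ π → E X z b → τ x₀ ≈ τ x₁
    step-aside {x₀} {x₁} {x₂} {x₃} {π} {τ} {z} {b} cyc r c₀ c₁ y₁∈ y₂∈ ne k₁ k₂ z∈ b∉ zb
      with bring-two (proj₂ (proj₂ (cyclic-edges cyc))) (here refl) (there (here refl))
             (λ q → uniq-∉ (uniq-tail (uniq-tail (proj₁ cyc))) (here q)) y₁∈ y₂∈ ne τ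
    ... | τ₁ , (r₁ , off₁) , e₂ , e₃
      with advance cyc (trans (cong col (off₁ (uniq-∉ (proj₁ cyc) ∘ there))) c₀)
                       (trans (cong col (off₁ (uniq-∉ (uniq-tail (proj₁ cyc))))) c₁) (λ q → κ₁≢c (trans (≡sym k₁) (trans (≡sym e₂) q)))
    ... | τ₂ , r₂ , p₁ , p₂ , p₀ , off₂
      with advance {τ = τ₂} (Cyclic-rotate cyc)
             (trans (cong col (trans p₁ (off₁ (uniq-∉ (proj₁ cyc) ∘ there)))) c₀)
             (trans (cong col (trans p₂ (off₁ (uniq-∉ (uniq-tail (proj₁ cyc)))))) c₁)
             (λ q → κ₂≢c (trans (≡sym k₂) (trans (≡sym e₃) (trans (≡sym (cong col (off₂ x₃∉))) q))))
      where
      x₃∉ : x₃ ∉ x₀ ∷ x₁ ∷ x₂ ∷ []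
      x₃∉ (here refl) = uniq-∉ (proj₁ cyc) (there (there (here refl)))
      x₃∉ (there (here refl)) = uniq-∉ (uniq-tail (proj₁ cyc)) (there (here refl))
      x₃∉ (there (there (here refl))) = uniq-∉ (uniq-tail (uniq-tail (proj₁ cyc))) (here refl)
    ... | τ₃ , r₃ , q₂ , q₃ , q₁ , off₃ = subst₂ _≈_ i₀ i₁ (go cyc₃ b∉′ x₀∈ x₁∈ (z∈′ z∈))
      where
      x₃∉ : x₃ ∉ x₀ ∷ x₁ ∷ x₂ ∷ []
      x₃∉ (here refl) = uniq-∉ (proj₁ cyc) (there (there (here refl)))
      x₃∉ (there (here refl)) = uniq-∉ (uniq-tail (proj₁ cyc)) (there (here refl))
      x₃∉ (there (there (here refl))) = uniq-∉ (uniq-tail (uniq-tail (proj₁ cyc))) (here refl)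
      i₀ : τ₃ x₂ ≡ τ x₀
      i₀ = trans q₂ (trans p₁ (off₁ (uniq-∉ (proj₁ cyc) ∘ there)))
      i₁ : τ₃ x₃ ≡ τ x₁
      i₁ = trans q₃ (trans p₂ (off₁ (uniq-∉ (uniq-tail (proj₁ cyc)))))
      u = proj₁ cyc
      x₀-col : col (τ₃ x₀) ≡ κ₁
      x₀-col = trans (cong col (trans (off₃ λ { (here refl) → uniq-∉ u (here refl) ; (there (here refl)) → uniq-∉ u (there (here refl))
                                              ; (there (there (here refl))) → uniq-∉ u (there (there (here refl))) }) p₀))
                     (trans e₂ k₁)
      x₁-col : col (τ₃ x₁) ≡ κ₂
      x₁-col = trans (cong col (trans q₁ (off₂ x₃∉))) (trans e₃ k₂)
      rest : List (Fin n)
      rest = (π ++ x₀ ∷ []) ++ x₁ ∷ []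
      cyc₃ : Cyclic X (x₂ ∷ x₃ ∷ rest)
      cyc₃ = Cyclic-rotate (Cyclic-rotate cyc)
      x₀∈ : x₀ ∈ rest
      x₀∈ = ∈-++⁺ˡ (∈-++⁺ʳ π (here refl))
      x₁∈ : x₁ ∈ rest
      x₁∈ = ∈-++⁺ʳ (π ++ x₀ ∷ []) (here refl)
      z∈′ : z ∈ x₀ ∷ x₁ ∷ [] → z ∈ rest
      z∈′ (here refl) = x₀∈
      z∈′ (there (here refl)) = x₁∈
      b∉′ : b ∉ x₂ ∷ x₃ ∷ rest
      b∉′ (here q) = b∉ (there (there (here q)))
      b∉′ (there (here q)) = b∉ (there (there (there (here q))))
      b∉′ (there (there m)) with ∈-++⁻ (π ++ x₀ ∷ []) m
      ... | inj₂ (here q) = b∉ (there (here q))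
      ... | inj₁ m′ with ∈-++⁻ π m′
      ...   | inj₁ m″ = b∉ (there (there (there (there m″))))
      ...   | inj₂ (here q) = b∉ (here q)
      go : ∀ {ρ} → Cyclic X (x₂ ∷ x₃ ∷ ρ) → b ∉ x₂ ∷ x₃ ∷ ρ → x₀ ∈ ρ → x₁ ∈ ρ → z ∈ ρ → τ₃ x₂ ≈ τ₃ x₃
      go {_ ∷ _} cyc′ b∉″ x₀∈′ x₁∈′ z∈″ =
        park cyc′ (⇝-trans r (⇝-trans r₁ (⇝-trans r₂ r₃))) (trans (cong col i₀) c₀) (trans (cong col i₁) c₁)
          x₀∈′ x₁∈′ (λ { refl → uniq-∉ u (here refl) }) x₀-col x₁-col z∈″ b∉″ zb

  train : ∀ {x₀ x₁ π τ z b y₁ y₂} → Cyclic X (x₀ ∷ x₁ ∷ π) → σ₀ ⇝ τ → col (τ x₀) ≡ c → col (τ x₁) ≡ c →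
    y₁ ∈ π → y₂ ∈ π → y₂ ≢ y₁ → col (τ y₁) ≡ κ₁ → col (τ y₂) ≡ κ₂ →
    z ∈ x₀ ∷ x₁ ∷ π → b ∉ x₀ ∷ x₁ ∷ π → E X z b → τ x₀ ≈ τ x₁
  train {π = _ ∷ []} _ _ _ _ (here refl) (here refl) ne _ _ _ _ _ = contradiction refl ne
  train {π = _ ∷ _ ∷ _} cyc r c₀ c₁ y₁∈ y₂∈ ne k₁ k₂ (here q) b∉ zb =
    step-aside cyc r c₀ c₁ y₁∈ y₂∈ ne k₁ k₂ (here q) b∉ zb
  train {π = _ ∷ _ ∷ _} cyc r c₀ c₁ y₁∈ y₂∈ ne k₁ k₂ (there (here q)) b∉ zb =
    step-aside cyc r c₀ c₁ y₁∈ y₂∈ ne k₁ k₂ (there (here q)) b∉ zb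
  train {π = _ ∷ _ ∷ _} cyc r c₀ c₁ y₁∈ y₂∈ ne k₁ k₂ (there (there z∈)) b∉ zb =
    park cyc r c₀ c₁ y₁∈ y₂∈ ne k₁ k₂ z∈ b∉ zb

-- All tokens of one colour are equivalent

module Neighbours {n : ℕ} (X : Graph n) where

  private
    nbrs : Fin n → List (Fin n)
    nbrs v = filterᵇ (adj X v) (allFin n)

    nbrs⁺ : ∀ {u v} → E X v u → u ∈ nbrs v
    nbrs⁺ {u} {v} e = ∈-filter⁺ (Boolₚ.T? ∘ adj X v) (∈-allFin u) (Equivalence.from Boolₚ.T-≡ e)

    nbrs⁻ : ∀ {u v} → u ∈ nbrs v → E X v u
    nbrs⁻ {u} {v} m = Equivalence.to Boolₚ.T-≡ (proj₂ (∈-filter⁻ (Boolₚ.T? ∘ adj X v) {xs = allFin n} m))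

    two-≤-deg : ∀ {v a b} → a ≢ b → E X v a → E X v b → 2 ≤ deg X v
    two-≤-deg {a = a} {b} a≢b ea eb = uniq-⊆-length {xs = a ∷ b ∷ []}
      (uniq-∷ (λ { (here q) → a≢b q }) (uniq-∷ (λ ()) [])) λ { (here refl) → nbrs⁺ ea ; (there (here refl)) → nbrs⁺ eb }

  deg≢1 : ∀ {v a b} → a ≢ b → E X v a → E X v b → deg X v ≢ 1
  deg≢1 a≢b ea eb q = ℕₚ.<-irrefl (≡sym q) (two-≤-deg a≢b ea eb)

  deg≡2 : ∀ {v a b} → a ≢ b → E X v a → E X v b → (∀ {y} → E X v y → y ≡ a ⊎ y ≡ b) → deg X v ≡ 2
  deg≡2 {v} {a} {b} a≢b ea eb only = ℕₚ.≤-antisym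
    (uniq-⊆-length {ys = a ∷ b ∷ []} (Uniqueₚ.filter⁺ (Boolₚ.T? ∘ adj X v) (Uniqueₚ.allFin⁺ n))
      λ m → [ here , there ∘ here ]′ (only (nbrs⁻ m)))
    (two-≤-deg a≢b ea eb)

  EdgeDel-sym : ∀ {a b u v} → EdgeDel X a b u v → EdgeDel X a b v u
  EdgeDel-sym {u = u} {v} (e , f) = trans (sym X v u) e , f ∘ λ { (inj₁ (p , q)) → inj₂ (q , p) ; (inj₂ (p , q)) → inj₁ (q , p) }

  EdgeDel-swap : ∀ {a b u v} → EdgeDel X a b u v → EdgeDel X b a u v
  EdgeDel-swap (e , f) = e , f ∘ swap

  noncut-sym : ∀ {a b} → Star (EdgeDel X a b) a b → Star (EdgeDel X b a) b a
  noncut-sym = Star.gmap id EdgeDel-swap ∘ Star.reverse EdgeDel-sym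

  last-departure : ∀ {R : Fin n → Fin n → Set} {a b} → a ≢ b → Star R a b →
    ∃ λ x → R a x × Star (λ u v → R u v × u ≢ a × v ≢ a) x b
  last-departure {R} {a} {b} a≢b s with go s
    where
    Avoid = Star (λ u v → R u v × u ≢ a × v ≢ a)
    go : ∀ {y} → Star R y b → Avoid y b ⊎ ∃ λ x → R a x × Avoid x b
    go ε = inj₁ ε
    go (_◅_ {i = y} {j = y′} e s) with go s
    ... | inj₂ r = inj₂ r
    ... | inj₁ r with y ≟ a | y′ ≟ a
    ...   | yes refl | _ = inj₂ (y′ , e , r)
    ...   | no y≢a | no y′≢a = inj₁ ((e , y≢a , y′≢a) ◅ r)
    ...   | no _ | yes refl with r
    ...     | ε = contradiction refl a≢b
    ...     | (_ , q , _) ◅ _ = contradiction refl q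
  ... | inj₂ r = r
  ... | inj₁ ε = contradiction refl a≢b
  ... | inj₁ ((_ , q , _) ◅ _) = contradiction refl q

  -- At a vertex t of degree 2 with neighbours t′ and u, a closed walk through one of its edges uses both.
  noncut-next : ∀ {t′ t u} → t ≢ t′ → t′ ≢ u → E X t t′ → (∀ {y} → E X t y → y ≡ t′ ⊎ y ≡ u) →
    Star (EdgeDel X t′ t) t′ t → Star (EdgeDel X t u) t u
  noncut-next {t′} {t} {u} t≢t′ t′≢u tt′ only s
    with last-departure t≢t′ (Star.reverse EdgeDel-sym s)
  ... | x , (e , ne) , r with only e
  ...   | inj₁ refl = contradiction (inj₂ (refl , refl)) ne
  ...   | inj₂ refl = Star.reverse EdgeDel-sym
    (Star.gmap id (λ { ((e , _) , p , q) → e , λ { (inj₁ (p′ , _)) → p p′ ; (inj₂ (_ , q′)) → q q′ } }) r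
      ◅◅ ((trans (sym X t′ t) tt′ , λ { (inj₁ (p , _)) → t≢t′ (≡sym p) ; (inj₂ (p , _)) → t′≢u p }) ◅ ε))

module Growth {n t : ℕ} (X : Graph n) (connected : Connected X) (¬cycle : ¬ IsCycle X)
              (col : Fin n → Fin t) (c κ₁ κ₂ : Fin t) (κ₁≢c : κ₁ ≢ c) (κ₂≢c : κ₂ ≢ c)
              {l₁ l₂ : Fin n} (l₁≢l₂ : l₁ ≢ l₂) (col-l₁ : col l₁ ≡ κ₁) (col-l₂ : col l₂ ≡ κ₂)
              (b : ℕ) (2≤b : 2 ≤ b) (b≤K : b ≤ length (Arrangement.blanks X col c)) (¬bridge : ¬ HasBridge X b)
              (σ₀ : Fin n → Fin n) (inj₀ : Injective _≡_ _≡_ σ₀) (_≈_ : Fin n → Fin n → Set)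
              (equivalence : ClawEquivalence X col c κ₁ κ₂ σ₀ _≈_) where

  open Moves X col
  open Arrangement X col c
  open ClawEquivalence equivalence
  open Neighbours X
  open Train X col c κ₁ κ₂ κ₁≢c κ₂≢c σ₀ _≈_ equivalence

  -- All reachable configurations are covered, because the step from `S` to `w ∷ S` rearranges the
  -- tokens before it appeals to the claim for `S`.
  Claim : List (Fin n) → Set
  Claim S = ∀ {τ} → σ₀ ⇝ τ → BlanksIn S τ → ∀ {x y} → x ∈ S → y ∈ S → col (τ x) ≡ c → col (τ y) ≡ c → τ x ≈ τ y

  Extension : List (Fin n) → Set
  Extension S = ∃ λ w → w ∉ S × (∃ λ s → s ∈ S × E X s w) × Claim (w ∷ S)

  -- So small an `S` that contains every blank has room for at most one token of colour `c`.
  claim-small : ∀ {S} → length S ≤ suc (length blanks) → Claim S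
  claim-small {S} le {τ} r bin {x} {y} x∈ y∈ cx cy with x ≟ y
  ... | yes refl = ≈-refl
  ... | no x≢y with blank-positions (⇝-injective inj₀ r)
  ... | vs , uv , bv , K≤ = contradiction (ℕₚ.≤-trans (s≤s (s≤s K≤)) (ℕₚ.≤-trans
          (uniq-⊆-length {xs = x ∷ y ∷ vs}
            (uniq-∷ (λ { (here q) → x≢y q ; (there m) → bv m cx }) (uniq-∷ (λ m → bv m cy) uv))
            (λ { (here refl) → x∈ ; (there (here refl)) → y∈ ; (there (there m)) → bin (bv m) })) le))
        ℕₚ.1+n≰n

  -- Rearrange inside `w ∷ S` until `w` and `z` hold tokens of colour `c` and the blanks stand as
  -- `key` wants them. All blanks are then in `S`, where the claim is known, and `key` links the one
  -- remaining token, at `w`, to the one at `z`. The rearrangement only permutes the tokens on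
  -- `w ∷ S`, so the original ones are covered.
  extend : ∀ {S w z p q us} → Unique S → Conn (w ∷ S) → w ∉ S → suc (length blanks) ≤ length S → Claim S →
    z ∈ S → Unique (p ∷ q ∷ us) → (∀ {v} → v ∈ p ∷ q ∷ us → v ∈ S) → z ∉ p ∷ q ∷ us → 2 + length us ≤ length blanks →
    (∀ {τ} → σ₀ ⇝ τ → col (τ w) ≡ c → col (τ z) ≡ c → col (τ p) ≡ κ₁ → col (τ q) ≡ κ₂ →
      (∀ {v} → v ∈ us → Blank τ v) → τ w ≈ τ z) →
    Claim (w ∷ S)
  extend {S} {w} {z} {p} {q} {us} uS conn w∉ big claimS z∈ u ⊆S z∉ le key {τ} r bin {x} {y} x∈ y∈ cx cy
    with injective⇒surjective (⇝-injective inj₀ r) l₁ | injective⇒surjective (⇝-injective inj₀ r) l₂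
  ... | y₁ , e₁ | y₂ , e₂
    with bring-two {S = w ∷ S} conn (there (⊆S (here refl))) (there (⊆S (there (here refl))))
           (λ { refl → uniq-∉ u (here refl) })
           (bin (λ f → κ₁≢c (trans (≡sym col-l₁) (trans (cong col (≡sym e₁)) f))))
           (bin (λ f → κ₂≢c (trans (≡sym col-l₂) (trans (cong col (≡sym e₂)) f))))
           (λ f → l₁≢l₂ (trans (≡sym e₁) (trans (cong τ (≡sym f)) e₂))) τ
       | extend-list (w ∷ S) (p ∷ q ∷ us) (w ∷ z ∷ []) (length blanks) (uniq-∷ w∉ uS) u (there ∘ ⊆S)
           (λ { m (here refl) → w∉ (⊆S m) ; m (there (here refl)) → z∉ m }) le
           (subst (_≤ suc (length S)) (ℕₚ.+-comm 2 (length blanks)) (s≤s big))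
  ... | τ₁ , r₁ , ep , eq | ts , uts , len , ts⊇ , ts⊆ , avoid
    with arrange conn uts ts⊆ len τ₁ (⇝-injective inj₀ (⇝-trans r (proj₁ r₁))) (BlanksIn-⇝ r₁ bin)
  ... | τ₂ , r₂ , bl , non , keep = go x∈ cx y∈ cy
    where
    r₁₂ : τ ⇝[ w ∷ S ] τ₂
    r₁₂ = ⇝[]-trans r₁ r₂
    r′ : σ₀ ⇝ τ₂
    r′ = ⇝-trans r (proj₁ r₁₂)
    p₁ : col (τ₁ p) ≡ κ₁
    p₁ = trans ep (trans (cong col e₁) col-l₁)
    q₁ : col (τ₁ q) ≡ κ₂
    q₁ = trans eq (trans (cong col e₂) col-l₂)
    w-c : col (τ₂ w) ≡ c
    w-c = non λ m → avoid m (here refl)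
    z-c : col (τ₂ z) ≡ c
    z-c = non λ m → avoid m (there (here refl))
    wz : τ₂ w ≈ τ₂ z
    wz = key r′ w-c z-c
      (trans (keep (ts⊇ (here refl)) (λ f → κ₁≢c (trans (≡sym p₁) f))) p₁)
      (trans (keep (ts⊇ (there (here refl))) (λ f → κ₂≢c (trans (≡sym q₁) f))) q₁)
      (λ m → bl (ts⊇ (there (there m))))
    bin₂ : BlanksIn S τ₂
    bin₂ {v} bv with BlanksIn-⇝ r₁₂ bin bv
    ... | here refl = contradiction w-c bv
    ... | there m = m
    to-z : ∀ {v} → v ∈ w ∷ S → col (τ₂ v) ≡ c → τ₂ v ≈ τ₂ z
    to-z (here refl) _ = wz
    to-z (there m) cv = claimS r′ bin₂ m z∈ cv z-c
    label : ∀ {v} → v ∈ w ∷ S → col (τ v) ≡ c → τ v ≈ τ₂ z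
    label {v} m cv with ⇝[]-label (⇝-injective inj₀ r) r₁₂ m
    ... | v′ , v′∈ , e = subst (_≈ τ₂ z) e (to-z v′∈ (trans (cong col e) cv))
    go : x ∈ w ∷ S → col (τ x) ≡ c → y ∈ w ∷ S → col (τ y) ≡ c → τ x ≈ τ y
    go x∈ cx y∈ cy = ≈-trans cx z-c cy (label x∈ cx) (≈-sym (label y∈ cy))

  module Step {S : List (Fin n)} (uS : Unique S) (conn : Conn S) (big : suc (length blanks) ≤ length S) (claimS : Claim S)
              {w s : Fin n} (w∉ : w ∉ S) (s∈ : s ∈ S) (sw : E X s w) where

    private
      connw : Conn (w ∷ S)
      connw = Conn-∷ conn s∈ sw

    -- A path in S ending at s along which the subgraph induced on S does not branch.
    data Tail : List (Fin n) → Set where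
      start : Tail (s ∷ [])
      more  : ∀ {t P t′} → Tail (t ∷ P) → t′ ∈ S → E X t t′ → t′ ∉ t ∷ P →
              (∀ {y} → y ∈ S → E X t y → y ≡ t′ ⊎ y ∈ take 1 P) → Tail (t′ ∷ t ∷ P)

    tail-⊆ : ∀ {P} → Tail P → ∀ {v} → v ∈ P → v ∈ S
    tail-⊆ start (here refl) = s∈
    tail-⊆ (more T t′∈ _ _ _) (here refl) = t′∈
    tail-⊆ (more T _ _ _ _) (there m) = tail-⊆ T m

    tail-unique : ∀ {P} → Tail P → Unique P
    tail-unique start = uniq-∷ (λ ()) []
    tail-unique (more T _ _ new _) = uniq-∷ new (tail-unique T)

    tail-path : ∀ {t P} → Tail (t ∷ P) → ∃ λ u → Path X u (P ++ w ∷ []) w × E X t u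
    tail-path start = w , one w , sw
    tail-path (more T _ e _ _) with tail-path T
    ... | u , p , f = _ , f ∷ p , E-sym e

    take⊆ : ∀ P {y : Fin n} → y ∈ take 1 P → y ∈ P
    take⊆ (_ ∷ _) (here refl) = here refl

    tail-closed : ∀ {t P x y} → Tail (t ∷ P) → x ∈ P → y ∈ S → E X x y → y ∈ t ∷ P
    tail-closed (more {P = P} T _ _ _ only) (here refl) y∈ e with only y∈ e
    ... | inj₁ refl = here refl
    ... | inj₂ m = there (there (take⊆ P m))
    tail-closed (more T _ _ _ _) (there m) y∈ e = there (tail-closed T m y∈ e)

    Next : Fin n → List (Fin n) → Fin n → Set
    Next t P y = y ∈ S × E X t y × y ∉ take 1 P

    Next? : ∀ t P y → Dec (Next t P y)
    Next? t P y = (y ∈? S) ×-dec E? X t y ×-dec ¬? (y ∈? take 1 P)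

    -- An edge from `t` back to the tail beyond its predecessor would be a branching at a vertex
    -- where the tail has none.
    Next-∉ : ∀ {t P y} → Tail (t ∷ P) → Next t P y → y ∉ t ∷ P
    Next-∉ T (_ , e , _) (here refl) = E-≢ e refl
    Next-∉ {P = u ∷ P} T (_ , _ , y∉) (there (here refl)) = y∉ (here refl)
    Next-∉ {t} {u ∷ P} T@(more T′ _ _ new _) (y∈ , e , _) (there (there m)) =
      new (tail-closed T′ m (tail-⊆ T (here refl)) (E-sym e))

    -- With `P` full of blanks, the token at `w` slides along it to the neighbour of `t` and
    -- completes a claw at `t` with the leaves `p` and `q`. The blanks used are those on `P` and on
    -- these two leaves.
    branch : ∀ {t P p q} → Tail (t ∷ P) → Next t P p → Next t P q → p ≢ q → 2 + length P ≤ length blanks → Extension S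
    branch {t} {P} {p} {q} T np nq p≢q le = w , w∉ , (s , s∈ , sw) ,
      extend uS connw w∉ big claimS (tail-⊆ T (here refl))
        (uniq-∷ (λ { (here e) → p≢q e ; (there m) → Next-∉ T np (there m) })
          (uniq-∷ (Next-∉ T nq ∘ there) (uniq-tail (tail-unique T))))
        (λ { (here refl) → proj₁ np ; (there (here refl)) → proj₁ nq ; (there (there m)) → tail-⊆ T (there m) })
        (λ { (here refl) → Next-∉ T np (here refl) ; (there (here refl)) → Next-∉ T nq (here refl)
           ; (there (there m)) → uniq-∉ (tail-unique T) m })
        le key
      where
      ∉path : ∀ {v} → v ∈ S → v ∉ P → v ∉ P ++ w ∷ []
      ∉path v∈ v∉ m with ∈-++⁻ P m
      ... | inj₁ m′ = v∉ m′
      ... | inj₂ (here refl) = w∉ v∈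
      t∉ = ∉path (tail-⊆ T (here refl)) (uniq-∉ (tail-unique T))
      p∉ = ∉path (proj₁ np) (Next-∉ T np ∘ there)
      q∉ = ∉path (proj₁ nq) (Next-∉ T nq ∘ there)
      key : ∀ {τ} → σ₀ ⇝ τ → col (τ w) ≡ c → col (τ t) ≡ c → col (τ p) ≡ κ₁ → col (τ q) ≡ κ₂ →
        (∀ {v} → v ∈ P → Blank τ v) → τ w ≈ τ t
      key {τ} r cw ct cp cq bl with tail-path T
      ... | u , path , tu
        with slide path (uniq-↭ (↭ₚ.++-comm (w ∷ []) P) (uniq-∷ (w∉ ∘ tail-⊆ T ∘ there) (uniq-tail (tail-unique T)))) blank cw
        where
        blank : ∀ {v} → v ∈ P ++ w ∷ [] → v ≢ w → Blank τ v
        blank m v≢w with ∈-++⁻ P m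
        ... | inj₁ m′ = bl m′
        ... | inj₂ (here e) = contradiction e v≢w
      ... | τ′ , (r′ , off) , e = ≈-sym (subst₂ _≈_ (off t∉) e
              (claw (⇝-trans r r′) uniq₄ tu (proj₁ (proj₂ np)) (proj₁ (proj₂ nq))
                (trans (cong col (off t∉)) ct) (trans (cong col e) cw)
                (trans (cong col (off p∉)) cp) (trans (cong col (off q∉)) cq)))
        where
        uniq₄ : Unique (t ∷ u ∷ p ∷ q ∷ [])
        uniq₄ = uniq-∷ (λ { (here f) → E-≢ tu f ; (there (here f)) → E-≢ (proj₁ (proj₂ np)) f
                          ; (there (there (here f))) → E-≢ (proj₁ (proj₂ nq)) f })
                  (uniq-∷ (λ { (here refl) → p∉ (Path-first path) ; (there (here refl)) → q∉ (Path-first path) })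
                    (uniq-∷ (λ { (here f) → p≢q f }) (uniq-∷ (λ ()) [])))

    -- A tail that cannot be continued is closed under adjacency in `S` and is therefore all of `S`,
    -- which has more vertices than there are blanks.
    some-next : ∀ {t P} → Tail (t ∷ P) → suc (length P) ≤ length blanks → ∃ (Next t P)
    some-next {t} {P} T le with Finₚ.any? (Next? t P)
    ... | yes p = p
    ... | no ¬p = contradiction (ℕₚ.≤-trans big (ℕₚ.≤-trans (uniq-⊆-length uS covers) le)) ℕₚ.1+n≰n
      where
      closed : ∀ {x y} → x ∈ t ∷ P → y ∈ S → E X x y → y ∈ t ∷ P
      closed (there m) y∈ e = tail-closed T m y∈ e
      closed {y = y} (here refl) y∈ e with y ∈? take 1 P
      ... | yes m = there (take⊆ P m)
      ... | no m = contradiction (y , y∈ , e , m) ¬p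
      reach : ∀ {x y} → ConnectedIn S x y → x ∈ t ∷ P → y ∈ t ∷ P
      reach ε m = m
      reach ((e , _ , y∈) ◅ r) m = reach r (closed m y∈ e)
      covers : ∀ {v} → v ∈ S → v ∈ t ∷ P
      covers v∈ = reach (conn (tail-⊆ T (here refl)) v∈) (here refl)

    -- `leafy` says that no boundary vertex of `S` is itself a branching vertex. A vertex with two
    -- neighbours in `S` then has none outside, so inner vertices of a tail have degree 2 in `X` and
    -- not merely in `S`.
    module Long (leafy : ∀ {x y p q} → x ∈ S → y ∉ S → E X x y → p ∈ S → q ∈ S → E X x p → E X x q → p ≡ q) where

      Inner : Fin n → Set
      Inner x = ∀ {y} → E X x y → y ∈ S

      inner : ∀ {x p q} → x ∈ S → p ∈ S → q ∈ S → E X x p → E X x q → p ≢ q → Inner x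
      inner x∈ p∈ q∈ ep eq p≢q {y} e = decidable-stable (y ∈? S) λ y∉ → p≢q (leafy x∈ y∉ e p∈ q∈ ep eq)

      -- As `t′` is the only neighbour of `s` in `S`, the other neighbour `w′` of `s` on the cycle
      -- lies outside `S`. It is `w′` rather than `w` that is added: the pair on `s` and `w′`
      -- travels round the cycle, with the blanks on `t′` and on the neighbour `s₃` of `t′`.
      through-cycle : ∀ {t′} → Tail (t′ ∷ s ∷ []) → Inner t′ → Star (EdgeDel X t′ s) t′ s → Extension S
      through-cycle {t′} T@(more start t′∈ e _ only) in′ nc
        with NonCutEdge.cycle-with-exit X connected ¬cycle e (noncut-sym nc)
      ... | w′ , π , cyc , sw′ , w′≢t′ , t′∈π , (s₃ , s₃∈ , s₃≢s , e₃) , z , v , z∈ , v∉ , zv =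
        w′ , w′∉ , (s , s∈ , sw′) ,
        extend {p = t′} {s₃} {[]} uS (Conn-∷ conn s∈ sw′) w′∉ big claimS s∈
          (uniq-∷ (λ { (here f) → E-≢ e₃ (≡sym f) }) (uniq-∷ (λ ()) []))
          (λ { (here refl) → t′∈ ; (there (here refl)) → s₃∈S })
          (λ { (here f) → E-≢ e f ; (there (here f)) → s₃≢s (≡sym f) })
          (ℕₚ.≤-trans 2≤b b≤K)
          (λ r cw cs c₁ c₂ _ → ≈-sym (train cyc r cs cw t′∈π s₃∈π (E-≢ e₃) c₁ c₂ z∈ v∉ zv))
        where
        w′∉ : w′ ∉ S
        w′∉ m with only m sw′
        ... | inj₁ f = w′≢t′ f
        s₃∈S : s₃ ∈ S
        s₃∈S = in′ (E-sym e₃)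
        s₃∈π : s₃ ∈ π
        s₃∈π = ∈-tail s₃∈ λ { refl → w′∉ s₃∈S }

      only-two : ∀ {t P t′ u} → Tail (t′ ∷ t ∷ u ∷ P) → Inner t → ∀ {y} → E X t y → y ≡ t′ ⊎ y ≡ u
      only-two (more _ _ _ _ only) int e with only (int e) e
      ... | inj₁ f = inj₁ f
      ... | inj₂ (here f) = inj₂ f

      inner-second : ∀ {t P t′ u} → Tail (t′ ∷ t ∷ u ∷ P) → Inner t
      inner-second T@(more T′@(more _ _ e′ _ _) t′∈ e new _) =
        inner (tail-⊆ T′ (here refl)) t′∈ (tail-⊆ T (there (there (here refl)))) e (E-sym e′) (λ { refl → new (there (here refl)) })

      -- Since inner vertices of the tail have degree 2, a cycle through one edge of the tail
      -- follows it down to `s`.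
      descend : ∀ {t′ t P} → Tail (t′ ∷ t ∷ P) → Inner t′ → Star (EdgeDel X t′ t) t′ t → Extension S
      descend T@(more start _ _ _ _) in′ nc = through-cycle T in′ nc
      descend T@(more T′@(more _ _ _ _ _) _ e new _) in′ nc =
        descend T′ (inner-second T)
          (noncut-next (E-≢ e) (λ { refl → new (there (here refl)) }) e (only-two T (inner-second T)) nc)

      descend-at : ∀ {t P} → Tail (t ∷ P) → Inner t → (i j : Fin (suc (length P))) → suc (toℕ i) ≡ toℕ j →
        Star (EdgeDel X (lookup (t ∷ P) i) (lookup (t ∷ P) j)) (lookup (t ∷ P) i) (lookup (t ∷ P) j) → Extension S
      descend-at {P = []} T in′ zero zero ()
      descend-at {P = u ∷ P} T in′ zero (suc zero) refl nc = descend T in′ nc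
      descend-at {P = u ∷ []} T in′ (suc zero) (suc zero) ()
      descend-at {P = u ∷ P@(_ ∷ _)} T@(more T′ _ _ _ _) in′ (suc i) (suc j) e nc =
        descend-at T′ (inner-second T) i j (ℕₚ.suc-injective e) nc

      tail-edge : ∀ {t P} → Tail (t ∷ P) → (i j : Fin (suc (length P))) → suc (toℕ i) ≡ toℕ j →
        E X (lookup (t ∷ P) i) (lookup (t ∷ P) j)
      tail-edge {P = []} T zero zero ()
      tail-edge (more _ _ e _ _) zero (suc zero) refl = E-sym e
      tail-edge (more T _ _ _ _) (suc i) (suc j) e = tail-edge T i j (ℕₚ.suc-injective e)

      tail-deg : ∀ {t P} → Tail (t ∷ P) → (i : Fin (suc (length P))) → toℕ i ≢ 0 → toℕ i ≢ length P →
        deg X (lookup (t ∷ P) i) ≡ 2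
      tail-deg T zero i≢0 _ = contradiction refl i≢0
      tail-deg {P = _ ∷ []} T (suc zero) _ i≢ = contradiction refl i≢
      tail-deg {P = _ ∷ _ ∷ _} T@(more (more _ _ e′ _ _) _ e new _) (suc zero) _ _ =
        deg≡2 (λ { refl → new (there (here refl)) }) e (E-sym e′) (only-two T (inner-second T))
      tail-deg {P = _ ∷ _} (more T _ _ _ _) (suc (suc i)) _ i≢ = tail-deg T (suc i) (λ ()) (i≢ ∘ cong suc)

      tail-end : ∀ {t u P} → Tail (t ∷ u ∷ P) → deg X (lookup (t ∷ u ∷ P) (fromℕ (suc (length P)))) ≢ 1
      tail-end (more start t∈ e _ _) = deg≢1 (λ { refl → w∉ t∈ }) e sw
      tail-end (more T@(more _ _ _ _ _) _ _ _ _) = tail-end T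

      -- If all edges of the tail are cut-edges it is a `b`-bridge: the end `s` has the further
      -- neighbour `w`, and the head has a next vertex `s′`, so neither has degree 1.
      long : ∀ {t P} → Tail (t ∷ P) → suc (length P) ≡ b → Extension S
      long {t} {[]} T e = contradiction (subst (2 ≤_) (≡sym e) 2≤b) (λ { (s≤s ()) })
      long {t} {P@(u ∷ P′)} T e with some-next T (subst (_≤ length blanks) (≡sym e) b≤K)
      ... | s′ , s′∈ , ts′ , s′∉ with Finₚ.any? (λ (i : Fin (suc (length P))) → Finₚ.any? (λ (j : Fin (suc (length P))) →
              (suc (toℕ i) ℕₚ.≟ toℕ j) ×-dec
              Distance.Star? (EdgeDel X (lookup (t ∷ P) i) (lookup (t ∷ P) j)) (EdgeDel? X (lookup (t ∷ P) i) (lookup (t ∷ P) j))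
                (lookup (t ∷ P) j) (lookup (t ∷ P) i)))
      ... | yes (i , j , ij , nc) = descend-at T in-t i j ij nc
        where
        tu : E X t u
        tu = tail-edge T zero (suc zero) refl
        in-t : Inner t
        in-t = inner (tail-⊆ T (here refl)) s′∈ (tail-⊆ T (there (here refl))) ts′ tu (λ { refl → s′∉ (here refl) })
      ... | no ¬nc = contradiction bridge ¬bridge
        where
        tu : E X t u
        tu = tail-edge T zero (suc zero) refl
        bridge : HasBridge X b
        bridge = subst (HasBridge X) e
          ( lookup (t ∷ P) , lookup-injective (tail-unique T)
          , (λ i j ij → tail-edge T i j ij , λ nc → ¬nc (i , j , ij , nc))
          , tail-deg T
          , deg≢1 (λ { refl → s′∉ (here refl) }) ts′ tu
          , tail-end T)

      -- `d` is the number of vertices by which the tail falls short of `b`. While it is positive, a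
      -- branching at the head can be served with `b` blanks; a tail of `b` vertices would need one
      -- more.
      search : ∀ d {t P} → Tail (t ∷ P) → suc (length P) + d ≡ b → Extension S
      search zero T e = long T (trans (≡sym (ℕₚ.+-identityʳ _)) e)
      search (suc d) {t} {P} T e with Finₚ.any? (λ p → Finₚ.any? (λ q → Next? t P p ×-dec Next? t P q ×-dec ¬? (p ≟ q)))
      ... | yes (p , q , np , nq , p≢q) = branch T np nq p≢q (ℕₚ.≤-trans
              (subst (2 + length P ≤_) (trans (cong suc (≡sym (ℕₚ.+-suc (length P) d))) e) (s≤s (s≤s (ℕₚ.m≤m+n (length P) d)))) b≤K)
      ... | no ¬two with some-next T (ℕₚ.≤-trans (subst (suc (length P) ≤_) e (ℕₚ.m≤m+n (suc (length P)) (suc d))) b≤K)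
      ...   | t′ , nt = search d (more T (proj₁ nt) (proj₁ (proj₂ nt)) (Next-∉ T nt) only) (trans (≡sym (ℕₚ.+-suc _ d)) e)
        where
        only : ∀ {y} → y ∈ S → E X t y → y ≡ t′ ⊎ y ∈ take 1 P
        only {y} y∈ ty with y ∈? take 1 P
        ... | yes m = inj₂ m
        ... | no m = inj₁ (decidable-stable (y ≟ t′) λ ne → ¬two (y , t′ , (y∈ , ty , m) , nt , ne))

  boundary : ∀ {S s} → s ∈ S → length S < n → ∃₂ λ x w → x ∈ S × w ∉ S × E X x w
  boundary {S} {s} s∈ lt with pigeon (allFin n) S (Uniqueₚ.allFin⁺ n) (subst (length S <_) (≡sym (length-allFin n)) lt)
  ... | v , _ , v∉ = crossing {X = X} S (connected s v) s∈ v∉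

  -- Small sets contain too few tokens to matter; a boundary vertex with two neighbours in `S` is a
  -- claw without any path to cross; what remains is the search along a tail.
  extension : ∀ {S s} → Unique S → Conn S → s ∈ S → length S < n → Claim S → Extension S
  extension {S} uS conn s∈ lt claimS with length S ≤? length blanks
  ... | yes le with boundary s∈ lt
  ...   | x , w , x∈ , w∉ , e = w , w∉ , (x , x∈ , e) , claim-small (s≤s le)
  extension {S} uS conn s∈ lt claimS | no ¬le
    with Finₚ.any? (λ x → Finₚ.any? (λ w → (x ∈? S) ×-dec ¬? (w ∈? S) ×-dec E? X x w ×-dec
           Finₚ.any? (λ p → Finₚ.any? (λ q → (p ∈? S) ×-dec (q ∈? S) ×-dec E? X x p ×-dec E? X x q ×-dec ¬? (p ≟ q)))))
  ... | yes (x , w , x∈ , w∉ , xw , p , q , p∈ , q∈ , xp , xq , p≢q) =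
        branch start (p∈ , xp , λ ()) (q∈ , xq , λ ()) p≢q (ℕₚ.≤-trans 2≤b b≤K)
    where open Step uS conn (ℕₚ.≰⇒> ¬le) claimS w∉ x∈ xw
  ... | no ¬p with boundary s∈ lt
  ...   | x , w , x∈ , w∉ , xw = Long.search leafy (b ∸ 1) start (ℕₚ.m+[n∸m]≡n (ℕₚ.≤-trans (s≤s z≤n) 2≤b))
    where
    open Step uS conn (ℕₚ.≰⇒> ¬le) claimS w∉ x∈ xw
    leafy : ∀ {x y p q} → x ∈ S → y ∉ S → E X x y → p ∈ S → q ∈ S → E X x p → E X x q → p ≡ q
    leafy {x} {y} {p} {q} x∈ y∉ e p∈ q∈ ep eq =
      decidable-stable (p ≟ q) λ ne → ¬p (x , y , x∈ , y∉ , e , p , q , p∈ , q∈ , ep , eq , ne)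

  grow : ∀ d {S s} → Unique S → Conn S → s ∈ S → length S + d ≡ n → Claim S → Claim (allFin n)
  grow zero {S} uS conn s∈ len claimS r _ _ _ = claimS r (λ _ → all _) (all _) (all _)
    where
    all : ∀ v → v ∈ S
    all v = decidable-stable (v ∈? S) λ v∉ →
      ℕₚ.<-irrefl (trans (≡sym (ℕₚ.+-identityʳ (length S))) len) (uniq-length≤ (uniq-∷ v∉ uS))
  grow (suc d) {S} uS conn s∈ len claimS with extension uS conn s∈ lt claimS
    where
    lt : length S < n
    lt = subst (length S <_) len (subst (length S <_) (≡sym (ℕₚ.+-suc (length S) d)) (s≤s (ℕₚ.m≤m+n (length S) d)))
  ... | w , w∉ , (x , x∈ , e) , claim = grow d (uniq-∷ w∉ uS) (Conn-∷ conn x∈ e) (there s∈) (trans (≡sym (ℕₚ.+-suc _ d)) len) claim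

  all-equivalent : ∀ {i j} → col i ≡ c → col j ≡ c → i ≈ j
  all-equivalent {i} {j} ci cj with injective⇒surjective inj₀ i | injective⇒surjective inj₀ j
  ... | x , refl | y , refl =
    grow (n ∸ 1) {x ∷ []} (uniq-∷ (λ ()) []) (λ { (here refl) (here refl) → ε }) (here refl)
      (ℕₚ.m+[n∸m]≡n (ℕₚ.≤-trans (s≤s z≤n) (Finₚ.toℕ<n x)))
      (claim-small (s≤s z≤n)) ⇝-refl (λ _ → ∈-allFin _) (∈-allFin x) (∈-allFin y) ci cj

-- Relabellings reachable from a configuration

module Exchanges {n t : ℕ} (X : Graph n) (col : Fin n → Fin t) (σ₀ : Fin n → Fin n) where

  open Moves X col

  ⇝-inverse : ∀ π ρ → ColourPreserving ρ → (∀ l → ρ (π l) ≡ l) → σ₀ ⇝ π ∘ σ₀ → σ₀ ⇝ ρ ∘ σ₀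
  ⇝-inverse _ _ cp inv p = ⇝-sym (⇝-respʳ (inv ∘ σ₀) (⇝-relabel cp p))

  module Coset {θ : Fin n → Fin n} (θ-cp : ColourPreserving θ) (θ-inv : ∀ l → θ (θ l) ≡ l) where

    -- The transpositions in the coset θ G, where G is the group of relabellings reachable from σ₀.
    infix 4 _≈_
    _≈_ : Fin n → Fin n → Set
    i ≈ j = i ≡ j ⊎ σ₀ ⇝ θ ∘ transpose i j ∘ σ₀

    ≈-sym : ∀ {i j} → i ≈ j → j ≈ i
    ≈-sym (inj₁ e) = inj₁ (≡sym e)
    ≈-sym {i} {j} (inj₂ p) = inj₂ (⇝-respʳ (λ v → cong θ (transpose-comm i j (σ₀ v))) p)

    flip : ∀ {i j} → col i ≡ col j → σ₀ ⇝ θ ∘ transpose i j ∘ σ₀ → σ₀ ⇝ transpose i j ∘ θ ∘ σ₀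
    flip {i} {j} e = ⇝-inverse (θ ∘ transpose i j) (transpose i j ∘ θ) (∘-cp (transpose-cp e) θ-cp)
      (λ l → trans (cong (transpose i j) (θ-inv (transpose i j l))) (transpose-involutive i j l))

    -- The inverse of one element of the coset times another lies in the group, and the two factors
    -- `θ` cancel.
    pair : ∀ {i j k l} → col i ≡ col j → σ₀ ⇝ θ ∘ transpose i j ∘ σ₀ → σ₀ ⇝ θ ∘ transpose k l ∘ σ₀ →
      σ₀ ⇝ transpose i j ∘ transpose k l ∘ σ₀
    pair {i} {j} {k} {l} e p q = ⇝-respʳ (λ v → cong (transpose i j) (θ-inv (transpose k l (σ₀ v))))
      (⇝-comp (transpose i j ∘ θ) (θ ∘ transpose k l) (∘-cp (transpose-cp e) θ-cp) (flip e p) q)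

    -- `θ (i j)` followed on the right by the group element `(j k)(i j)` is `θ (i k)`.
    ≈-trans : ∀ {i j k} → col i ≡ col j → col j ≡ col k → i ≈ j → j ≈ k → i ≈ k
    ≈-trans _ _ (inj₁ refl) q = q
    ≈-trans _ _ p (inj₁ refl) = p
    ≈-trans {i} {j} {k} ij jk (inj₂ p) (inj₂ q) with i ≟ j | j ≟ k | i ≟ k
    ... | yes refl | _ | _ = inj₂ q
    ... | no _ | yes refl | _ = inj₂ p
    ... | no _ | no _ | yes e = inj₁ e
    ... | no i≢j | no j≢k | no i≢k = inj₂ (⇝-respʳ (λ v → cong θ (transpose-conj i≢j j≢k i≢k (σ₀ v)))
            (⇝-comp (θ ∘ transpose i j) (transpose j k ∘ transpose i j) (∘-cp θ-cp (transpose-cp ij)) p (pair jk q p)))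

    -- It rests on the identity `(j k)(i j)(i k) = (i j)`, multiplied by `θ` on the left.
    three-cycle : ∀ {i j k} → i ≢ j → j ≢ k → i ≢ k → col i ≡ col j → col j ≡ col k →
      σ₀ ⇝ transpose i j ∘ transpose i k ∘ σ₀ → j ≈ k → i ≈ j
    three-cycle i≢j j≢k i≢k ij jk p (inj₁ e) = contradiction e j≢k
    three-cycle {i} {j} {k} i≢j j≢k i≢k ij jk p (inj₂ q) =
      inj₂ (⇝-respʳ (λ v → cong θ (act-≗ (lookup-injective (uniq-∷ {xs = j ∷ k ∷ []}
              (λ { (here e) → i≢j e ; (there (here e)) → i≢k e }) (uniq-∷ (λ { (here e) → j≢k e }) (uniq-∷ (λ ()) []))))
              ((suc zero , suc (suc zero)) ∷ (zero , suc zero) ∷ (zero , suc (suc zero)) ∷ []) ((zero , suc zero) ∷ [])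
              (λ { zero → refl ; (suc zero) → refl ; (suc (suc zero)) → refl }) (σ₀ v)))
        (⇝-comp (θ ∘ transpose j k) (transpose i j ∘ transpose i k) (∘-cp θ-cp (transpose-cp jk)) q p))

    all-exchangeable : ∀ {i j} → σ₀ ⇝ θ ∘ σ₀ → i ≈ j → σ₀ ⇝ transpose i j ∘ σ₀
    all-exchangeable {i} p (inj₁ refl) = done (λ v → ≡sym (transpose-refl i (σ₀ v)))
    all-exchangeable {i} {j} p (inj₂ q) = ⇝-respʳ (λ v → θ-inv (transpose i j (σ₀ v))) (⇝-comp θ (θ ∘ transpose i j) θ-cp p q)

  id-cp : ColourPreserving id
  id-cp _ = refl

  module Pure = Coset {id} id-cp (λ _ → refl)

  -- `g` is what a claw yields. Its second factor does nothing to labels of the colour of `u`, so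
  -- conjugation by `g` turns `(u v)` into `(u′ v)` and hands a property of `u` on to `u′`.
  module Conjugate {u u′ p q : Fin n} (uu′ : col u ≡ col u′) (pq : col p ≡ col q)
                   (u≢p : col u ≢ col p) (g∈ : σ₀ ⇝ transpose u u′ ∘ transpose p q ∘ σ₀) where

    g g⁻¹ : Fin n → Fin n
    g = transpose u u′ ∘ transpose p q
    g⁻¹ = transpose p q ∘ transpose u u′

    conjugate : ∀ {h} → ColourPreserving h → σ₀ ⇝ h ∘ σ₀ → σ₀ ⇝ g ∘ h ∘ g⁻¹ ∘ σ₀
    conjugate {h} cp h∈ = ⇝-comp g (h ∘ g⁻¹) (∘-cp (transpose-cp uu′) (transpose-cp pq)) g∈ (⇝-comp h g⁻¹ cp h∈
      (⇝-inverse g g⁻¹ (∘-cp (transpose-cp pq) (transpose-cp uu′))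
        (λ l → trans (cong (transpose p q) (transpose-involutive u u′ (transpose p q l))) (transpose-involutive p q l)) g∈))

    g-injective : Injective _≡_ _≡_ g
    g-injective = transpose-injective p q ∘ transpose-injective u u′

    g-inverse : ∀ l → g (g⁻¹ l) ≡ l
    g-inverse l = trans (cong (transpose u u′) (transpose-involutive p q (transpose u u′ l))) (transpose-involutive u u′ l)

    g-off : ∀ {v} → col v ≡ col u → transpose p q v ≡ v
    g-off {v} e = transpose-≢ (λ { refl → u≢p (≡sym e) }) (λ { refl → u≢p (trans (≡sym e) (≡sym pq)) })

    g-u : g u ≡ u′
    g-u = trans (cong (transpose u u′) (g-off refl)) (transpose-ˡ u u′)

    g-fix : ∀ {v} → col v ≡ col u → v ≢ u → v ≢ u′ → g v ≡ v
    g-fix e v≢u v≢u′ = trans (cong (transpose u u′) (g-off e)) (transpose-≢ v≢u v≢u′)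

    conjugate-transpose : ∀ {v} → col v ≡ col u → v ≢ u → v ≢ u′ → ∀ l → g (transpose u v l) ≡ transpose u′ v (g l)
    conjugate-transpose {v} e v≢u v≢u′ l = trans (transpose-natural g-injective u v l)
      (cong₂ (λ x y → transpose x y (g l)) g-u (g-fix e v≢u v≢u′))

-- On an odd cycle, carry the token tok at the first position round the cycle until everything returns to
-- its place; every other token is passed length C times.
module Rotation {n t : ℕ} (X : Graph n) (col : Fin n → Fin t) (σ : Fin n → Fin n) (inj : Injective _≡_ _≡_ σ)
                {θ : Fin n → Fin n} (θ-cp : Moves.ColourPreserving X col θ) (θ-inv : ∀ l → θ (θ l) ≡ l)
                (tok : Fin n) (C : List (Fin n))
                (coset : ∀ {l} → l ∈ map σ C → l ≢ tok → col tok ≡ col l → Moves._⇝_ X col σ (θ ∘ transpose tok l ∘ σ)) where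

  open Moves X col
  open Exchanges X col σ
  open Coset {θ} θ-cp θ-inv

  -- `τ` is the imagined configuration, in which `tok` also passes tokens of its own colour. The
  -- flag tells whether the configuration really reached differs from it by `θ`.
  Reached : Bool → (Fin n → Fin n) → Set
  Reached false τ = σ ⇝ τ
  Reached true τ = σ ⇝ θ ∘ τ

  Reached-injective : ∀ β {τ} → Reached β τ → Injective _≡_ _≡_ τ
  Reached-injective false r = ⇝-injective inj r
  Reached-injective true r = ⇝-injective inj r ∘ cong θ

  same? : Fin n → Bool
  same? l = does (col tok ≟ col l)

  parity : List (Fin n) → Bool
  parity [] = false
  parity (l ∷ ls) = same? l xor parity ls

  -- Passing a token of another colour is a legal swap. Passing a token `m` of the same colour
  -- amounts to a relabelling by `(tok m)`; as `θ (tok m)` is reachable, this toggles the flag.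
  pass : ∀ β {τ x y m} → E X x y → τ x ≡ tok → τ y ≡ m → m ∈ map σ C → m ≢ tok → Reached β τ →
    Reached (β xor same? m) (τ ∘ transpose x y)
  pass β {τ} {x} {y} {m} e refl refl m∈ m≢ r with col tok ≟ col m
  pass false e refl refl m∈ m≢ r | no ne = ⇝-trans r (⇝-move e ne)
  pass true e refl refl m∈ m≢ r | no ne = ⇝-trans r (⇝-relabel θ-cp (⇝-move e ne))
  pass false {τ} {x} {y} e refl refl m∈ m≢ r | yes q =
    ⇝-respʳ (λ v → cong θ (≡sym (transpose-natural (Reached-injective false r) x y v)))
      (⇝-trans (coset m∈ m≢ q) (⇝-relabel (∘-cp θ-cp (transpose-cp q)) r))
  pass true {τ} {x} {y} e refl refl m∈ m≢ r | yes q =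
    ⇝-respʳ (λ v → trans (cong (transpose (τ x) (τ y)) (θ-inv (τ v))) (≡sym (transpose-natural (Reached-injective true r) x y v)))
      (⇝-trans (flip q (coset m∈ m≢ q)) (⇝-relabel (∘-cp (transpose-cp q) θ-cp) r))

  rotate : List (Fin n) → List (Fin n)
  rotate [] = []
  rotate (x ∷ xs) = xs ++ x ∷ []

  rotates : ℕ → List (Fin n) → List (Fin n)
  rotates zero L = L
  rotates (suc k) L = rotates k (rotate L)

  rotates-+ : ∀ j k L → rotates (j + k) L ≡ rotates k (rotates j L)
  rotates-+ zero k L = refl
  rotates-+ (suc j) k L = rotates-+ j k (rotate L)

  rotates-length : ∀ as bs → rotates (length as) (as ++ bs) ≡ bs ++ as
  rotates-length [] bs = ≡sym (Listₚ.++-identityʳ bs)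
  rotates-length (a ∷ as) bs = trans (cong (rotates (length as)) (Listₚ.++-assoc as bs (a ∷ [])))
    (trans (rotates-length as (bs ++ a ∷ [])) (Listₚ.++-assoc bs (a ∷ []) as))

  rotates-* : ∀ k L → rotates (k * length L) L ≡ L
  rotates-* zero L = refl
  rotates-* (suc k) L = trans (rotates-+ (length L) (k * length L) L)
    (trans (cong (rotates (k * length L)) (trans (cong (rotates (length L)) (≡sym (Listₚ.++-identityʳ L))) (rotates-length L [])))
           (rotates-* k L))

  record State (L : List (Fin n)) (ms : List (Fin n)) (β : Bool) : Set where
    constructor state
    field
      {τ}     : Fin n → Fin n
      cyclic  : Cyclic X L
      within  : ∀ {v} → v ∈ L → v ∈ C
      word    : map τ L ≡ tok ∷ ms
      outside : ∀ {v} → v ∉ C → τ v ≡ σ v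
      reached : Reached β τ

  one-step : ∀ {L m ms β} → (∀ {l} → l ∈ m ∷ ms → l ∈ map σ C) → State L (m ∷ ms) β →
    State (rotate L) (ms ++ m ∷ []) (β xor same? m)
  one-step {x ∷ y ∷ ρ} {m} {ms} {β} ms⊆ (state {τ} cyc@(u , _ , _ , p , _) win w out r) =
    state {τ = τ ∘ transpose x y} (Cyclic-rotate cyc)
      (λ v∈ → [ win ∘ there , (λ { (here refl) → win (here refl) }) ]′ (∈-++⁻ (y ∷ ρ) v∈))
      (trans (cong (_∷ map (τ ∘ transpose x y) (ρ ++ x ∷ [])) (trans (cong τ (transpose-ʳ x y)) at-x))
        (cong (tok ∷_) (trans (Listₚ.map-++ (τ ∘ transpose x y) ρ (x ∷ []))
          (cong₂ _++_ (trans (Listₚ.map-cong-local {xs = ρ} (All.tabulate untouched)) at-ρ)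
                      (cong (_∷ []) (trans (cong τ (transpose-ˡ x y)) at-y))))))
      (λ v∉ → trans (cong τ (transpose-≢ (λ { refl → v∉ (win (here refl)) }) (λ { refl → v∉ (win (there (here refl))) }))) (out v∉))
      (pass β (Path-edge p) at-x at-y (ms⊆ (here refl))
        (λ q → x≢y (Reached-injective β r (trans at-x (trans (≡sym q) (≡sym at-y))))) r)
    where
    at-x : τ x ≡ tok
    at-x = Listₚ.∷-injectiveˡ w
    at-y : τ y ≡ m
    at-y = Listₚ.∷-injectiveˡ (Listₚ.∷-injectiveʳ w)
    at-ρ : map τ ρ ≡ ms
    at-ρ = Listₚ.∷-injectiveʳ (Listₚ.∷-injectiveʳ w)
    x≢y : x ≢ y
    x≢y refl = uniq-∉ u (here refl)
    untouched : ∀ {v} → v ∈ ρ → τ (transpose x y v) ≡ τ v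
    untouched v∈ = cong τ (transpose-≢ (λ { refl → uniq-∉ u (there v∈) }) (λ { refl → uniq-∉ (uniq-tail u) v∈ }))

  steps : ∀ as bs {L β} → (∀ {l} → l ∈ as ++ bs → l ∈ map σ C) → State L (as ++ bs) β →
    State (rotates (length as) L) (bs ++ as) (β xor parity as)
  steps [] bs {L} {β} sub st = subst₂ (State L) (≡sym (Listₚ.++-identityʳ bs)) (≡sym (Boolₚ.xor-identityʳ β)) st
  steps (a ∷ as) bs {L} {β} sub st =
    subst₂ (State (rotates (length as) (rotate L))) (Listₚ.++-assoc bs (a ∷ []) as) (Boolₚ.xor-assoc β (same? a) (parity as))
      (steps as (bs ++ a ∷ []) (sub ∘ back)
        (subst (λ ls → State (rotate L) ls (β xor same? a)) (Listₚ.++-assoc as bs (a ∷ [])) (one-step sub st)))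
    where
    back : ∀ {l} → l ∈ as ++ bs ++ a ∷ [] → l ∈ a ∷ as ++ bs
    back {l} m with ∈-++⁻ (as ++ bs) (subst (l ∈_) (≡sym (Listₚ.++-assoc as bs (a ∷ []))) m)
    ... | inj₁ m′ = there m′
    ... | inj₂ (here q) = here q

  -- A turn passes each other token once. It restores the word `ms`, toggles the flag, and advances
  -- the starting point on the cycle by `length ms` places.
  turns : ∀ k {ms L β} → (∀ {l} → l ∈ ms → l ∈ map σ C) → parity ms ≡ true → State L ms β →
    State (rotates (k * length ms) L) ms (β xor odd k)
  turns zero {ms} {L} {β} sub par st = subst (State L ms) (≡sym (Boolₚ.xor-identityʳ β)) st
  turns (suc k) {ms} {L} {β} sub par st =
    subst₂ (λ L′ → State L′ ms) (≡sym (rotates-+ (length ms) (k * length ms) L))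
      (trans (cong (λ z → (β xor z) xor odd k) par) (Boolₚ.xor-assoc β true (odd k)))
      (turns k sub par (steps ms [] (sub ∘ subst (_ ∈_) (Listₚ.++-identityʳ ms))
        (subst (λ ls → State L ls β) (≡sym (Listₚ.++-identityʳ ms)) st)))

  odd-turn : ∀ {x xs} → C ≡ x ∷ xs → σ x ≡ tok → Cyclic X C → odd (length C) ≡ true → parity (map σ xs) ≡ true →
    σ ⇝ θ ∘ σ
  odd-turn {x} {xs} refl refl cyc o par
    with subst₂ (λ L → State L (map σ xs)) back o
           (turns (length C) {β = false} there par (state {τ = σ} cyc id refl (λ _ → refl) ⇝-refl))
    where
    back : rotates (length C * length (map σ xs)) C ≡ C
    -- One turn advances by `length xs`, one less than the length of the cycle, so `length C` turns
    -- advance by a multiple of that length. Their number is odd, which leaves one factor `θ`.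
    back = trans (cong (λ k → rotates k C) (trans (cong (length C *_) (Listₚ.length-map σ xs)) (ℕₚ.*-comm (length C) (length xs))))
                 (rotates-* (length xs) C)
  ... | state {τ} _ _ w out r = ⇝-respʳ (λ v → cong θ (agree v)) r
    where
    agree : ∀ v → τ v ≡ σ v
    agree v with v ∈? C
    ... | yes v∈ = map-≡⇒≗ C w v∈
    ... | no v∉ = out v∉

-- Two colours

module Spider {n t : ℕ} (X : Graph n) (col : Fin n → Fin t) {c d : Fin t} (c≢d : c ≢ d)
              {σ : Fin n → Fin n} (inj : Injective _≡_ _≡_ σ)
              {y₀ y₁ y₂ z x₀ x₁ x₂ e : Fin n} (u : Unique (y₀ ∷ y₁ ∷ y₂ ∷ z ∷ x₀ ∷ x₁ ∷ x₂ ∷ e ∷ []))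
              (e₀ : E X y₀ y₁) (e₁ : E X y₁ y₂) (e₂ : E X y₂ z) (e₃ : E X z x₀) (e₄ : E X x₀ x₁) (e₅ : E X x₁ x₂)
              (ze : E X z e)
              (y-col : ∀ {v} → v ∈ y₀ ∷ y₁ ∷ y₂ ∷ e ∷ [] → col (σ v) ≡ d)
              (x-col : ∀ {v} → v ∈ z ∷ x₀ ∷ x₁ ∷ x₂ ∷ [] → col (σ v) ≡ c) where

  open Moves X col
  open Exchanges X col σ

  private
    ι : Fin 8 → Fin n
    ι = lookup (y₀ ∷ y₁ ∷ y₂ ∷ z ∷ x₀ ∷ x₁ ∷ x₂ ∷ e ∷ [])

    ι-inj : Injective _≡_ _≡_ ι
    ι-inj = lookup-injective u

    pattern #0 = zero
    pattern #1 = suc #0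
    pattern #2 = suc #1
    pattern #3 = suc #2
    pattern #4 = suc #3
    pattern #5 = suc #4
    pattern #6 = suc #5
    pattern #7 = suc #6

    -- turns d d d c c c c along the path into c c d c c d d, keeping the order within each colour
    shift : List (Fin 8 × Fin 8)
    shift = (#2 , #3) ∷ (#1 , #2) ∷ (#0 , #1) ∷ (#3 , #4) ∷ (#2 , #3) ∷ (#1 , #2)
          ∷ (#4 , #5) ∷ (#3 , #4) ∷ (#5 , #6) ∷ (#4 , #5) ∷ []

    τ : Fin n → Fin n
    τ = σ ∘ act ι shift

    σ⇝τ : σ ⇝ τ
    σ⇝τ = Gadget.run ι-inj {c ∷ d ∷ []} (uniq-∷ (λ { (here q) → c≢d q }) (uniq-∷ (λ ()) []))
      (lookup (suc zero ∷ suc zero ∷ suc zero ∷ zero ∷ zero ∷ zero ∷ zero ∷ suc zero ∷ []))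
      (λ { #0 → y-col (here refl) ; #1 → y-col (there (here refl)) ; #2 → y-col (there (there (here refl)))
         ; #3 → x-col (here refl) ; #4 → x-col (there (here refl)) ; #5 → x-col (there (there (here refl)))
         ; #6 → x-col (there (there (there (here refl)))) ; #7 → y-col (there (there (there (here refl)))) })
      shift
      ((λ ()) , e₂ , (λ ()) , e₁ , (λ ()) , e₀ , (λ ()) , e₃ , (λ ()) , e₂ , (λ ()) , e₁ ,
       (λ ()) , e₄ , (λ ()) , e₃ , (λ ()) , e₅ , (λ ()) , e₄ , tt)

    τ-at : ∀ m → τ (ι m) ≡ σ (ι (act id shift m))
    τ-at m = cong σ (act-image ι-inj shift m)

    claw-unique : Unique (z ∷ x₀ ∷ y₂ ∷ e ∷ [])
    claw-unique = Uniqueₚ.map⁺ {f = ι} ι-inj {#3 ∷ #4 ∷ #2 ∷ #7 ∷ []}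
      (((λ ()) ∷ (λ ()) ∷ (λ ()) ∷ []) ∷ ((λ ()) ∷ (λ ()) ∷ []) ∷ ((λ ()) ∷ []) ∷ [] ∷ [])

    claw-at : ∀ {ρ i j k l} → Injective _≡_ _≡_ ρ → ρ z ≡ i → ρ x₀ ≡ j → ρ y₂ ≡ k → ρ e ≡ l →
      col i ≡ c → col j ≡ c → col k ≡ d → col l ≡ d → ρ ⇝ transpose i j ∘ transpose k l ∘ ρ
    claw-at ρ-inj refl refl refl refl ci cj dk dl =
      Claw.exchange-both claw-unique e₃ (trans (sym X z y₂) e₂) ze ρ-inj (trans cj (≡sym ci))
        (λ q → c≢d (trans (≡sym ci) (trans q dk))) (λ q → c≢d (trans (≡sym ci) (trans q dl))) (trans dl (≡sym dk))

    d-cols : ∀ {v v′} → v ∈ y₀ ∷ y₁ ∷ y₂ ∷ e ∷ [] → v′ ∈ y₀ ∷ y₁ ∷ y₂ ∷ e ∷ [] → ColourPreserving (transpose (σ v) (σ v′))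
    d-cols v∈ v′∈ = transpose-cp (trans (y-col v∈) (≡sym (y-col v′∈)))

    c-cols : ∀ {v v′} → v ∈ z ∷ x₀ ∷ x₁ ∷ x₂ ∷ [] → v′ ∈ z ∷ x₀ ∷ x₁ ∷ x₂ ∷ [] → ColourPreserving (transpose (σ v) (σ v′))
    c-cols v∈ v′∈ = transpose-cp (trans (x-col v∈) (≡sym (x-col v′∈)))

    g h : Fin n → Fin n
    g = transpose (σ z) (σ x₀) ∘ transpose (σ y₂) (σ e)
    h = transpose (σ x₁) (σ x₂) ∘ transpose (σ y₀) (σ e)

    g-cp : ColourPreserving g
    g-cp = ∘-cp (c-cols (here refl) (there (here refl)))
                (d-cols (there (there (here refl))) (there (there (there (here refl)))))

    h-cp : ColourPreserving h
    h-cp = ∘-cp (c-cols (there (there (here refl))) (there (there (there (here refl)))))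
                (d-cols (here refl) (there (there (there (here refl)))))

    g∈ : σ ⇝ g ∘ σ
    g∈ = claw-at inj refl refl refl refl (x-col (here refl)) (x-col (there (here refl)))
           (y-col (there (there (here refl)))) (y-col (there (there (there (here refl)))))

    -- After `shift` the claw at `z` carries the labels of `x₁`, `x₂` and `y₀` instead of those of
    -- `z`, `x₀` and `y₂`, with `e` untouched. So `g` and `h` move disjoint pairs of colour `c`,
    -- which vanish in a square, and in colour `d` they share only the label of `e`.
    h∈ : σ ⇝ h ∘ σ
    h∈ = ⇝-conj h-cp (⇝-sym σ⇝τ) (claw-at (⇝-injective inj σ⇝τ) (τ-at #3) (τ-at #4) (τ-at #2) (τ-at #7)
           (x-col (there (there (here refl)))) (x-col (there (there (there (here refl)))))
           (y-col (here refl)) (y-col (there (there (there (here refl))))))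

  -- (g h)² with g = (z x₀)(y₂ e) and h = (x₁ x₂)(y₀ e), where positions stand for their labels.
  spider : σ ⇝ transpose (σ y₂) (σ e) ∘ transpose (σ y₂) (σ y₀) ∘ σ
  spider = ⇝-respʳ (λ v → act-≗ {ι = σ ∘ ι} (ι-inj ∘ inj)
      ((#3 , #4) ∷ (#2 , #7) ∷ (#5 , #6) ∷ (#0 , #7) ∷ (#3 , #4) ∷ (#2 , #7) ∷ (#5 , #6) ∷ (#0 , #7) ∷ [])
      ((#2 , #7) ∷ (#2 , #0) ∷ [])
      (λ { #0 → refl ; #1 → refl ; #2 → refl ; #3 → refl ; #4 → refl ; #5 → refl ; #6 → refl ; #7 → refl }) (σ v))
    (⇝-comp g (h ∘ g ∘ h) g-cp g∈ (⇝-comp h (g ∘ h) h-cp h∈ (⇝-comp g h g-cp g∈ h∈)))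

module TwoColours {n t : ℕ} (X : Graph n) (connected : Connected X) (¬cycle : ¬ IsCycle X)
                  (col : Fin n → Fin t) {c d : Fin t} (c≢d : c ≢ d) (cover : ∀ l → col l ≡ c ⊎ col l ≡ d)
                  (b : ℕ) (2≤b : 2 ≤ b) (¬bridge : ¬ HasBridge X b) where

  open Moves X col

  ¬c⇒d : ∀ {l} → col l ≢ c → col l ≡ d
  ¬c⇒d {l} ne = [ (λ e → contradiction e ne) , id ]′ (cover l)

  module _ {l₁ l₂ : Fin n} (l₁≢l₂ : l₁ ≢ l₂) (l₁-c : col l₁ ≡ c) (l₂-c : col l₂ ≡ c)
           (b≤M : b ≤ length (Arrangement.blanks X col d))
           (σ : Fin n → Fin n) (inj : Injective _≡_ _≡_ σ) where

    open Exchanges X col σ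

    -- In colour `d` a claw gives no transposition, only a product `(u u′)(p q)`. The growth
    -- argument is therefore run for the relation of lying in `Class` together, which claws respect
    -- once such products preserve `Class`.
    class-closed : (Class : Fin n → Set) →
      (∀ {u u′ p q} → u ≢ u′ → col u ≡ d → col u′ ≡ d → col p ≡ c → col q ≡ c →
        σ ⇝ transpose u u′ ∘ transpose p q ∘ σ → Class u → Class u′) →
      ∀ {i j} → col i ≡ d → col j ≡ d → Class i → Class j
    class-closed Class link di dj = proj₁ (Growth.all-equivalent X connected ¬cycle col d c c c≢d c≢d l₁≢l₂ l₁-c l₂-c
      b 2≤b b≤M ¬bridge σ inj (λ i j → (Class i → Class j) × (Class j → Class i)) record
        { ≈-refl = id , id
        ; ≈-sym = λ (f , g) → g , f
        ; ≈-trans = λ _ _ _ (f , g) (h , k) → h ∘ f , g ∘ k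
        ; claw = claw } di dj)
      where
      claw : ∀ {τ z x p q} → σ ⇝ τ → Unique (z ∷ x ∷ p ∷ q ∷ []) → E X z x → E X z p → E X z q →
        col (τ z) ≡ d → col (τ x) ≡ d → col (τ p) ≡ c → col (τ q) ≡ c →
        (Class (τ z) → Class (τ x)) × (Class (τ x) → Class (τ z))
      claw {τ} {z} {x} {p} {q} r u zx zp zq dz dx cp cq =
        link zx≢ dz dx cp cq g∈ ,
        link (zx≢ ∘ ≡sym) dx dz cp cq (⇝-respʳ (λ v → transpose-comm (τ z) (τ x) (transpose (τ p) (τ q) (σ v))) g∈)
        where
        τ-inj = ⇝-injective inj r
        zx≢ : τ z ≢ τ x
        zx≢ e = E-≢ zx (τ-inj e)
        g∈ : σ ⇝ transpose (τ z) (τ x) ∘ transpose (τ p) (τ q) ∘ σ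
        g∈ = ⇝-conj (∘-cp (transpose-cp (trans dz (≡sym dx))) (transpose-cp (trans cp (≡sym cq)))) (⇝-sym r)
          (Claw.exchange-both u zx zp zq τ-inj (trans dx (≡sym dz))
            (λ f → c≢d (trans (≡sym cp) (trans (≡sym f) dz))) (λ f → c≢d (trans (≡sym cq) (trans (≡sym f) dz)))
            (trans cq (≡sym cp)))

    -- The class consists of the labels `i` for which `(i x)` is reachable or trivial. Conjugation
    -- passes it from `u` to `u′`; for `u = x`, where there is nothing to conjugate, `(x e)` takes
    -- its place.
    all-pure : ∀ {x e} → x ≢ e → col x ≡ d → col e ≡ d → σ ⇝ transpose x e ∘ σ →
      ∀ {i j} → col i ≡ d → col j ≡ d → σ ⇝ transpose i j ∘ σ
    all-pure {x} {e} x≢e dx de p {i} {j} di dj =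
      Pure.all-exchangeable ⇝-refl (Pure.≈-trans (trans di (≡sym dx)) (trans dx (≡sym dj)) (all di) (Pure.≈-sym (all dj)))
      where
      open Pure
      e≈x : e ≈ x
      e≈x = ≈-sym (inj₂ p)
      move-to : ∀ {u u′ p q v} → u ≢ u′ → col u ≡ d → col u′ ≡ d → col p ≡ c → col q ≡ c →
        σ ⇝ transpose u u′ ∘ transpose p q ∘ σ → u ≢ v → col v ≡ d → u ≈ v → u′ ≈ v
      move-to {u} {u′} {v = v} u≢u′ du du′ cp cq g∈ u≢v dv (inj₁ q) = contradiction q u≢v
      move-to {u} {u′} {p} {q} {v} u≢u′ du du′ cp cq g∈ u≢v dv (inj₂ h) with u′ ≟ v
      ... | yes f = inj₁ f
      ... | no u′≢v = inj₂ (⇝-respʳ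
              (λ w → trans (conjugate-transpose (trans dv (≡sym du)) (u≢v ∘ ≡sym) (u′≢v ∘ ≡sym) (g⁻¹ (σ w)))
                       (cong (transpose u′ v) (g-inverse (σ w))))
              (conjugate (transpose-cp (trans du (≡sym dv))) h))
        where open Conjugate (trans du (≡sym du′)) (trans cp (≡sym cq)) (λ f → c≢d (trans (≡sym cp) (trans (≡sym f) du))) g∈
      link : ∀ {u u′ p q} → u ≢ u′ → col u ≡ d → col u′ ≡ d → col p ≡ c → col q ≡ c →
        σ ⇝ transpose u u′ ∘ transpose p q ∘ σ → u ≈ x → u′ ≈ x
      link {u} u≢u′ du du′ cp cq g∈ u≈x with u ≟ x
      ... | no u≢x = move-to u≢u′ du du′ cp cq g∈ u≢x dx u≈x
      ... | yes refl = ≈-trans (trans du′ (≡sym de)) (trans de (≡sym dx))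
              (move-to u≢u′ du du′ cp cq g∈ x≢e de (≈-sym e≈x)) e≈x
      all : ∀ {i} → col i ≡ d → i ≈ x
      all di = class-closed (_≈ x) link dx di (inj₁ refl)

    module ThreeInCoset {x y z : Fin n} (x≢y : x ≢ y) (x≢z : x ≢ z) (y≢z : y ≢ z)
                        (dx : col x ≡ d) (dy : col y ≡ d) (dz : col z ≡ d) where

      θ-cp : ColourPreserving (transpose x y)
      θ-cp = transpose-cp (trans dx (≡sym dy))

      open Coset θ-cp (transpose-involutive x y) public

      -- Conjugating `θ (u v)` would alter `θ` too. Two elements of the coset are therefore first
      -- multiplied to `(u v)(u v′)`, free of `θ`; its conjugate `(u′ v)(u′ v′)` together with
      -- `v ≈ v′` yields `u′ ≈ v`.
      all-coset : σ ⇝ transpose x y ∘ transpose x z ∘ σ → ∀ {i j} → col i ≡ d → col j ≡ d → i ≈ j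
      all-coset x≈z {i} {j} di dj = ≈-trans (trans di (≡sym dx)) (trans dx (≡sym dj)) (all di) (≈-sym (all dj))
        where
        x≈y : x ≈ y
        x≈y = inj₂ (done (λ v → ≡sym (transpose-involutive x y (σ v))))
        dd : ∀ {i j} → col i ≡ d → col j ≡ d → col i ≡ col j
        dd p q = trans p (≡sym q)
        y≈z : y ≈ z
        y≈z = ≈-trans (dd dy dx) (dd dx dz) (≈-sym x≈y) (inj₂ x≈z)
        move-to : ∀ {u u′ p q v v′} → col u ≡ d → col u′ ≡ d → col p ≡ c → col q ≡ c →
          σ ⇝ transpose u u′ ∘ transpose p q ∘ σ → u ≢ v → u ≢ v′ → v ≢ v′ → col v ≡ d → col v′ ≡ d →
          u ≈ v → v ≈ v′ → u′ ≈ v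
        move-to {u} {u′} {p} {q} {v} {v′} du du′ cp cq g∈ u≢v u≢v′ v≢v′ dv dv′ u≈v v≈v′
          with u′ ≟ v | u′ ≟ v′ | u≈v | ≈-trans (dd du dv) (dd dv dv′) u≈v v≈v′
        ... | yes f | _ | _ | _ = inj₁ f
        ... | no _ | yes refl | _ | _ = ≈-sym v≈v′
        ... | no _ | no _ | inj₁ f | _ = contradiction f u≢v
        ... | no _ | no _ | inj₂ _ | inj₁ f = contradiction f u≢v′
        ... | no u′≢v | no u′≢v′ | inj₂ uv | inj₂ uv′ =
              three-cycle u′≢v v≢v′ u′≢v′ (dd du′ dv) (dd dv dv′) (⇝-respʳ conj
                (conjugate (∘-cp (transpose-cp (dd du dv)) (transpose-cp (dd du dv′))) (pair (dd du dv) uv uv′))) v≈v′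
          where
          open Conjugate (dd du du′) (trans cp (≡sym cq)) (λ f → c≢d (trans (≡sym cp) (trans (≡sym f) du))) g∈
          conj : ∀ w → g (transpose u v (transpose u v′ (g⁻¹ (σ w)))) ≡ transpose u′ v (transpose u′ v′ (σ w))
          conj w = trans (conjugate-transpose (dd dv du) (u≢v ∘ ≡sym) (u′≢v ∘ ≡sym) (transpose u v′ (g⁻¹ (σ w))))
            (cong (transpose u′ v) (trans (conjugate-transpose (dd dv′ du) (u≢v′ ∘ ≡sym) (u′≢v′ ∘ ≡sym) (g⁻¹ (σ w)))
              (cong (transpose u′ v′) (g-inverse (σ w)))))
        link : ∀ {u u′ p q} → u ≢ u′ → col u ≡ d → col u′ ≡ d → col p ≡ c → col q ≡ c →
          σ ⇝ transpose u u′ ∘ transpose p q ∘ σ → u ≈ x → u′ ≈ x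
        link {u} u≢u′ du du′ cp cq g∈ u≈x with u ≟ x | u ≟ y
        ... | yes refl | _ = ≈-trans (dd du′ dy) (dd dy dx)
                (move-to du du′ cp cq g∈ x≢y x≢z y≢z dy dz x≈y y≈z) (≈-sym x≈y)
        ... | no u≢x | yes refl = move-to du du′ cp cq g∈ u≢x y≢z x≢z dx dz u≈x (inj₂ x≈z)
        ... | no u≢x | no u≢y = move-to du du′ cp cq g∈ u≢x u≢y x≢y dx dy u≈x x≈y
        all : ∀ {i} → col i ≡ d → i ≈ x
        all di = class-closed (_≈ x) link dx di (inj₁ refl)

  open Arrangement X col c

  place : ∀ {ts av} → Unique ts → (∀ {x} → x ∈ ts → x ∉ av) → length ts ≤ length blanks → length blanks + length av ≤ n →
    ∀ σ → Injective _≡_ _≡_ σ →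
    ∃ λ τ → σ ⇝ τ × (∀ {v} → v ∈ ts → col (τ v) ≡ d) × (∀ {v} → v ∈ av → col (τ v) ≡ c)
  place {ts} {av} u dis le bound σ inj
    with extend-list (allFin n) ts av (length blanks) (Uniqueₚ.allFin⁺ n) u (λ _ → ∈-allFin _) dis le
           (subst (length blanks + length av ≤_) (≡sym (length-allFin n)) bound)
  ... | us , uu , len , ts⊆ , _ , avoid
    with arrange (Conn-allFin connected) uu (λ _ → ∈-allFin _) len σ inj (λ _ → ∈-allFin _)
  ... | τ , (r , _) , bl , non , _ = τ , r , (λ m → ¬c⇒d (bl (ts⊆ m))) , λ m → non (λ m′ → avoid m′ m)

  -- The label at `x` is carried round and meets its own colour exactly on `qs`, so the parity of
  -- one turn is that of `length qs`.
  rotation : ∀ {τ x qs rs θ} → Injective _≡_ _≡_ τ → Cyclic X (x ∷ qs ++ rs) → odd (length (x ∷ qs ++ rs)) ≡ true →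
    odd (length qs) ≡ true → (∀ {v} → v ∈ x ∷ qs → col (τ v) ≡ d) → (∀ {v} → v ∈ rs → col (τ v) ≡ c) →
    ColourPreserving θ → (∀ l → θ (θ l) ≡ l) →
    (∀ {v} → v ∈ qs → τ ⇝ θ ∘ transpose (τ x) (τ v) ∘ τ) → τ ⇝ θ ∘ τ
  rotation {τ} {x} {qs} {rs} {θ} inj cyc o oq d-col c-col θ-cp θ-inv coset =
    odd-turn refl refl cyc o (trans (count-all qs (d-col ∘ there)) oq)
    where
    coset′ : ∀ {l} → l ∈ map τ (x ∷ qs ++ rs) → l ≢ τ x → col (τ x) ≡ col l → τ ⇝ θ ∘ transpose (τ x) l ∘ τ
    coset′ m l≢ q with ∈-map⁻ τ m
    ... | _ , here refl , refl = contradiction refl l≢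
    ... | _ , there v∈ , refl with ∈-++⁻ qs v∈
    ...   | inj₁ v∈qs = coset v∈qs
    ...   | inj₂ v∈rs = contradiction (trans (≡sym (c-col v∈rs)) (trans (≡sym q) (d-col (here refl)))) c≢d
    open Rotation X col τ inj {θ} θ-cp θ-inv (τ x) (x ∷ qs ++ rs) coset′
    none : ∀ rs → (∀ {v} → v ∈ rs → col (τ v) ≡ c) → parity (map τ rs) ≡ false
    none [] _ = refl
    none (r ∷ rs) cc with col (τ x) ≟ col (τ r)
    ... | yes q = contradiction (trans (≡sym (cc (here refl))) (trans (≡sym q) (d-col (here refl)))) c≢d
    ... | no _ = none rs (cc ∘ there)
    count-all : ∀ qs → (∀ {v} → v ∈ qs → col (τ v) ≡ d) → parity (map τ (qs ++ rs)) ≡ odd (length qs)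
    count-all [] _ = none rs c-col
    count-all (q ∷ qs) dd with col (τ x) ≟ col (τ q)
    ... | yes _ = cong not (count-all qs (dd ∘ there))
    ... | no ne = contradiction (trans (d-col (here refl)) (≡sym (dd (here refl)))) ne

  module _ {l₁ l₂ : Fin n} (l₁≢l₂ : l₁ ≢ l₂) (l₁-c : col l₁ ≡ c) (l₂-c : col l₂ ≡ c)
           (b≤M : b ≤ length (Arrangement.blanks X col d)) {σ : Fin n → Fin n} (inj : Injective _≡_ _≡_ σ) where

    -- With exactly two tokens of colour d on the cycle, they are exchanged by the rotation.
    pure-by-two : ∀ {x₀ x₁ rs} → Cyclic X (x₀ ∷ x₁ ∷ rs) → odd (length (x₀ ∷ x₁ ∷ rs)) ≡ true →
      2 ≤ length blanks → length blanks + length rs ≤ n → ∀ {i j} → col i ≡ d → col j ≡ d → σ ⇝ transpose i j ∘ σ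
    pure-by-two {x₀} {x₁} {rs} cyc o 2≤K le {i} {j} di dj
      with place {x₀ ∷ x₁ ∷ []} {rs} (uniq-∷ (λ { (here refl) → uniq-∉ (proj₁ cyc) (here refl) }) (uniq-∷ (λ ()) []))
             (λ { (here refl) m → uniq-∉ (proj₁ cyc) (there m) ; (there (here refl)) m → uniq-∉ (uniq-tail (proj₁ cyc)) m })
             2≤K le σ inj
    ... | τ , r , d-col , c-col =
      ⇝-conj (transpose-cp (trans di (≡sym dj))) (⇝-sym r)
        (all-pure l₁≢l₂ l₁-c l₂-c b≤M τ τ-inj (λ q → uniq-∉ (proj₁ cyc) (here (τ-inj q)))
          (d-col (here refl)) (d-col (there (here refl)))
          (rotation {qs = x₁ ∷ []} {rs} {θ} τ-inj cyc o refl d-col c-col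
            (transpose-cp (trans (d-col (here refl)) (≡sym (d-col (there (here refl))))))
            (transpose-involutive (τ x₀) (τ x₁))
            -- As `θ` is the transposition of the two tokens themselves, the only product to be
            -- provided is the identity.
            (λ { (here refl) → done (λ v → ≡sym (transpose-involutive (τ x₀) (τ x₁) (τ v))) }))
          di dj)
      where
      τ-inj = ⇝-injective inj r
      θ = transpose (τ x₀) (τ x₁)

    -- When neither colour nearly fills the cycle, the rotation of an even number of tokens of colour d is
    -- an odd permutation, and the spider provides all even ones.
    module Many {y₀ y₁ y₂ z x₀ x₁ x₂ e : Fin n} {rest : List (Fin n)} {q : ℕ}
                (cyc : Cyclic X (y₀ ∷ y₁ ∷ y₂ ∷ z ∷ x₀ ∷ x₁ ∷ x₂ ∷ rest))
                (o : odd (length (y₀ ∷ y₁ ∷ y₂ ∷ z ∷ x₀ ∷ x₁ ∷ x₂ ∷ rest)) ≡ true)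
                (e∉ : e ∉ y₀ ∷ y₁ ∷ y₂ ∷ z ∷ x₀ ∷ x₁ ∷ x₂ ∷ rest) (ze : E X z e) where

      private
        seven xs ys zs : List (Fin n)
        seven = y₀ ∷ y₁ ∷ y₂ ∷ z ∷ x₀ ∷ x₁ ∷ x₂ ∷ []
        xs = y₁ ∷ y₂ ∷ z ∷ x₀ ∷ x₁ ∷ x₂ ∷ rest
        ys = y₀ ∷ y₁ ∷ y₂ ∷ e ∷ []
        zs = z ∷ x₀ ∷ x₁ ∷ x₂ ∷ []
        u₈ : Unique (seven ++ e ∷ [])
        u₈ = uniq-↭ (↭ₚ.++-comm (e ∷ []) seven) (uniq-∷ (e∉ ∘ ∈-++⁺ˡ {xs = seven}) (uniq-++ˡ seven (proj₁ cyc)))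
        u₈′ : Unique (ys ++ zs)
        u₈′ = uniq-↭ (↭ₚ.++⁺ˡ (y₀ ∷ y₁ ∷ y₂ ∷ []) (↭ₚ.++-comm zs (e ∷ []))) u₈
        edges : ∀ {x y} → Path X x (y₀ ∷ xs) y →
          E X y₀ y₁ × E X y₁ y₂ × E X y₂ z × E X z x₀ × E X x₀ x₁ × E X x₁ x₂
        edges p = Path-edge p , edges₅ p
          where
          edges₁ : ∀ {x₁ x₂ rest x y} → Path X x (x₀ ∷ x₁ ∷ x₂ ∷ rest) y → E X x₀ x₁ × E X x₁ x₂
          edges₁ p@(_ ∷ p₁) = Path-edge p , Path-edge p₁
          edges₅ : ∀ {x y} → Path X x (y₀ ∷ xs) y → E X y₁ y₂ × E X y₂ z × E X z x₀ × E X x₀ x₁ × E X x₁ x₂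
          edges₅ (_ ∷ p₁@(_ ∷ p₂@(_ ∷ p₃@(_ ∷ p₄)))) = Path-edge p₁ , Path-edge p₂ , Path-edge p₃ , edges₁ p₄

      module At {τ : Fin n → Fin n} (τ-inj : Injective _≡_ _≡_ τ) (d-col : ∀ {v} → v ∈ ys → col (τ v) ≡ d)
                (c-col : ∀ {v} → v ∈ zs → col (τ v) ≡ c) where

        private
          ∈y₀ : y₀ ∈ ys
          ∈y₀ = here refl
          ∈y₂ : y₂ ∈ ys
          ∈y₂ = there (there (here refl))
          ∈e : e ∈ ys
          ∈e = there (there (there (here refl)))
          y₂≢e : y₂ ≢ e
          y₂≢e q = e∉ (there (there (here (≡sym q))))
          y₂≢y₀ : y₂ ≢ y₀
          y₂≢y₀ q = uniq-∉ (proj₁ cyc) (there (here (≡sym q)))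
          e≢y₀ : e ≢ y₀
          e≢y₀ q = e∉ (here q)

        open ThreeInCoset l₁≢l₂ l₁-c l₂-c b≤M τ τ-inj (y₂≢e ∘ τ-inj) (y₂≢y₀ ∘ τ-inj) (e≢y₀ ∘ τ-inj)
               (d-col ∈y₂) (d-col ∈e) (d-col ∈y₀)

        coset : ∀ {i j} → col i ≡ d → col j ≡ d → i ≈ j
        coset = all-coset (let e₀ , e₁ , e₂ , e₃ , e₄ , e₅ = edges (proj₁ (proj₂ (proj₂ (proj₂ cyc))))
                           in Spider.spider X col c≢d τ-inj u₈ e₀ e₁ e₂ e₃ e₄ e₅ ze d-col c-col)

        private
          θ : Fin n → Fin n
          θ = transpose (τ y₂) (τ e)
          qs rs : List (Fin n)
          qs = take q xs
          rs = drop q xs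
          split : qs ++ rs ≡ xs
          split = Listₚ.take++drop≡id q xs
          cyc′ : Cyclic X (y₀ ∷ qs ++ rs)
          cyc′ = subst (λ l → Cyclic X (y₀ ∷ l)) (≡sym split) cyc

        -- `θ` and the coset belong to `τ`, which has the colours that the spider needs. The
        -- rotation needs others and is run at `ρ`; its result is carried back to `τ`.
        turn : length qs ≡ q → odd q ≡ true → ∀ {ρ} → τ ⇝ ρ → (∀ {v} → v ∈ y₀ ∷ qs → col (ρ v) ≡ d) →
          (∀ {v} → v ∈ rs → col (ρ v) ≡ c) → τ ⇝ θ ∘ τ
        turn len oq {ρ} r d-col′ c-col′ = ⇝-conj θ-cp (⇝-sym r)
          (rotation {qs = qs} {rs} {θ} ρ-inj cyc′ (subst (λ l → odd (suc (length l)) ≡ true) (≡sym split) o)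
            (trans (cong odd len) oq) d-col′ c-col′ θ-cp (transpose-involutive (τ y₂) (τ e)) member)
          where
          ρ-inj : Injective _≡_ _≡_ ρ
          ρ-inj = ⇝-injective τ-inj r
          member : ∀ {v} → v ∈ qs → ρ ⇝ θ ∘ transpose (ρ y₀) (ρ v) ∘ ρ
          member {v} v∈ = [ (λ f → contradiction (subst (_∈ qs) (≡sym (ρ-inj f)) v∈) (uniq-∉ (uniq-++ˡ (y₀ ∷ qs) (proj₁ cyc′))))
                          , ⇝-conj (∘-cp θ-cp (transpose-cp same)) r ]′ (coset (d-col′ (here refl)) (d-col′ (there v∈)))
            where
            same : col (ρ y₀) ≡ col (ρ v)
            same = trans (d-col′ (here refl)) (≡sym (d-col′ (there v∈)))

        all-by-turn : odd q ≡ true → suc q ≤ length blanks → q ≤ length xs → length blanks + (length xs ∸ q) ≤ n →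
          ∀ {i j} → col i ≡ d → col j ≡ d → τ ⇝ transpose i j ∘ τ
        all-by-turn oq q<K q≤ le di dj =
          let ρ , r , d-col′ , c-col′ = place {y₀ ∷ qs} {rs} (uniq-++ˡ (y₀ ∷ qs) (proj₁ cyc′))
                (uniq-++-disjoint (y₀ ∷ qs) (proj₁ cyc′))
                (subst (λ k → suc k ≤ length blanks) (≡sym len) q<K)
                (subst (λ k → length blanks + k ≤ n) (≡sym (Listₚ.length-drop q xs)) le) τ τ-inj
          in all-exchangeable (turn len oq r d-col′ c-col′) (coset di dj)
          where
          len : length qs ≡ q
          len = trans (Listₚ.length-take q xs) (ℕₚ.m≤n⇒m⊓n≡m q≤)

      pure-by-many : 4 ≤ length blanks → length blanks + 4 ≤ n → odd q ≡ true → suc q ≤ length blanks →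
        q ≤ length xs → length blanks + (length xs ∸ q) ≤ n → ∀ {i j} → col i ≡ d → col j ≡ d → σ ⇝ transpose i j ∘ σ
      pure-by-many 4≤K K+4≤n oq q<K q≤ le di dj =
        let τ , r , d-col , c-col = place {ys} {zs} (uniq-++ˡ ys u₈′) (uniq-++-disjoint ys u₈′) 4≤K K+4≤n σ inj
        in ⇝-conj (transpose-cp (trans di (≡sym dj))) (⇝-sym r)
             (At.all-by-turn (⇝-injective inj r) d-col c-col oq q<K q≤ le di dj)

two-distinct : {xs : List A} → Unique xs → 2 ≤ length xs → ∃₂ λ x y → x ∈ xs × y ∈ xs × x ≢ y
two-distinct {xs = x ∷ y ∷ xs} u _ = x , y , here refl , there (here refl) , λ { refl → uniq-∉ u (here refl) }
two-distinct {xs = _ ∷ []} _ (s≤s ())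

-- `q + 1` is the largest even number up to `k`: of `k` tokens, all or all but one are put on the
-- cycle.
odd-below : ∀ k → 2 ≤ k → ∃ λ q → odd q ≡ true × suc q ≤ k × k ≤ 2 + q
odd-below (suc (suc k)) _ with odd k in eq
... | true = k , eq , s≤s (ℕₚ.n≤1+n k) , ℕₚ.≤-refl
... | false = suc k , cong not eq , ℕₚ.≤-refl , ℕₚ.n≤1+n _
odd-below (suc zero) (s≤s ())

-- The cycle is read from `z` and its last three vertices are moved to the front. The spider needs
-- three vertices on either side of `z`, whence the bound 7.
around : {X : Graph n} {Q : List (Fin n)} {z : Fin n} → Cyclic X Q → z ∈ Q → 7 ≤ length Q →
  ∃₂ λ y₀ y₁ → ∃₂ λ y₂ x₀ → ∃₂ λ x₁ x₂ → ∃ λ rest → let L = y₀ ∷ y₁ ∷ y₂ ∷ z ∷ x₀ ∷ x₁ ∷ x₂ ∷ rest in Cyclic X L × Q ↭ L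
around {X = X} {Q} {z} cyc z∈ 7≤ with ∈-∃++ z∈
... | as , bs , refl = shape front back refl refl len-back len-front
  where
  L = z ∷ bs ++ as
  k = length L ∸ 3
  front = take k L
  back = drop k L
  ↭L : as ++ z ∷ bs ↭ L
  ↭L = ↭ₚ.++-comm as (z ∷ bs)
  7≤L : 7 ≤ length L
  7≤L = subst (7 ≤_) (↭ₚ.↭-length ↭L) 7≤
  len-front : 4 ≤ length front
  len-front = subst (4 ≤_) (≡sym (trans (Listₚ.length-take k L) (ℕₚ.m≤n⇒m⊓n≡m (ℕₚ.m∸n≤m (length L) 3)))) (ℕₚ.∸-monoˡ-≤ 3 7≤L)
  len-back : length back ≡ 3
  len-back = trans (Listₚ.length-drop k L) (ℕₚ.m∸[m∸n]≡n (ℕₚ.≤-trans (s≤s (s≤s (s≤s z≤n))) 7≤L))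
  shape : ∀ fr bk → front ≡ fr → back ≡ bk → length bk ≡ 3 → 4 ≤ length fr →
    ∃₂ λ y₀ y₁ → ∃₂ λ y₂ x₀ → ∃₂ λ x₁ x₂ → ∃ λ rest → let L′ = y₀ ∷ y₁ ∷ y₂ ∷ z ∷ x₀ ∷ x₁ ∷ x₂ ∷ rest in
      Cyclic X L′ × as ++ z ∷ bs ↭ L′
  shape (z′ ∷ x₀ ∷ x₁ ∷ x₂ ∷ rest) (y₀ ∷ y₁ ∷ y₂ ∷ []) ef eb _ _ = y₀ , y₁ , y₂ , x₀ , x₁ , x₂ , rest ,
    subst (λ l → Cyclic X (y₀ ∷ y₁ ∷ y₂ ∷ l ∷ x₀ ∷ x₁ ∷ x₂ ∷ rest)) z′≡z
      (Cyclic-++ (z′ ∷ x₀ ∷ x₁ ∷ x₂ ∷ rest) (subst (Cyclic X) split (Cyclic-++ as cyc))) ,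
    subst (λ l → as ++ z ∷ bs ↭ y₀ ∷ y₁ ∷ y₂ ∷ l ∷ x₀ ∷ x₁ ∷ x₂ ∷ rest) z′≡z
      (↭-trans (subst (as ++ z ∷ bs ↭_) split ↭L)
        (↭ₚ.++-comm (z′ ∷ x₀ ∷ x₁ ∷ x₂ ∷ rest) (y₀ ∷ y₁ ∷ y₂ ∷ [])))
    where
    split : L ≡ (z′ ∷ x₀ ∷ x₁ ∷ x₂ ∷ rest) ++ y₀ ∷ y₁ ∷ y₂ ∷ []
    split = trans (≡sym (Listₚ.take++drop≡id k L)) (cong₂ _++_ ef eb)
    z′≡z : z′ ≡ z
    z′≡z = ≡sym (Listₚ.∷-injectiveˡ split)
  shape (_ ∷ []) _ _ _ _ (s≤s ())
  shape (_ ∷ _ ∷ []) _ _ _ _ (s≤s (s≤s ()))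
  shape (_ ∷ _ ∷ _ ∷ []) _ _ _ _ (s≤s (s≤s (s≤s ())))

-- Exchanging the labels of one part

module _ {n t : ℕ} (X : Graph n) (connected : Connected X) (¬cycle : ¬ IsCycle X) (col : Fin n → Fin t)
         (σ : Fin n → Fin n) (inj : Injective _≡_ _≡_ σ) where

  open Moves X col
  open Exchanges X col σ
  open Arrangement X col using (blanks)

  pure-equivalence : ∀ {c κ₁ κ₂} →
    (∀ {τ z x a b} → σ ⇝ τ → Unique (z ∷ x ∷ a ∷ b ∷ []) → E X z x → E X z a → E X z b →
      col (τ z) ≡ c → col (τ x) ≡ c → col (τ a) ≡ κ₁ → col (τ b) ≡ κ₂ → σ ⇝ transpose (τ z) (τ x) ∘ σ) →
    ClawEquivalence X col c κ₁ κ₂ σ Pure._≈_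
  pure-equivalence claw = record
    { ≈-refl = inj₁ refl
    ; ≈-sym = Pure.≈-sym
    ; ≈-trans = λ ci cj ck → Pure.≈-trans (trans ci (≡sym cj)) (trans cj (≡sym ck))
    ; claw = λ r u zx za zb cz cx ca cb → inj₂ (claw r u zx za zb cz cx ca cb)
    }

  exchange-many-colours : ∀ {c κ₁ κ₂ l₁ l₂ b} → κ₁ ≢ κ₂ → κ₁ ≢ c → κ₂ ≢ c → col l₁ ≡ κ₁ → col l₂ ≡ κ₂ →
    2 ≤ b → b ≤ length (blanks c) → ¬ HasBridge X b → ∀ {i j} → col i ≡ c → col j ≡ c → σ ⇝ transpose i j ∘ σ
  exchange-many-colours {c} {κ₁} {κ₂} {b = b} κ₁≢κ₂ κ₁≢c κ₂≢c k₁ k₂ 2≤b b≤ ¬bridge ci cj =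
    Pure.all-exchangeable ⇝-refl
      (Growth.all-equivalent X connected ¬cycle col c κ₁ κ₂ κ₁≢c κ₂≢c
        (λ { refl → κ₁≢κ₂ (trans (≡sym k₁) k₂) }) k₁ k₂ b 2≤b b≤ ¬bridge σ inj Pure._≈_
        (pure-equivalence λ r u zx za zb cz cx ca cb →
          ⇝-conj (transpose-cp (trans cz (≡sym cx))) (⇝-sym r)
            (Claw.exchange u zx za zb (⇝-injective inj r) (trans cx (≡sym cz))
              (λ q → κ₁≢c (trans (≡sym ca) (trans (≡sym q) cz))) (λ q → κ₂≢c (trans (≡sym cb) (trans (≡sym q) cz)))
              (λ q → κ₁≢κ₂ (trans (≡sym ca) (trans q cb))))) ci cj)

  module _ (¬bipartite : ¬ Bipartite X) {c d : Fin t} (c≢d : c ≢ d) (cover : ∀ l → col l ≡ c ⊎ col l ≡ d)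
           (total : length (blanks c) + length (blanks d) ≡ n) (2≤K : 2 ≤ length (blanks c))
           (K≤M : length (blanks c) ≤ length (blanks d)) (¬bridge : ¬ HasBridge X (length (blanks c))) where

    private
      K M : ℕ
      K = length (blanks c)
      M = length (blanks d)

      of-colour : ∀ {c d} → (∀ l → col l ≡ c ⊎ col l ≡ d) → ∀ {l} → l ∈ blanks d → col l ≡ c
      of-colour {c} {d} cover {l} m =
        [ id , (λ q → contradiction q (proj₂ (∈-filter⁻ (λ l → ¬? (col l ≟ d)) {xs = allFin n} m))) ]′ (cover l)

      two-of : ∀ {c d} → (∀ l → col l ≡ c ⊎ col l ≡ d) → 2 ≤ length (blanks d) →
        ∃₂ λ l₁ l₂ → l₁ ≢ l₂ × col l₁ ≡ c × col l₂ ≡ c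
      two-of {d = d} cover le =
        let l₁ , l₂ , m₁ , m₂ , ne = two-distinct (Uniqueₚ.filter⁺ (λ l → ¬? (col l ≟ d)) (Uniqueₚ.allFin⁺ n)) le
        in l₁ , l₂ , ne , of-colour cover m₁ , of-colour cover m₂

    open TwoColours X connected ¬cycle col c≢d cover K 2≤K ¬bridge

    private
      module Minority {l₁ l₂ : Fin n} (ne : l₁ ≢ l₂) (c₁ : col l₁ ≡ c) (c₂ : col l₂ ≡ c)
                      {Q : List (Fin n)} (cyc : Cyclic X Q) (o : odd (length Q) ≡ true)
                      {z e : Fin n} (z∈ : z ∈ Q) (e∉ : e ∉ Q) (ze : E X z e) where

        short : 3 ≤ length Q → length Q ≤ 2 + M → ∀ {i j} → col i ≡ d → col j ≡ d → σ ⇝ transpose i j ∘ σ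
        short 3≤ le = go Q cyc o 3≤ le
          where
          go : ∀ Q → Cyclic X Q → odd (length Q) ≡ true → 3 ≤ length Q → length Q ≤ 2 + M →
            ∀ {i j} → col i ≡ d → col j ≡ d → σ ⇝ transpose i j ∘ σ
          go (x₀ ∷ x₁ ∷ rs) cyc o _ (s≤s (s≤s le)) =
            pure-by-two ne c₁ c₂ K≤M inj cyc o 2≤K (subst (K + length rs ≤_) total (ℕₚ.+-monoʳ-≤ K le))
          go (_ ∷ []) _ _ (s≤s ()) _

        module Large (M+3≤N : M + 3 ≤ length Q) where

          N<n : length Q < n
          N<n = uniq-length≤ (uniq-∷ e∉ (proj₁ cyc))
          -- An edge leaves the cycle, so `length Q < n = K + M`, while `M + 3 ≤ length Q`.
          4≤K : 4 ≤ K
          4≤K = ℕₚ.+-cancelˡ-≤ M 4 K (subst₂ _≤_ (≡sym (ℕₚ.+-suc M 3)) (trans (≡sym total) (ℕₚ.+-comm K M)) (ℕₚ.≤-trans (s≤s M+3≤N) N<n))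
          4≤M : 4 ≤ M
          4≤M = ℕₚ.≤-trans 4≤K K≤M
          7≤N : 7 ≤ length Q
          7≤N = ℕₚ.≤-trans (ℕₚ.+-monoˡ-≤ 3 4≤M) M+3≤N

          module Turn {q : ℕ} (oq : odd q ≡ true) (q<K : suc q ≤ K) (K≤2+q : K ≤ 2 + q)
                      {y₀ y₁ y₂ x₀ x₁ x₂ : Fin n} {rest : List (Fin n)}
                      (cyc′ : Cyclic X (y₀ ∷ y₁ ∷ y₂ ∷ z ∷ x₀ ∷ x₁ ∷ x₂ ∷ rest))
                      (Q↭ : Q ↭ y₀ ∷ y₁ ∷ y₂ ∷ z ∷ x₀ ∷ x₁ ∷ x₂ ∷ rest) where

            len : length Q ≡ 7 + length rest
            len = ↭ₚ.↭-length Q↭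
            q≤ : q ≤ 6 + length rest
            q≤ = s≤s⁻¹ (ℕₚ.≤-trans q<K (ℕₚ.≤-trans K≤M (ℕₚ.≤-trans (ℕₚ.m≤m+n M 3) (subst (M + 3 ≤_) len M+3≤N))))
            -- With one vertex off the cycle and `K ≤ 2 + q`, the cycle has at most `q + 1 + M`
            -- vertices. Next to the `q + 1` tokens of colour `d`, the `M` others suffice to fill
            -- it.
            le : K + (6 + length rest ∸ q) ≤ n
            le = subst (K + (6 + length rest ∸ q) ≤_) total (ℕₚ.+-monoʳ-≤ K (ℕₚ.m≤n+o⇒m∸n≤o (6 + length rest) q
                   (s≤s⁻¹ (s≤s⁻¹ (ℕₚ.≤-trans (subst (λ k → suc k ≤ n) len N<n)
                     (subst (_≤ 2 + q + M) total (ℕₚ.+-monoˡ-≤ M K≤2+q)))))))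

            turn : ∀ {i j} → col i ≡ d → col j ≡ d → σ ⇝ transpose i j ∘ σ
            turn = Many.pure-by-many ne c₁ c₂ K≤M inj cyc′ (trans (cong odd (≡sym len)) o) (e∉ ∘ ↭ₚ.∈-resp-↭ (↭-sym Q↭)) ze
                     4≤K (subst (K + 4 ≤_) total (ℕₚ.+-monoʳ-≤ K 4≤M)) oq q<K q≤ le

          large : ∀ {i j} → col i ≡ d → col j ≡ d → σ ⇝ transpose i j ∘ σ
          large = let q , oq , q<K , K≤2+q = odd-below K 2≤K
                      y₀ , y₁ , y₂ , x₀ , x₁ , x₂ , rest , cyc′ , Q↭ = around cyc z∈ 7≤N
                  in Turn.turn oq q<K K≤2+q cyc′ Q↭

    -- Up to length `M + 2` the cycle can be filled with two tokens of colour `d` and otherwise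
    -- colour `c`. A longer one has both colours in sufficient number for the spider.
    exchange-minority : ∀ {i j} → col i ≡ d → col j ≡ d → σ ⇝ transpose i j ∘ σ
    exchange-minority {i} =
      let l₁ , l₂ , ne , c₁ , c₂ = two-of cover (ℕₚ.≤-trans 2≤K K≤M)
          Q , cyc , o , 3≤ , z , e , z∈ , e∉ , ze = non-bipartite⇒odd-cycle i connected ¬cycle ¬bipartite
      in [ (λ le → Minority.short ne c₁ c₂ cyc o z∈ e∉ ze 3≤ le)
         , (λ lt → Minority.Large.large ne c₁ c₂ cyc o z∈ e∉ ze (subst (_≤ length Q) (ℕₚ.+-comm 3 M) lt)) ]′
         (ℕₚ.≤-<-connex (length Q) (2 + M))

    exchange-majority : ∀ {i j} → col i ≡ c → col j ≡ c → σ ⇝ transpose i j ∘ σ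
    exchange-majority ci cj with two-of (swap ∘ cover) 2≤K
    ... | l₁ , l₂ , ne , d₁ , d₂ = Pure.all-exchangeable ⇝-refl
      (Growth.all-equivalent X connected ¬cycle col c d d (c≢d ∘ ≡sym) (c≢d ∘ ≡sym) ne d₁ d₂ K 2≤K ℕₚ.≤-refl ¬bridge
        σ inj Pure._≈_ (pure-equivalence claw) ci cj)
      where
      claw : ∀ {τ z x a b} → σ ⇝ τ → Unique (z ∷ x ∷ a ∷ b ∷ []) → E X z x → E X z a → E X z b →
        col (τ z) ≡ c → col (τ x) ≡ c → col (τ a) ≡ d → col (τ b) ≡ d → σ ⇝ transpose (τ z) (τ x) ∘ σ
      claw {τ} {z} {x} {a} {b} r u zx za zb cz cx da db =
        ⇝-respʳ (λ v → cong (transpose (τ z) (τ x)) (transpose-involutive (τ a) (τ b) (σ v)))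
          (⇝-comp (transpose (τ z) (τ x) ∘ transpose (τ a) (τ b)) (transpose (τ a) (τ b)) g-cp
            (⇝-conj g-cp (⇝-sym r) (Claw.exchange-both u zx za zb (⇝-injective inj r) (trans cx (≡sym cz))
              (λ q → c≢d (trans (≡sym cz) (trans q da))) (λ q → c≢d (trans (≡sym cz) (trans q db))) (trans db (≡sym da))))
            (exchange-minority da db))
        where
        g-cp : ColourPreserving (transpose (τ z) (τ x) ∘ transpose (τ a) (τ b))
        g-cp = ∘-cp (transpose-cp (trans cz (≡sym cx))) (transpose-cp (trans da (≡sym db)))

-- Part sizes and the final case distinction

length-filter-complement : {P : A → Set} (P? : ∀ x → Dec (P x)) (xs : List A) →
  length (filter P? xs) + length (filter (¬? ∘ P?) xs) ≡ length xs
length-filter-complement P? [] = refl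
length-filter-complement P? (x ∷ xs) with P? x
... | yes _ = cong suc (length-filter-complement P? xs)
... | no _ = trans (ℕₚ.+-suc _ _) (cong suc (length-filter-complement P? xs))

⇝⇒Exchangeable : ∀ {t} {X : Graph n} {p : Fin n → Fin t} {σ : Fin n → Fin n} {i j} →
  Moves._⇝_ X p σ (transpose i j ∘ σ) → Exchangeable (E X) (MultiAdj p) σ i j
⇝⇒Exchangeable {X = X} {p} {σ} {i} {j} = go
  where
  open Moves X p
  go : ∀ {σ τ} → σ ⇝ τ → Σ (Fin _ → Fin _) λ σ′ → Star (FriendlySwap (E X) (MultiAdj p)) σ σ′ × (∀ v → σ′ v ≡ τ v)
  go (done f) = _ , ε , f
  go {σ} (move a b e c r) with go r
  ... | σ′ , s , f = σ′ , (a , b , e , c , cong σ (transpose-ˡ a b) , cong σ (transpose-ʳ a b)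
                        , λ v v≢a v≢b → cong σ (transpose-≢ v≢a v≢b)) ◅ s , f

two-others : ∀ {m} → 2 ≤ m → (s : Fin (suc m)) → ∃₂ λ κ₁ κ₂ → κ₁ ≢ κ₂ × κ₁ ≢ s × κ₂ ≢ s
two-others (s≤s (s≤s _)) zero = suc zero , suc (suc zero) , (λ ()) , (λ ()) , λ ()
two-others (s≤s (s≤s _)) (suc zero) = zero , suc (suc zero) , (λ ()) , (λ ()) , λ ()
two-others (s≤s (s≤s _)) (suc (suc _)) = zero , suc zero , (λ ()) , (λ ()) , λ ()

module PartSizes {n t : ℕ} (X : Graph n) (p : Fin n → Fin t) where

  open Arrangement X p using (blanks)

  size+blanks : ∀ s → partSize p s + length (blanks s) ≡ n
  size+blanks s = trans (length-filter-complement (λ v → p v ≟ s) (allFin n)) (length-allFin n)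

  blanks≡ : ∀ s → length (blanks s) ≡ n ∸ partSize p s
  blanks≡ s = ≡sym (trans (cong (_∸ partSize p s) (≡sym (size+blanks s))) (ℕₚ.m+n∸m≡n (partSize p s) (length (blanks s))))

  inhabited : ∀ s → 1 ≤ partSize p s → ∃ λ l → p l ≡ s
  inhabited s le with filter (λ v → p v ≟ s) (allFin n) in eq
  inhabited s () | []
  ... | l ∷ _ = l , proj₂ (∈-filter⁻ (λ v → p v ≟ s) {xs = allFin n} (subst (l ∈_) (≡sym eq) (here refl)))

theorem3p1 : (m : ℕ) → 1 ≤ m → (k : Fin (suc m) → ℕ) →
    (∀ s → 1 ≤ k s) → (∀ s s' → s ≤ᶠ s' → k s ≤ k s') →
    (n : ℕ) → n ≡ sumFin k → 4 ≤ n →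
    (p : Fin n → Fin (suc m)) → (∀ s → partSize p s ≡ k s) →
    (X : Graph n) →
    ((m ≡ 1 × k (fromℕ m) < n ∸ 1 × Connected X × ¬ Bipartite X × ¬ IsCycle X
    × ¬ HasBridge X (k fz))
    ⊎ (2 ≤ m × Connected X × ¬ IsCycle X × ¬ IsTree X
    × ¬ HasBridge X (n ∸ k (fromℕ m)))) →
    (i j : Fin n) → (σ : Fin n → Fin n) → Bijective _≡_ _≡_ σ →
    Σ (Fin n) (λ a → Σ (Fin n) (λ b → σ a ≡ i × σ b ≡ j × E X a b)) →
    Exchangeable (E X) (MultiAdj p) σ i j
theorem3p1 m 1≤m k 1≤k mono n n≡ 4≤n p size X hyp i j σ (inj , _) (a , b , refl , refl , ab) = ⇝⇒Exchangeable (by-colour hyp)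
  where
  open Moves X p
  open PartSizes X p
  open Arrangement X p using (blanks; blanks-∈)
  two-parts : m ≡ 1 → k (fromℕ m) < n ∸ 1 → Connected X → ¬ Bipartite X → ¬ IsCycle X → ¬ HasBridge X (k fz) →
    p (σ a) ≡ p (σ b) → σ ⇝ transpose (σ a) (σ b) ∘ σ
  two-parts refl k₁< connected ¬bip ¬cycle ¬bridge same = by-part (p (σ a)) refl
    where
    total : k zero + k (suc zero) ≡ n
    total = ≡sym (trans n≡ (cong (k zero +_) (ℕₚ.+-identityʳ (k (suc zero)))))
    K≡ : length (blanks (suc zero)) ≡ k zero
    K≡ = ℕₚ.+-cancelˡ-≡ (k (suc zero)) _ _ (trans (cong (_+ length (blanks (suc zero))) (≡sym (size (suc zero))))
           (trans (size+blanks (suc zero)) (trans (≡sym total) (ℕₚ.+-comm (k zero) (k (suc zero))))))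
    M≡ : length (blanks zero) ≡ k (suc zero)
    M≡ = ℕₚ.+-cancelˡ-≡ (k zero) _ _ (trans (cong (_+ length (blanks zero)) (≡sym (size zero)))
           (trans (size+blanks zero) (≡sym total)))
    -- A smaller part with one label would leave `n ∸ 1` labels to the other part, which `k₁<`
    -- excludes.
    2≤k₀ : 2 ≤ k zero
    2≤k₀ with k zero | total | 1≤k zero
    ... | suc zero | t | _ = contradiction (subst (k (suc zero) <_) (cong (_∸ 1) (≡sym t)) k₁<) (ℕₚ.<-irrefl refl)
    ... | suc (suc _) | _ | _ = s≤s (s≤s z≤n)
    parts : ∀ l → p l ≡ suc zero ⊎ p l ≡ zero
    parts l with p l
    ... | zero = inj₂ refl
    ... | suc zero = inj₁ refl
    -- The smaller part `zero` takes the role of `d` and the larger part `suc zero` that of `c`. The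
    -- blanks for `c` then number `k zero`, the length of the excluded bridge.
    by-part : ∀ s → p (σ a) ≡ s → σ ⇝ transpose (σ a) (σ b) ∘ σ
    by-part zero e = exchange-minority X connected ¬cycle p σ inj ¬bip (λ ()) parts
      (trans (cong₂ _+_ K≡ M≡) total) (subst (2 ≤_) (≡sym K≡) 2≤k₀) (subst₂ _≤_ (≡sym K≡) (≡sym M≡) (mono zero (suc zero) z≤n))
      (subst (λ k → ¬ HasBridge X k) (≡sym K≡) ¬bridge) e (trans (≡sym same) e)
    by-part (suc zero) e = exchange-majority X connected ¬cycle p σ inj ¬bip (λ ()) parts
      (trans (cong₂ _+_ K≡ M≡) total) (subst (2 ≤_) (≡sym K≡) 2≤k₀) (subst₂ _≤_ (≡sym K≡) (≡sym M≡) (mono zero (suc zero) z≤n))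
      (subst (λ k → ¬ HasBridge X k) (≡sym K≡) ¬bridge) e (trans (≡sym same) e)
  more-parts : 2 ≤ m → Connected X → ¬ IsCycle X → ¬ HasBridge X (n ∸ k (fromℕ m)) →
    p (σ a) ≡ p (σ b) → σ ⇝ transpose (σ a) (σ b) ∘ σ
  more-parts 2≤m connected ¬cycle ¬bridge same
    with two-others 2≤m (p (σ a)) | two-others 2≤m (fromℕ m)
  ... | κ₁ , κ₂ , κ₁≢κ₂ , κ₁≢ , κ₂≢ | λ₁ , λ₂ , λ₁≢λ₂ , λ₁≢ , λ₂≢ =
    exchange-many-colours X connected ¬cycle p σ inj κ₁≢κ₂ κ₁≢ κ₂≢
      (proj₂ (label κ₁)) (proj₂ (label κ₂)) 2≤b b≤ ¬bridge refl (≡sym same)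
    where
    label : ∀ s → ∃ λ l → p l ≡ s
    label s = inhabited s (subst (1 ≤_) (≡sym (size s)) (1≤k s))
    blanks-size : ∀ s → length (blanks s) ≡ n ∸ k s
    blanks-size s = trans (blanks≡ s) (cong (n ∸_) (size s))
    -- Each of two parts other than the last contributes a label.
    2≤b : 2 ≤ n ∸ k (fromℕ m)
    2≤b = subst (2 ≤_) (blanks-size (fromℕ m)) (uniq-⊆-length {xs = proj₁ (label λ₁) ∷ proj₁ (label λ₂) ∷ []}
      (uniq-∷ (λ { (here q) → λ₁≢λ₂ (trans (≡sym (proj₂ (label λ₁))) (trans (cong p q) (proj₂ (label λ₂)))) }) (uniq-∷ (λ ()) []))
      λ { (here refl) → blanks-∈ (fromℕ m) (λ q → λ₁≢ (trans (≡sym (proj₂ (label λ₁))) q))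
        ; (there (here refl)) → blanks-∈ (fromℕ m) (λ q → λ₂≢ (trans (≡sym (proj₂ (label λ₂))) q)) })
    -- The last part is the largest and leaves the fewest blanks, so its bridge length suits every
    -- part.
    b≤ : n ∸ k (fromℕ m) ≤ length (blanks (p (σ a)))
    b≤ = subst (n ∸ k (fromℕ m) ≤_) (≡sym (blanks-size (p (σ a)))) (ℕₚ.∸-monoʳ-≤ n (mono _ (fromℕ m) (Finₚ.≤fromℕ (p (σ a)))))
  by-colour : _ → σ ⇝ transpose (σ a) (σ b) ∘ σ
  by-colour hyp with p (σ a) ≟ p (σ b) | hyp
  ... | no ne | _ = ⇝-respʳ (transpose-natural inj a b) (⇝-move ab ne)
  ... | yes e | inj₁ (m≡1 , k< , connected , ¬bip , ¬cycle , ¬bridge) = two-parts m≡1 k< connected ¬bip ¬cycle ¬bridge e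
  ... | yes e | inj₂ (2≤m , connected , ¬cycle , _ , ¬bridge) = more-parts 2≤m connected ¬cycle ¬bridge e
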